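{- Suppose there is a constant $\varepsilon>0$ and an algorithm which, given any $m$-edge undirected unweighted graph of diameter $D$, runs in $O(m^{2-\varepsilon})$ time (for every $m$) and outputs an estimate $\hat D$ with $D/(3/2-\varepsilon)\le \hat D\le D$. Then there is a constant $\delta>0$ such that satisfiability of CNF formulas on $n$ variables can be decided in $O^{*}((2-\delta)^n)$ time.
   Context: The diameter of a graph is the maximum over ordered pairs of vertices of the shortest-path distance. $O^{*}(f(n))$ denotes $O(f(n)\cdot \mathrm{poly}(n))$ (polynomial also in the formula size). -}

module Defs where

open import Algebra.Definitions.RawSemiring as RawSemiringDefs using ()
open import Data.Bool.Base using (Bool; true; false; if_then_else_)
open import Data.Fin.Base as Fin using (Fin; toℕ)
open import Data.Integer.Base as ℤ using (+_)
open import Data.List.Base using (List; []; _∷_; length; map; concatMap)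
open import Data.List.Membership.Propositional using (_∈_)
open import Data.List.Relation.Unary.All using (All)
open import Data.List.Relation.Unary.Any using (Any)
open import Data.List.Relation.Unary.Unique.Propositional using (Unique)
open import Data.Nat.Base using (ℕ; zero; suc; _+_; _*_; _∸_; _/_; _^_; _≤_; _<_)
open import Data.Nat.Properties using (_≟_)
open import Data.Product.Base using (_×_; _,_; ∃; ∃-syntax; proj₁; proj₂)
open import Data.Rational.Base as ℚ using (ℚ; ↥_; ↧ₙ_)
open import Data.Sum.Base using (_⊎_)
open import Function.Bundles using (_⇔_)
open import Relation.Binary.PropositionalEquality using (_≡_; _≢_)
open import Relation.Nullary.Decidable using (does)
open import Relation.Nullary.Negation using (¬_)

open RawSemiringDefs ℚ.+-*-rawSemiring using () renaming (_^_ to _^ℚ_)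

fromℕ : ℕ → ℚ
fromℕ n = + n ℚ./ 1

------------------------------------------------------------------------
-- Word RAM
--
-- The machine model is the unit-cost RAM with O(log N)-bit words, N being
-- the scale of the instance.  Programs are structured; goto programs can be
-- simulated with constant-factor overhead by a single loop that dispatches
-- on a program counter.

Reg : Set
Reg = ℕ

data Op : Set where
  add sub mul div : Op

-- Subtraction is truncated, and division by zero yields zero.
⟦_⟧ : Op → ℕ → ℕ → ℕ
⟦ add ⟧ x y       = x + y
⟦ sub ⟧ x y       = x ∸ y
⟦ mul ⟧ x y       = x * y
⟦ div ⟧ x zero    = 0
⟦ div ⟧ x (suc y) = x / suc y

infixr 5 _⨾_

data Program : Set where
  skip  : Program
  const : (r : Reg) (k : ℕ) → Program                -- r ← k
  arith : (o : Op) (r a b : Reg) → Program           -- r ← a o b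
  load  : (r a : Reg) → Program                      -- r ← mem[a]
  store : (a b : Reg) → Program                      -- mem[a] ← b
  _⨾_   : (P Q : Program) → Program
  ifnz  : (r : Reg) (P Q : Program) → Program        -- P if r ≠ 0, else Q
  while : (r : Reg) (P : Program) → Program          -- repeat P as long as r ≠ 0

record State : Set where
  constructor state
  field
    reg : Reg → ℕ
    mem : ℕ → ℕ

open State public

_[_↦_] : (ℕ → ℕ) → ℕ → ℕ → ℕ → ℕ
(f [ i ↦ v ]) j = if does (i ≟ j) then v else f j

setReg : Reg → ℕ → State → State
setReg r v s = state (reg s [ r ↦ v ]) (mem s)

setMem : ℕ → ℕ → State → State
setMem i v s = state (reg s) (mem s [ i ↦ v ])

infix 4 _⊢_∶_⇓[_]_

-- W ⊢ P ∶ s ⇓[ t ] s′ : started in s, the program P halts in s′ after t unit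
-- steps, and never produces a value outside the word range 0, …, W - 1.
-- There is no wrap-around: an operation that would overflow has no successor
-- state, so an algorithm must run without overflow.
data _⊢_∶_⇓[_]_ (W : ℕ) : Program → State → ℕ → State → Set where
  ⇓skip  : ∀ {s} → W ⊢ skip ∶ s ⇓[ 1 ] s
  ⇓const : ∀ {s r k} → k < W →
           W ⊢ const r k ∶ s ⇓[ 1 ] setReg r k s
  ⇓arith : ∀ {s o r a b} → ⟦ o ⟧ (reg s a) (reg s b) < W →
           W ⊢ arith o r a b ∶ s ⇓[ 1 ] setReg r (⟦ o ⟧ (reg s a) (reg s b)) s
  ⇓load  : ∀ {s r a} → mem s (reg s a) < W →
           W ⊢ load r a ∶ s ⇓[ 1 ] setReg r (mem s (reg s a)) s
  ⇓store : ∀ {s a b} →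
           W ⊢ store a b ∶ s ⇓[ 1 ] setMem (reg s a) (reg s b) s
  ⇓seq   : ∀ {s s′ s″ P Q t u} →
           W ⊢ P ∶ s ⇓[ t ] s′ → W ⊢ Q ∶ s′ ⇓[ u ] s″ →
           W ⊢ P ⨾ Q ∶ s ⇓[ t + u ] s″
  ⇓then  : ∀ {s s′ r P Q t} → reg s r ≢ 0 →
           W ⊢ P ∶ s ⇓[ t ] s′ →
           W ⊢ ifnz r P Q ∶ s ⇓[ 1 + t ] s′
  ⇓else  : ∀ {s s′ r P Q t} → reg s r ≡ 0 →
           W ⊢ Q ∶ s ⇓[ t ] s′ →
           W ⊢ ifnz r P Q ∶ s ⇓[ 1 + t ] s′
  ⇓loop  : ∀ {s s′ s″ r P t u} → reg s r ≢ 0 →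
           W ⊢ P ∶ s ⇓[ t ] s′ → W ⊢ while r P ∶ s′ ⇓[ u ] s″ →
           W ⊢ while r P ∶ s ⇓[ 1 + t + u ] s″
  ⇓exit  : ∀ {s r P} → reg s r ≡ 0 →
           W ⊢ while r P ∶ s ⇓[ 1 ] s

cell : List ℕ → ℕ → ℕ
cell []       _       = 0
cell (x ∷ xs) zero    = x
cell (x ∷ xs) (suc i) = cell xs i

-- The input occupies the first memory cells; everything else is zero.
initial : List ℕ → State
initial input = state (λ _ → 0) (cell input)

-- The output is read from register 0.
Run : (W : ℕ) → Program → (input : List ℕ) (output t : ℕ) → Set
Run W P input output t =
  ∃[ s ] (W ⊢ P ∶ initial input ⇓[ t ] s) × reg s 0 ≡ output

-- Word range for O(log N)-bit words, with c the constant in the O(·).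
wordRange : (c N : ℕ) → ℕ
wordRange c N = (2 + N) ^ c

------------------------------------------------------------------------
-- Graphs and diameter

-- A finite simple undirected graph.  Each edge {u , v} is listed exactly
-- once, as the pair with u < v; the order of the list is arbitrary.
record Graph : Set where
  field
    order  : ℕ
    edges  : List (Fin order × Fin order)
    sorted : All (λ e → proj₁ e Fin.< proj₂ e) edges
    unique : Unique edges

  Vertex : Set
  Vertex = Fin order

  size : ℕ
  size = length edges

  Adjacent : Vertex → Vertex → Set
  Adjacent u v = (u , v) ∈ edges ⊎ (v , u) ∈ edges

  data Walk : Vertex → Vertex → ℕ → Set where
    nil  : ∀ {u} → Walk u u 0
    cons : ∀ {u v w l} → Adjacent u v → Walk v w l → Walk u w (suc l)

  IsDistance : Vertex → Vertex → ℕ → Set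
  IsDistance u v d = Walk u v d × (∀ l → l < d → ¬ Walk u v l)

  -- Holds for some D exactly when the graph is nonempty and connected.
  IsDiameter : ℕ → Set
  IsDiameter D =
    (∀ u v → ∃[ d ] IsDistance u v d × d ≤ D) ×
    (∃[ u ] ∃[ v ] IsDistance u v D)

encodeGraph : Graph → List ℕ
encodeGraph G =
  order ∷ size ∷ concatMap (λ e → toℕ (proj₁ e) ∷ toℕ (proj₂ e) ∷ []) edges
  where open Graph G

-- t ≤ C · m^(2-ε) for ε = p/q > 0, raised to the power q and multiplied by
-- m^p.  No constraint on t when m = 0.
TimeBound : (ε : ℚ) (C m t : ℕ) → Set
TimeBound ε C m t = t ^ q * m ^ p ≤ C ^ q * m ^ (2 * q)
  where
  p = ℤ.∣ ↥ ε ∣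
  q = ↧ₙ ε

-- D / (3/2 - ε) ≤ D̂ ≤ D.  Multiplying out the first inequality matters only
-- for ε ≥ 3/2, where the quotient is meaningless; there no D > 0 has a valid
-- estimate.
IsEstimate : (ε : ℚ) (D D̂ : ℕ) → Set
IsEstimate ε D D̂ =
  fromℕ D ℚ.≤ (+ 3 ℚ./ 2 ℚ.- ε) ℚ.* fromℕ D̂ × D̂ ≤ D

ApproximatesDiameter : (ε : ℚ) → Program → Set
ApproximatesDiameter ε P =
  ∃[ c ] ∃[ C ] ((G : Graph) → let open Graph G in
    ∀ D → IsDiameter D →
    ∃[ D̂ ] ∃[ t ]
      Run (wordRange c (order + size)) P (encodeGraph G) D̂ t ×
      IsEstimate ε D D̂ ×
      TimeBound ε C size t)

------------------------------------------------------------------------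
-- CNF satisfiability

-- The literal (x , true) is the variable x, and (x , false) its negation.
Literal : ℕ → Set
Literal n = Fin n × Bool

Clause : ℕ → Set
Clause n = List (Literal n)

CNF : ℕ → Set
CNF n = List (Clause n)

Satisfies : ∀ {n} → (Fin n → Bool) → CNF n → Set
Satisfies α = All (Any (λ l → α (proj₁ l) ≡ proj₂ l))

Satisfiable : ∀ {n} → CNF n → Set
Satisfiable φ = ∃[ α ] Satisfies α φ

bit : Bool → ℕ
bit b = if b then 1 else 0

encodeLiteral : ∀ {n} → Literal n → ℕ
encodeLiteral (x , b) = 2 * toℕ x + bit b

encodeClause : ∀ {n} → Clause n → List ℕ
encodeClause κ = length κ ∷ map encodeLiteral κ

encodeCNF : ∀ {n} → CNF n → List ℕ
encodeCNF {n} φ = n ∷ length φ ∷ concatMap encodeClause φ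

-- Variables need not occur in the formula, hence the summand n.
formulaSize : ∀ {n} → CNF n → ℕ
formulaSize {n} φ = n + length (encodeCNF φ)

-- Satisfiability is decided in time O((2-δ)^n · poly(size)).  Words have
-- O(n + log size) bits, enough to address exponentially large memory.
DecidesSAT : (δ : ℚ) → Program → Set
DecidesSAT δ P =
  ∃[ c ] ∃[ C ] ∃[ k ] (∀ n (φ : CNF n) →
    ∃[ b ] ∃[ t ]
      Run (wordRange c (2 ^ n * formulaSize φ)) P (encodeCNF φ) (bit b) t ×
      (b ≡ true ⇔ Satisfiable φ) ×
      fromℕ t ℚ.≤
        fromℕ (C * formulaSize φ ^ k) ℚ.* (fromℕ 2 ℚ.- δ) ^ℚ n)

{-# OPTIONS --safe #-}

-- Split the variables into two halves of size h = ⌈n/2⌉ and build a graph with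
-- a vertex for each of the 2^h assignments of either half, and a vertex for
-- each clause, adjacent to the assignments that falsify it.  Two further
-- vertices, the hubs, are adjacent to each other and to all clause vertices,
-- and each is adjacent to all assignments of one half.  Any two vertices are at
-- distance at most 2, except for two assignments of different halves without
-- a common falsified clause, that is, assignments that together satisfy the
-- formula: these are at distance 3.  Hence an estimate better than 3/2 decides
-- satisfiability, in time O(m^(2 - ε)) for m = 2^(n/2) · poly.
--
-- The RAM program writes this graph behind the formula and then runs the given
-- program with its registers and addresses shifted.  The graph is written by
-- code compiled from arithmetic expressions with bounded loops, for which
-- running time and word size are bounded once and for all.

module Submission where

open import Defs
open import Algebra.Definitions.RawSemiring as RawSemiringDefs using ()
open import Data.Bool.Base using (Bool; true; false; if_then_else_; _∨_; _∧_; T)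
import Data.Bool.Properties as Bool
open import Data.Fin.Base using (Fin; zero; suc; toℕ; fromℕ<)
open import Data.Fin.Patterns using (0F; 1F; 2F; 3F)
import Data.Fin.Properties as Fin
import Data.Integer.Base as ℤ
import Data.Integer.Properties as ℤ
open import Data.List.Base using (List; []; _∷_; length; map; drop; tabulate; concatMap; _++_)
open import Data.List.Membership.DecPropositional using (_∈?_)
open import Data.List.Membership.Propositional using (_∈_)
open import Data.List.Membership.Propositional.Properties using (∈-tabulate⁺; ∈-tabulate⁻)
open import Data.List.Properties using (length-++; length-map; length-tabulate; drop-all)
import Data.List.Relation.Unary.All as All
import Data.List.Relation.Unary.All.Properties as All
open import Data.List.Relation.Unary.Any using (Any; here; there)
import Data.List.Relation.Unary.Any as Any
import Data.List.Relation.Unary.Unique.Propositional.Properties as Unique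
open import Data.Nat.Base
open import Data.Nat.DivMod hiding (result)
open import Data.Nat.Divisibility using (∣-refl; divides-refl)
open import Data.Nat.Properties
open import Data.Nat.Tactic.RingSolver using (solve-∀)
open import Data.Product.Base using (_×_; _,_; ∃-syntax; proj₁; proj₂)
import Data.Product.Properties as Product
import Data.Rational.Base as ℚ
import Data.Rational.Properties as ℚ
open import Data.Rational.Unnormalised.Base as ℚᵘ using (mkℚᵘ)
import Data.Rational.Unnormalised.Properties as ℚᵘ
open import Data.Sum.Base using (_⊎_; inj₁; inj₂; swap; [_,_]′)
open import Data.Unit.Base using (⊤; tt)
open import Data.Vec.Base using (Vec; []; _∷_; lookup)
open import Function.Base using (_∘_)
open import Function.Bundles using (_⇔_; mk⇔; Equivalence)
open import Relation.Binary.Definitions using (tri<; tri≈; tri>)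
open import Relation.Binary.PropositionalEquality
open import Relation.Nullary.Decidable using (Dec; yes; no; map′; toWitness; dec-true; dec-false; _⊎-dec_; _×-dec_)
open import Relation.Nullary.Negation using (¬_; contradiction)

open RawSemiringDefs ℚ.+-*-rawSemiring using () renaming (_^_ to _^ℚ_)

-- Running and relocating programs

-- With ε = p/q and p ≥ 1, halving the variables leads to a cost of 2^(1 - 1/(2q)) per variable.
-- This base is irrational, so Bernoulli's inequality replaces it by 2 - 1/(2q), which gives δ =
-- 1/(2q).
--
-- The machine model shapes the rest. An operation that overflows has no successor state, so
-- correctness of a program cannot be separated from bounds on all its intermediate values. The
-- given program expects zero registers and zero memory behind its input, so the code that writes
-- the graph must leave high registers and the cells behind the graph untouched. The edge list may
-- not contain repetitions, so edge k is given by a formula that is injective in k and that a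
-- counting loop can evaluate.
--
-- Variables are split by parity rather than into two blocks: one formula then serves both halves,
-- and both have the same number of assignments even for odd n.

update-same : ∀ f i {v} → (f [ i ↦ v ]) i ≡ v
update-same f i rewrite dec-true (i ≟ i) refl = refl

update-other : ∀ f {i j v} → i ≢ j → (f [ i ↦ v ]) j ≡ f j
update-other f {i} {j} i≢j rewrite dec-false (i ≟ j) i≢j = refl

update-cong : ∀ i {v} {f g : ℕ → ℕ} → (∀ j → f j ≡ g j) → ∀ j → (f [ i ↦ v ]) j ≡ (g [ i ↦ v ]) j
update-cong i {f = f} {g} eq j with i ≟ j
... | yes refl = trans (update-same f i) (sym (update-same g i))
... | no  i≢j  = trans (update-other f i≢j) (trans (eq j) (sym (update-other g i≢j)))

-- A total-correctness triple with a time budget. Since `b` is only an upper bound, budgets of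
-- consecutive programs can be added and rounded up to closed forms.
Exec : ℕ → Program → State → ℕ → (State → Set) → Set
Exec W P s b Q = ∃[ t ] ∃[ s′ ] (W ⊢ P ∶ s ⇓[ t ] s′) × t ≤ b × Q s′

exec-seq : ∀ {W P P′ s b b′ Q Q′} → Exec W P s b Q → (∀ {s′} → Q s′ → Exec W P′ s′ b′ Q′) →
           Exec W (P ⨾ P′) s (b + b′) Q′
exec-seq (_ , _ , p , t≤ , q) next with _ , s″ , p′ , t′≤ , q′ ← next q =
  _ , s″ , ⇓seq p p′ , +-mono-≤ t≤ t′≤ , q′

exec-loop : ∀ {W r P s b b′ Q Q′} → reg s r ≢ 0 → Exec W P s b Q →
            (∀ {s′} → Q s′ → Exec W (while r P) s′ b′ Q′) → Exec W (while r P) s (1 + b + b′) Q′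
exec-loop r≢0 (_ , _ , p , t≤ , q) next with _ , s″ , p′ , t′≤ , q′ ← next q =
  _ , s″ , ⇓loop r≢0 p p′ , s≤s (+-mono-≤ t≤ t′≤) , q′

exec-map : ∀ {W P s b Q Q′} → Exec W P s b Q → (∀ {s′} → Q s′ → Q′ s′) → Exec W P s b Q′
exec-map (t , s′ , p , t≤ , q) f = t , s′ , p , t≤ , f q

exec-weaken : ∀ {W P s b b′ Q} → b ≤ b′ → Exec W P s b Q → Exec W P s b′ Q
exec-weaken b≤ (t , s′ , p , t≤ , q) = t , s′ , p , ≤-trans t≤ b≤ , q

-- Registers from `offset` on hold the registers of the relocated program.
offset : ℕ
offset = 64

-- The base address lives in register 0, and register 1 is scratch.
relocate : Program → Program
relocate skip            = skip
relocate (const r k)     = const (offset + r) k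
relocate (arith o r a b) = arith o (offset + r) (offset + a) (offset + b)
relocate (load r a)      = arith add 1 0 (offset + a) ⨾ load (offset + r) 1
relocate (store a b)     = arith add 1 0 (offset + a) ⨾ store 1 (offset + b)
relocate (P ⨾ Q)         = relocate P ⨾ relocate Q
relocate (ifnz r P Q)    = ifnz (offset + r) (relocate P) (relocate Q)
relocate (while r P)     = while (offset + r) (relocate P)

-- Register 1 stays unconstrained because every address computation overwrites it, and nothing is
-- said about memory below the base, where the formula lies.
record Relocated (B : ℕ) (s s′ : State) : Set where
  field
    base      : reg s′ 0 ≡ B
    registers : ∀ r → reg s′ (offset + r) ≡ reg s r
    memory    : ∀ a → mem s′ (B + a) ≡ mem s a

open Relocated

update-+ : ∀ B {f g : ℕ → ℕ} i v → (∀ j → g (B + j) ≡ f j) →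
           ∀ j → (g [ B + i ↦ v ]) (B + j) ≡ (f [ i ↦ v ]) j
update-+ B {f} {g} i v eq j with i ≟ j
... | yes refl = trans (update-same g (B + i)) (sym (update-same f i))
... | no  i≢j  = trans (update-other g (λ e → i≢j (+-cancelˡ-≡ B i j e)))
                   (trans (eq j) (sym (update-other f i≢j)))

Small : ℕ → State → Set
Small W s = ∀ r → reg s r < W

small-set : ∀ {W} s r {v} → v < W → Small W s → Small W (setReg r v s)
small-set s r v<W small x with r ≟ x
... | yes refl = subst (_< _) (sym (update-same (reg s) r)) v<W
... | no  r≢x  = subst (_< _) (sym (update-other (reg s) r≢x)) (small x)

-- Each register write checks the word range. Relocated `load` and `store` rely on this: they
-- compute base plus address without overflow, while the semantics puts no bound of its own on
-- addresses.
exec-small : ∀ {W P s t s′} → W ⊢ P ∶ s ⇓[ t ] s′ → Small W s → Small W s′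
exec-small ⇓skip sm = sm
exec-small (⇓const {s} {r} lt) sm = small-set s r lt sm
exec-small (⇓arith {s} {r = r} lt) sm = small-set s r lt sm
exec-small (⇓load {s} {r} lt) sm = small-set s r lt sm
exec-small ⇓store sm = sm
exec-small (⇓seq p q) sm = exec-small q (exec-small p sm)
exec-small (⇓then _ p) sm = exec-small p sm
exec-small (⇓else _ p) sm = exec-small p sm
exec-small (⇓loop _ p q) sm = exec-small q (exec-small p sm)
exec-small (⇓exit _) sm = sm

relocated-setReg : ∀ {B s s′} r v → Relocated B s s′ →
                   Relocated B (setReg r v s) (setReg (offset + r) v s′)
relocated-setReg r v R .base = R .base
relocated-setReg {s = s} {s′} r v R .registers =
  update-+ offset {reg s} {reg s′} r v (R .registers)
relocated-setReg r v R .memory = R .memory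

relocated-scratch : ∀ {B s s′} v → Relocated B s s′ → Relocated B s (setReg 1 v s′)
relocated-scratch v R .base = R .base
relocated-scratch v R .registers = R .registers
relocated-scratch v R .memory = R .memory

module _ {W W′ B : ℕ} (fits : B + W ≤ W′) where

  private
    widen : ∀ {v} → v < W → v < W′
    widen lt = <-≤-trans lt (m+n≤o⇒n≤o B fits)

    address : ∀ {s s′} a → Small W s → Relocated B s s′ →
              reg s′ 0 + reg s′ (offset + a) < W′
    address {s} {s′} a sm R = subst₂ (λ x y → x + y < W′) (sym (R .base)) (sym (R .registers a))
      (<-≤-trans (+-monoʳ-< B (sm a)) fits)

  -- The factor 2 pays for `load` and `store`, which become two instructions each; `fits` leaves
  -- room in a word for a shifted address.
  simulate : ∀ {P s t s₁} → W ⊢ P ∶ s ⇓[ t ] s₁ → ∀ {s′} → Small W s → Relocated B s s′ →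
             Exec W′ (relocate P) s′ (2 * t) (Relocated B s₁)
  simulate ⇓skip sm R = _ , _ , ⇓skip , s≤s z≤n , R
  simulate (⇓const lt) sm R = _ , _ , ⇓const (widen lt) , s≤s z≤n , relocated-setReg _ _ R
  simulate (⇓arith {o = o} {r} {a} {b} lt) {s′} sm R
    with e ← cong₂ ⟦ o ⟧ (R .registers a) (R .registers b) =
    _ , _ , ⇓arith (subst (_< W′) (sym e) (widen lt)) , s≤s z≤n ,
    subst (λ v → Relocated B _ (setReg (offset + r) v s′)) (sym e) (relocated-setReg r _ R)
  simulate (⇓load {r = r} {a} lt) {s′} sm R
    with e ← trans (cong (mem s′) (cong₂ _+_ (R .base) (R .registers a))) (R .memory _) =
    _ , _ , ⇓seq (⇓arith (address a sm R)) (⇓load (subst (_< W′) (sym e) (widen lt))) , s≤s (s≤s z≤n) ,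
    subst (λ v → Relocated B _ (setReg (offset + r) v (setReg 1 _ s′))) (sym e)
      (relocated-setReg r _ (relocated-scratch _ R))
  simulate (⇓store {s} {a} {b}) {s′} sm R =
    _ , _ , ⇓seq (⇓arith (address a sm R)) ⇓store , s≤s (s≤s z≤n) , stored
    where
    stored : Relocated B (setMem (reg s a) (reg s b) s)
               (setMem (reg s′ 0 + reg s′ (offset + a)) (reg s′ (offset + b)) (setReg 1 (reg s′ 0 + reg s′ (offset + a)) s′))
    stored .base = R .base
    stored .registers = R .registers
    stored .memory rewrite R .base | R .registers a | R .registers b =
      update-+ B {mem s} {mem s′} (reg s a) (reg s b) (R .memory)
  simulate (⇓seq {t = t} {u} p q) sm R
    with t₁ , _ , p′ , t₁≤ , R₁ ← simulate p sm R
    with t₂ , _ , q′ , t₂≤ , R₂ ← simulate q (exec-small p sm) R₁ =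
    _ , _ , ⇓seq p′ q′ , subst (t₁ + t₂ ≤_) (sym (*-distribˡ-+ 2 t u)) (+-mono-≤ t₁≤ t₂≤) , R₂
  simulate (⇓then {t = t} r≢0 p) sm R
    with t₁ , _ , p′ , t₁≤ , R₁ ← simulate p sm R =
    _ , _ , ⇓then (λ e → r≢0 (trans (sym (R .registers _)) e)) p′ ,
    subst (suc t₁ ≤_) (sym (*-suc 2 t)) (m≤n⇒m≤1+n (s≤s t₁≤)) , R₁
  simulate (⇓else {t = t} r≡0 p) sm R
    with t₁ , _ , p′ , t₁≤ , R₁ ← simulate p sm R =
    _ , _ , ⇓else (trans (R .registers _) r≡0) p′ ,
    subst (suc t₁ ≤_) (sym (*-suc 2 t)) (m≤n⇒m≤1+n (s≤s t₁≤)) , R₁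
  simulate (⇓loop {t = t} {u} r≢0 p q) sm R
    with t₁ , _ , p′ , t₁≤ , R₁ ← simulate p sm R
    with t₂ , _ , q′ , t₂≤ , R₂ ← simulate q (exec-small p sm) R₁ =
    _ , _ , ⇓loop (λ e → r≢0 (trans (sym (R .registers _)) e)) p′ q′ ,
    subst (suc (t₁ + t₂) ≤_) (sym (*-suc 2 (t + u)))
      (m≤n⇒m≤1+n (s≤s (subst (t₁ + t₂ ≤_) (sym (*-distribˡ-+ 2 t u)) (+-mono-≤ t₁≤ t₂≤)))) , R₂
  simulate (⇓exit r≡0) sm R = _ , _ , ⇓exit (trans (R .registers _) r≡0) , s≤s z≤n , R

-- For a concrete program the condition reduces to a product of unit types. It serves to show that
-- the registers of the relocated program are still zero once the graph has been written.
Writes< : ℕ → Program → Set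
Writes< R skip            = ⊤
Writes< R (const r k)     = T (r <ᵇ R)
Writes< R (arith o r a b) = T (r <ᵇ R)
Writes< R (load r a)      = T (r <ᵇ R)
Writes< R (store a b)     = ⊤
Writes< R (P ⨾ Q)         = Writes< R P × Writes< R Q
Writes< R (ifnz r P Q)    = Writes< R P × Writes< R Q
Writes< R (while r P)     = Writes< R P

frame : ∀ {W R P s t s′} → W ⊢ P ∶ s ⇓[ t ] s′ → Writes< R P →
        ∀ r → R ≤ r → reg s′ r ≡ reg s r
frame ⇓skip w r R≤r = refl
frame (⇓const {s} {r₁} _) w r R≤r = update-other (reg s) (<⇒≢ (<-≤-trans (<ᵇ⇒< r₁ _ w) R≤r))
frame (⇓arith {s} {r = r₁} _) w r R≤r = update-other (reg s) (<⇒≢ (<-≤-trans (<ᵇ⇒< r₁ _ w) R≤r))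
frame (⇓load {s} {r₁} _) w r R≤r = update-other (reg s) (<⇒≢ (<-≤-trans (<ᵇ⇒< r₁ _ w) R≤r))
frame ⇓store w r R≤r = refl
frame (⇓seq p q) (w , w′) r R≤r = trans (frame q w′ r R≤r) (frame p w r R≤r)
frame (⇓then _ p) (w , _) r R≤r = frame p w r R≤r
frame (⇓else _ p) (_ , w) r R≤r = frame p w r R≤r
frame {R = R} (⇓loop {r = x} {P} _ p q) w r R≤r =
  trans (frame {R = R} {P = while x P} q w r R≤r) (frame p w r R≤r)
frame (⇓exit _) w r R≤r = refl

-- Compiling arithmetic expressions

-- In `loop c i b` the body is iterated c times starting from i; its variable
-- 0 is the accumulator and its variable 1 the number of remaining rounds.
data Exp (k : ℕ) : Set where
  var  : Fin k → Exp k
  lit  : ℕ → Exp k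
  op   : Op → Exp k → Exp k → Exp k
  read : Exp k → Exp k
  bind : Exp k → Exp (1 + k) → Exp k
  loop : Exp k → Exp k → Exp (2 + k) → Exp k

move : Reg → Reg → Program
move r a = const r 0 ⨾ arith add r a r

-- Register `1 + r` is overwritten with the constant 1, so it must hold nothing of value wherever
-- this is used.
decrement : Reg → Program
decrement r = const (1 + r) 1 ⨾ arith sub r r (1 + r)

-- The registers from `d` on act as an evaluation stack: the result goes to `d`, intermediate values
-- lie above it, and all variables in `σ` below it. In a loop `d` is the accumulator and `1 + d` the
-- counter.
compile : ∀ {k} → Exp k → Vec Reg k → Reg → Program
compile (var x)      σ d = move d (lookup σ x)
compile (lit n)      σ d = const d n
compile (op o a b)   σ d = compile a σ d ⨾ compile b σ (1 + d) ⨾ arith o d d (1 + d)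
compile (read a)     σ d = compile a σ d ⨾ load d d
compile (bind a b)   σ d = compile a σ d ⨾ compile b (d ∷ σ) (1 + d) ⨾ move d (1 + d)
compile (loop c i b) σ d =
  compile i σ d ⨾ compile c σ (1 + d) ⨾
  while (1 + d)
    (decrement (1 + d) ⨾ compile b (d ∷ 1 + d ∷ σ) (2 + d) ⨾ move d (2 + d))

poke : ∀ {k} → Exp k → Exp k → Vec Reg k → Reg → Program
poke a e σ d = compile a σ d ⨾ compile e σ (1 + d) ⨾ store d (1 + d)

-- Running time: at most cost e * X ^ nesting e when no loop count exceeds X.
cost : ∀ {k} → Exp k → ℕ
cost (var _)      = 2
cost (lit _)      = 1
cost (op _ a b)   = cost a + (cost b + 1)
cost (read a)     = cost a + 1
cost (bind a b)   = cost a + (cost b + 2)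
cost (loop c i b) = cost i + (cost c + ((cost b + 5) + 1))

nesting : ∀ {k} → Exp k → ℕ
nesting (var _)      = 0
nesting (lit _)      = 0
nesting (op _ a b)   = nesting a + nesting b
nesting (read a)     = nesting a
nesting (bind a b)   = nesting a + nesting b
nesting (loop c i b) = nesting i + (nesting c + (1 + nesting b))

-- Sizes: the value of e is at most Z ^ degree e, and no intermediate value
-- exceeds Z ^ peak e, when the variables satisfy the bounds Z ^ δ and all
-- memory cells and loop accumulators are at most Z.
degree : ∀ {k} → Exp k → Vec ℕ k → ℕ
degree (var x)      δ = lookup δ x
degree (lit n)      δ = n
degree (op _ a b)   δ = 1 + (degree a δ + degree b δ)
degree (read _)     δ = 1
degree (bind a b)   δ = degree b (degree a δ ∷ δ)
degree (loop _ _ _) δ = 1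

peak : ∀ {k} → Exp k → Vec ℕ k → ℕ
peak (var x)      δ = lookup δ x
peak (lit n)      δ = n
peak (op o a b)   δ = peak a δ + (peak b δ + degree (op o a b) δ)
peak (read a)     δ = peak a δ + 1
peak (bind a b)   δ = peak a δ + (peak b (degree a δ ∷ δ) + degree (bind a b) δ)
peak (loop c i b) δ = peak i δ + (peak c δ + (peak b (1 ∷ 1 ∷ δ) + 1))

iterate : (ℕ → ℕ → ℕ) → ℕ → ℕ → ℕ
iterate f zero    a = a
iterate f (suc j) a = iterate f j (f a j)

eval : ∀ {k} → (ℕ → ℕ) → Exp k → Vec ℕ k → ℕ
eval m (var x)      ρ = lookup ρ x
eval m (lit n)      ρ = n
eval m (op o a b)   ρ = ⟦ o ⟧ (eval m a ρ) (eval m b ρ)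
eval m (read a)     ρ = m (eval m a ρ)
eval m (bind a b)   ρ = eval m b (eval m a ρ ∷ ρ)
eval m (loop c i b) ρ = iterate (λ a j → eval m b (a ∷ j ∷ ρ)) (eval m c ρ) (eval m i ρ)

-- Correctness, running time and word size of compiled expressions

record Limits : Set where
  field
    contents : ℕ → ℕ
    extent   : ℕ        -- only addresses below it may be read
    rounds   : ℕ        -- bound on loop counts
    ceiling  : ℕ        -- bound on memory cells and accumulators

module Compiled (L : Limits) where

  open Limits L renaming (contents to m; extent to B; rounds to X; ceiling to Z)

  -- A bound on the accumulator cannot be read off the syntax, since a body such as a squaring
  -- multiplies the exponent in each round. It is therefore an obligation to be met loop by loop,
  -- together with the safety of the body.
  Iterates : (ℕ → ℕ → Set) → (ℕ → ℕ → ℕ) → ℕ → ℕ → Set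
  Iterates I f zero    a = a ≤ Z
  Iterates I f (suc j) a = a ≤ Z × I a j × Iterates I f j (f a j)

  Ok : ∀ {k} → Exp k → Vec ℕ k → Set
  Ok (var x)      ρ = ⊤
  Ok (lit n)      ρ = ⊤
  Ok (op _ a b)   ρ = Ok a ρ × Ok b ρ
  Ok (read a)     ρ = Ok a ρ × eval m a ρ < B
  Ok (bind a b)   ρ = Ok a ρ × Ok b (eval m a ρ ∷ ρ)
  Ok (loop c i b) ρ = Ok c ρ × Ok i ρ × eval m c ρ ≤ X ×
    Iterates (λ a j → Ok b (a ∷ j ∷ ρ)) (λ a j → eval m b (a ∷ j ∷ ρ)) (eval m c ρ) (eval m i ρ)

  Below : ∀ {k} → Vec ℕ k → Vec ℕ k → Set
  Below ρ δ = ∀ x → lookup ρ x ≤ Z ^ lookup δ x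

  below-∷ : ∀ {k} {ρ δ : Vec ℕ k} {v e} → v ≤ Z ^ e → Below ρ δ → Below (v ∷ ρ) (e ∷ δ)
  below-∷ v≤ ρ≤ zero    = v≤
  below-∷ v≤ ρ≤ (suc x) = ρ≤ x

  iterates-start : ∀ {I f} c {a} → Iterates I f c a → a ≤ Z
  iterates-start zero    a≤          = a≤
  iterates-start (suc c) (a≤ , _)    = a≤

  iterates-end : ∀ {I f} c {a} → Iterates I f c a → iterate f c a ≤ Z
  iterates-end zero    a≤           = a≤
  iterates-end (suc c) (_ , _ , it) = iterates-end c it

  record Bounds (W : ℕ) : Set where
    field
      1<W   : 1 < W
      2≤Z   : 2 ≤ Z
      X≤Z   : X ≤ Z
      1≤X   : 1 ≤ X
      cells : ∀ a → m a ≤ Z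

  module Correct {W : ℕ} (bounds : Bounds W) where

    open Bounds bounds

    private instance
      Z≢0 : NonZero Z
      Z≢0 = >-nonZero (≤-trans (s≤s z≤n) 2≤Z)
      X≢0 : NonZero X
      X≢0 = >-nonZero 1≤X

    Z^1 : Z ^ 1 ≡ Z
    Z^1 = *-identityʳ Z

    n≤Z^n : ∀ n → n ≤ Z ^ n
    n≤Z^n zero    = z≤n
    n≤Z^n (suc n) = begin
      suc n             ≡⟨ +-comm 1 n ⟩
      n + 1             ≤⟨ +-mono-≤ (n≤Z^n n) (m^n>0 Z n) ⟩
      Z ^ n + Z ^ n     ≡⟨ cong (Z ^ n +_) (+-identityʳ (Z ^ n)) ⟨
      2 * Z ^ n         ≤⟨ *-monoˡ-≤ (Z ^ n) 2≤Z ⟩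
      Z * Z ^ n         ∎
      where open ≤-Reasoning

    -- Both powers are at least 1, so each of the four results is at most twice their product; by 2
    -- ≤ Z the factor 2 costs one more power of Z, hence the `1 +` in `degree`.
    op-≤ : ∀ o {x y} a b → x ≤ Z ^ a → y ≤ Z ^ b → ⟦ o ⟧ x y ≤ Z ^ (1 + (a + b))
    op-≤ o a b x≤ y≤ = ≤-trans (result o x≤ y≤) widen
      where
      open ≤-Reasoning
      instance
        _ = m^n≢0 Z a
        _ = m^n≢0 Z b
      result : ∀ o {x y} → x ≤ Z ^ a → y ≤ Z ^ b → ⟦ o ⟧ x y ≤ Z ^ a * Z ^ b + Z ^ a * Z ^ b
      result add x≤ y≤ = +-mono-≤ (≤-trans x≤ (m≤m*n _ _)) (≤-trans y≤ (m≤n*m _ _))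
      result sub {x} {y} x≤ y≤ = ≤-trans (m∸n≤m x y) (≤-trans x≤ (≤-trans (m≤m*n _ _) (m≤m+n _ _)))
      result mul x≤ y≤ = ≤-trans (*-mono-≤ x≤ y≤) (m≤m+n _ _)
      result div {y = zero} x≤ y≤ = z≤n
      result div {x} {suc y} x≤ y≤ = ≤-trans (m/n≤m x (suc y)) (≤-trans x≤ (≤-trans (m≤m*n _ _) (m≤m+n _ _)))
      widen : Z ^ a * Z ^ b + Z ^ a * Z ^ b ≤ Z ^ (1 + (a + b))
      widen = begin
        Z ^ a * Z ^ b + Z ^ a * Z ^ b ≡⟨ cong₂ _+_ (^-distribˡ-+-* Z a b) (trans (+-identityʳ _) (^-distribˡ-+-* Z a b)) ⟨
        2 * Z ^ (a + b)               ≤⟨ *-monoˡ-≤ (Z ^ (a + b)) 2≤Z ⟩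
        Z ^ (1 + (a + b))             ∎

    eval-≤ : ∀ {k} (e : Exp k) {ρ δ} → Ok e ρ → Below ρ δ → eval m e ρ ≤ Z ^ degree e δ
    eval-≤ (var x) ok ρ≤ = ρ≤ x
    eval-≤ (lit n) ok ρ≤ = n≤Z^n n
    eval-≤ (op o a b) {ρ} {δ} (oka , okb) ρ≤ =
      op-≤ o (degree a δ) (degree b δ) (eval-≤ a oka ρ≤) (eval-≤ b okb ρ≤)
    eval-≤ (read a) ok ρ≤ = ≤-trans (cells _) (≤-reflexive (sym Z^1))
    eval-≤ (bind a b) (oka , okb) ρ≤ = eval-≤ b okb (below-∷ (eval-≤ a oka ρ≤) ρ≤)
    eval-≤ (loop c i b) {ρ} (_ , _ , _ , it) ρ≤ = subst (_ ≤_) (sym Z^1) (iterates-end (eval m c ρ) it)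

    record Returns (d : Reg) (v : ℕ) (s s′ : State) : Set where
      field
        result : reg s′ d ≡ v
        saved  : ∀ x → x < d → reg s′ x ≡ reg s x
        intact : ∀ a → mem s′ a ≡ mem s a

    open Returns public

    -- Memory is known only below `B`, because the cells beyond are filled with the graph while
    -- expressions are still being evaluated; `Ok` confines reads to this part.
    record Holds {k} (σ ρ : Vec ℕ k) (d : Reg) (s : State) : Set where
      field
        fresh : ∀ x → lookup σ x < d
        value : ∀ x → reg s (lookup σ x) ≡ lookup ρ x
        input : ∀ a → a < B → mem s a ≡ m a

    open Holds public

    kept : ∀ {k} {σ ρ : Vec ℕ k} {d v s s′} → Holds σ ρ d s → Returns d v s s′ → Holds σ ρ (1 + d) s′
    kept H R .fresh x = m<n⇒m<1+n (H .fresh x)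
    kept H R .value x = trans (R .saved _ (H .fresh x)) (H .value x)
    kept H R .input a a<B = trans (R .intact a) (H .input a a<B)

    extend : ∀ {k} {σ ρ : Vec ℕ k} {d v s s′} → Holds σ ρ d s → Returns d v s s′ →
             Holds (d ∷ σ) (v ∷ ρ) (1 + d) s′
    extend H R .fresh zero    = ≤-refl
    extend H R .fresh (suc x) = kept H R .fresh x
    extend H R .value zero    = R .result
    extend H R .value (suc x) = kept H R .value x
    extend H R .input = kept H R .input

    compose : ∀ {d u v w s s₁ s₂ s₃} → Returns d u s s₁ → Returns (1 + d) v s₁ s₂ →
              Returns d w s₂ s₃ → Returns d w s s₃
    compose R R₁ R₂ .result = R₂ .result
    compose R R₁ R₂ .saved x x<d =
      trans (R₂ .saved x x<d) (trans (R₁ .saved x (m<n⇒m<1+n x<d)) (R .saved x x<d))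
    compose R R₁ R₂ .intact a = trans (R₂ .intact a) (trans (R₁ .intact a) (R .intact a))

    set-returns : ∀ {d v w} s → w ≡ v → Returns d v s (setReg d w s)
    set-returns s refl .result = update-same (reg s) _
    set-returns s refl .saved x x<d = update-other (reg s) (>⇒≢ x<d)
    set-returns s refl .intact a = refl

    -- Stronger than `Returns`: registers above `d` survive as well. The loop needs this when it
    -- copies the new accumulator to `d` while the counter is in `1 + d`.
    record Moved (d v : ℕ) (s s′ : State) : Set where
      field
        target : reg s′ d ≡ v
        others : ∀ x → d ≢ x → reg s′ x ≡ reg s x
        stored : ∀ a → mem s′ a ≡ mem s a

    open Moved

    moved-returns : ∀ {d v s s′} → Moved d v s s′ → Returns d v s s′
    moved-returns M .result = M .target
    moved-returns M .saved x x<d = M .others x (>⇒≢ x<d)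
    moved-returns M .intact = M .stored

    moved : ∀ {d r v s} → d ≢ r → reg s r ≡ v → v < W → Exec W (move d r) s 2 (Moved d v s)
    moved {d} {r} {v} {s} d≢r refl v<W
      with eq ← trans (cong₂ _+_ (update-other (reg s) {d} {r} {0} d≢r) (update-same (reg s) d)) (+-identityʳ (reg s r)) =
      _ , _ , ⇓seq (⇓const (≤-trans (s≤s z≤n) 1<W)) (⇓arith (subst (_< W) (sym eq) v<W)) , ≤-refl , record
        { target = trans (update-same (reg s [ d ↦ 0 ]) d) eq
        ; others = λ x d≢x → trans (update-other (reg s [ d ↦ 0 ]) d≢x) (update-other (reg s) d≢x)
        ; stored = λ _ → refl }

    decremented : ∀ {r j s} → reg s r ≡ suc j → j < W → Exec W (decrement r) s 2 (Returns r j s)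
    decremented {r} {j} {s} eq j<W
      with eq′ ← cong₂ _∸_ (trans (update-other (reg s) {1 + r} {r} {1} (>⇒≢ (n<1+n r))) eq) (update-same (reg s) (1 + r) {1}) =
      _ , _ , ⇓seq (⇓const 1<W) (⇓arith (subst (_< W) (sym eq′) j<W)) , ≤-refl , record
        { result = trans (update-same (reg s [ 1 + r ↦ 1 ]) r) eq′
        ; saved  = λ x x<r → trans (update-other (reg s [ 1 + r ↦ 1 ]) (>⇒≢ x<r)) (update-other (reg s) (>⇒≢ (m<n⇒m<1+n x<r)))
        ; intact = λ _ → refl }

    -- Peaks are sums rather than maxima, so one bound on the whole expression passes to each part
    -- by monotonicity of powers.
    peak-left : ∀ p {q} → Z ^ (p + q) < W → Z ^ p < W
    peak-left p = ≤-<-trans (^-monoʳ-≤ Z (m≤m+n p _))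

    peak-right : ∀ p {q} → Z ^ (p + q) < W → Z ^ q < W
    peak-right p = ≤-<-trans (^-monoʳ-≤ Z (m≤n+m _ p))

    powers : ∀ {t u} c c′ a b → t ≤ c * X ^ a → u ≤ c′ * X ^ b → t + u ≤ (c + c′) * X ^ (a + b)
    powers {t} {u} c c′ a b t≤ u≤ = subst (t + u ≤_) (sym (*-distribʳ-+ (X ^ (a + b)) c c′))
      (+-mono-≤ (≤-trans t≤ (*-monoʳ-≤ c (^-monoʳ-≤ X (m≤m+n a b))))
                (≤-trans u≤ (*-monoʳ-≤ c′ (^-monoʳ-≤ X (m≤n+m b a)))))

    plus : ∀ {t u} c c′ a → t ≤ c * X ^ a → u ≤ c′ → t + u ≤ (c + c′) * X ^ a
    plus {t} {u} c c′ a t≤ u≤ = subst (λ b → t + u ≤ (c + c′) * X ^ b) (+-identityʳ a)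
      (powers c c′ a 0 t≤ (subst (u ≤_) (sym (*-identityʳ c′)) u≤))

    holds-step : ∀ {k} {σ ρ : Vec ℕ k} {a j j′ d s s′} →
                 Holds (d ∷ 1 + d ∷ σ) (a ∷ j ∷ ρ) (2 + d) s → (∀ x → lookup σ x < d) →
                 Returns (1 + d) j′ s s′ → Holds (d ∷ 1 + d ∷ σ) (a ∷ j′ ∷ ρ) (2 + d) s′
    holds-step H σ<d R .fresh = H .fresh
    holds-step H σ<d R .value zero          = trans (R .saved _ ≤-refl) (H .value zero)
    holds-step H σ<d R .value (suc zero)    = R .result
    holds-step H σ<d R .value (suc (suc x)) =
      trans (R .saved _ (m<n⇒m<1+n (σ<d x))) (H .value (suc (suc x)))
    holds-step H σ<d R .input a a<B = trans (R .intact a) (H .input a a<B)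

    holds-next : ∀ {k} {σ ρ : Vec ℕ k} {a a′ v j d s s₁ s₂} →
                 Holds (d ∷ 1 + d ∷ σ) (a ∷ j ∷ ρ) (2 + d) s → (∀ x → lookup σ x < d) →
                 Returns (2 + d) v s s₁ → Moved d a′ s₁ s₂ → Holds (d ∷ 1 + d ∷ σ) (a′ ∷ j ∷ ρ) (2 + d) s₂
    holds-next H σ<d R M .fresh = H .fresh
    holds-next H σ<d R M .value zero          = M .target
    holds-next H σ<d R M .value (suc zero)    =
      trans (M .others _ (<⇒≢ (n<1+n _))) (trans (R .saved _ ≤-refl) (H .value (suc zero)))
    holds-next H σ<d R M .value (suc (suc x)) =
      trans (M .others _ (>⇒≢ (σ<d x))) (trans (R .saved _ (H .fresh (suc (suc x)))) (H .value (suc (suc x))))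
    holds-next H σ<d R M .input a a<B =
      trans (M .stored a) (trans (R .intact a) (H .input a a<B))

    compile-correct : ∀ {k} (e : Exp k) {σ ρ δ d s} → Ok e ρ → Below ρ δ → Z ^ peak e δ < W →
                      Holds σ ρ d s →
                      Exec W (compile e σ d) s (cost e * X ^ nesting e) (Returns d (eval m e ρ) s)

    -- Each round costs 5 steps besides the body: one test, two to decrement and two to move the
    -- accumulator. The final 1 is the failing test.
    while-correct : ∀ {k} (b : Exp (2 + k)) {σ ρ δ d} →
      let f = λ a j → eval m b (a ∷ j ∷ ρ) in
      (∀ x → lookup σ x < d) → Below ρ δ → Z < W → Z ^ peak b (1 ∷ 1 ∷ δ) < W →
      ∀ j {a s} → j ≤ X → Iterates (λ a j → Ok b (a ∷ j ∷ ρ)) f j a →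
      Holds (d ∷ 1 + d ∷ σ) (a ∷ j ∷ ρ) (2 + d) s →
      Exec W (while (1 + d) (decrement (1 + d) ⨾ compile b (d ∷ 1 + d ∷ σ) (2 + d) ⨾ move d (2 + d)))
        s (j * (cost b * X ^ nesting b + 5) + 1) (Returns d (iterate f j a) s)

    compile-correct (var x) {d = d} ok ρ≤ pk H
      with t , s₁ , p , t≤ , M ← moved (>⇒≢ (H .fresh x)) (H .value x) (≤-<-trans (ρ≤ x) pk) =
      t , s₁ , p , t≤ , moved-returns M
    compile-correct (lit n) ok ρ≤ pk H =
      _ , _ , ⇓const (≤-<-trans (n≤Z^n n) pk) , ≤-refl , set-returns _ refl
    compile-correct (op o a b) {ρ = ρ} {δ} {d} (oka , okb) ρ≤ pk H
      with t₁ , s₁ , p₁ , t₁≤ , R₁ ← compile-correct a oka ρ≤ (peak-left (peak a δ) pk) H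
      with t₂ , s₂ , p₂ , t₂≤ , R₂ ← compile-correct b okb ρ≤ (peak-left (peak b δ) (peak-right (peak a δ) pk)) (kept H R₁)
      with eq ← cong₂ ⟦ o ⟧ (trans (R₂ .saved d ≤-refl) (R₁ .result)) (R₂ .result) =
      _ , _ , ⇓seq p₁ (⇓seq p₂ (⇓arith (subst (_< W) (sym eq) (≤-<-trans (eval-≤ (op o a b) (oka , okb) ρ≤)
                (peak-right (peak b δ) (peak-right (peak a δ) pk)))))) ,
      powers (cost a) (cost b + 1) (nesting a) (nesting b) t₁≤ (plus (cost b) 1 (nesting b) t₂≤ ≤-refl) ,
      compose R₁ R₂ (set-returns s₂ eq)
    compile-correct (read a) {ρ = ρ} {δ} {d} {s} (oka , a<B) ρ≤ pk H
      with t₁ , s₁ , p₁ , t₁≤ , R₁ ← compile-correct a oka ρ≤ (peak-left (peak a δ) pk) H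
      with eq ← trans (cong (mem s₁) (R₁ .result)) (trans (R₁ .intact _) (H .input _ a<B)) =
      _ , _ , ⇓seq p₁ (⇓load (subst (_< W) (sym eq) (≤-<-trans (eval-≤ (read a) {δ = δ} (oka , a<B) ρ≤)
                (peak-right (peak a δ) pk)))) ,
      plus (cost a) 1 (nesting a) t₁≤ ≤-refl ,
      record { result = trans (update-same (reg s₁) d) eq
             ; saved = λ x x<d → trans (update-other (reg s₁) (>⇒≢ x<d)) (R₁ .saved x x<d)
             ; intact = R₁ .intact }
    compile-correct (bind a b) {ρ = ρ} {δ} {d} (oka , okb) ρ≤ pk H
      with t₁ , s₁ , p₁ , t₁≤ , R₁ ← compile-correct a oka ρ≤ (peak-left (peak a δ) pk) H
      with ρ≤′ ← below-∷ {δ = δ} (eval-≤ a oka ρ≤) ρ≤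
      with t₂ , s₂ , p₂ , t₂≤ , R₂ ← compile-correct b okb ρ≤′
             (peak-left (peak b (degree a δ ∷ δ)) (peak-right (peak a δ) pk)) (extend H R₁)
      with t₃ , s₃ , p₃ , t₃≤ , R₃ ← moved (<⇒≢ (n<1+n d)) (R₂ .result) (≤-<-trans (eval-≤ b okb ρ≤′)
                (peak-right (peak b (degree a δ ∷ δ)) (peak-right (peak a δ) pk))) =
      _ , _ , ⇓seq p₁ (⇓seq p₂ p₃) ,
      powers (cost a) (cost b + 2) (nesting a) (nesting b) t₁≤ (plus (cost b) 2 (nesting b) t₂≤ t₃≤) ,
      compose R₁ R₂ (moved-returns R₃)
    compile-correct (loop c i b) {σ} {ρ} {δ} {d} (okc , oki , c≤X , it) ρ≤ pk H
      with pk₁ ← peak-right (peak i δ) pk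
      with pk₂ ← peak-right (peak c δ) pk₁
      with t₁ , s₁ , p₁ , t₁≤ , R₁ ← compile-correct i oki ρ≤ (peak-left (peak i δ) pk) H
      with t₂ , s₂ , p₂ , t₂≤ , R₂ ← compile-correct c okc ρ≤ (peak-left (peak c δ) pk₁) (kept H R₁)
      with t₃ , s₃ , p₃ , t₃≤ , R₃ ← while-correct b (H .fresh) ρ≤
             (≤-<-trans (≤-reflexive (sym Z^1)) (peak-right (peak b (1 ∷ 1 ∷ δ)) pk₂))
             (peak-left (peak b (1 ∷ 1 ∷ δ)) pk₂) (eval m c ρ) c≤X it
             (record { fresh = λ { zero → m<n⇒m<1+n ≤-refl ; (suc zero) → ≤-refl
                                 ; (suc (suc x)) → m<n⇒m<1+n (m<n⇒m<1+n (H .fresh x)) }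
                     ; value = λ { zero → trans (R₂ .saved d ≤-refl) (R₁ .result) ; (suc zero) → R₂ .result
                                 ; (suc (suc x)) → kept (kept H R₁) R₂ .value x }
                     ; input = kept (kept H R₁) R₂ .input }) =
      _ , _ , ⇓seq p₁ (⇓seq p₂ p₃) ,
      powers (cost i) (cost c + (cost b + 5 + 1)) (nesting i) (nesting c + (1 + nesting b)) t₁≤
        (powers (cost c) (cost b + 5 + 1) (nesting c) (1 + nesting b) t₂≤
          (≤-trans t₃≤ (plus (cost b + 5) 1 (1 + nesting b) rounds≤ ≤-refl))) ,
      compose R₁ R₂ R₃
      where
      open ≤-Reasoning
      rounds≤ : eval m c ρ * (cost b * X ^ nesting b + 5) ≤ (cost b + 5) * X ^ (1 + nesting b)
      rounds≤ = begin
        eval m c ρ * (cost b * X ^ nesting b + 5) ≤⟨ *-mono-≤ c≤X (plus (cost b) 5 (nesting b) ≤-refl ≤-refl) ⟩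
        X * ((cost b + 5) * X ^ nesting b)        ≡⟨ *-assoc X (cost b + 5) _ ⟨
        X * (cost b + 5) * X ^ nesting b          ≡⟨ cong (_* X ^ nesting b) (*-comm X (cost b + 5)) ⟩
        (cost b + 5) * X * X ^ nesting b          ≡⟨ *-assoc (cost b + 5) X _ ⟩
        (cost b + 5) * X ^ (1 + nesting b)        ∎

    while-correct b σ<d ρ≤ Z<W pk zero j≤ it H =
      _ , _ , ⇓exit (H .value (suc zero)) , ≤-refl , record
        { result = H .value zero ; saved = λ _ _ → refl ; intact = λ _ → refl }
    while-correct b {σ} {ρ} {δ} {d} σ<d ρ≤ Z<W pk (suc j) {a} {s} j<X (a≤ , okb , it) H
      with j≤X ← ≤-trans (n≤1+n j) j<X
      with t₁ , s₁ , p₁ , t₁≤ , R₁ ← decremented (H .value (suc zero)) (≤-<-trans (≤-trans j≤X X≤Z) Z<W)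
      with H₁ ← holds-step H σ<d R₁
      with t₂ , s₂ , p₂ , t₂≤ , R₂ ← compile-correct b okb
             (below-∷ (subst (a ≤_) (sym Z^1) a≤) (below-∷ (subst (j ≤_) (sym Z^1) (≤-trans j≤X X≤Z)) ρ≤)) pk H₁
      with t₃ , s₃ , p₃ , t₃≤ , M ← moved (<⇒≢ (m<n⇒m<1+n (n<1+n d))) (R₂ .result) (≤-<-trans (iterates-start j it) Z<W)
      with t₄ , s₄ , p₄ , t₄≤ , R₄ ← while-correct b {σ} {ρ} {δ} {d} σ<d ρ≤ Z<W pk j j≤X it (holds-next H₁ σ<d R₂ M) =
      _ , _ , ⇓loop (λ e → 1+n≢0 (trans (sym (H .value (suc zero))) e)) (⇓seq p₁ (⇓seq p₂ p₃)) p₄ ,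
      time (+-mono-≤ t₁≤ (+-mono-≤ t₂≤ t₃≤)) t₄≤ ,
      record { result = R₄ .result
             ; saved  = λ x x<d → trans (R₄ .saved x x<d) (trans (M .others x (>⇒≢ x<d))
                          (trans (R₂ .saved x (m<n⇒m<1+n (m<n⇒m<1+n x<d))) (R₁ .saved x (m<n⇒m<1+n x<d))))
             ; intact = λ x → trans (R₄ .intact x) (trans (M .stored x) (trans (R₂ .intact x) (R₁ .intact x))) }
      where
      time : ∀ {t u T v} → t ≤ 2 + (T + 2) → u ≤ v + 1 → 1 + t + u ≤ T + 5 + v + 1
      time {t} {u} {T} {v} t≤ u≤ = begin
        1 + t + u                   ≤⟨ +-mono-≤ (s≤s t≤) u≤ ⟩
        3 + (T + 2) + (v + 1)       ≡⟨ +-assoc (3 + (T + 2)) v 1 ⟨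
        3 + (T + 2) + v + 1         ≡⟨ cong (λ x → x + v + 1) (trans (+-comm 3 (T + 2)) (+-assoc T 2 3)) ⟩
        T + 5 + v + 1               ∎
        where open ≤-Reasoning

    record Poked (d a v : ℕ) (s s′ : State) : Set where
      field
        kept-reg : ∀ x → x < d → reg s′ x ≡ reg s x
        poked    : ∀ x → mem s′ x ≡ (mem s [ a ↦ v ]) x

    open Poked public

    poke-correct : ∀ {k} (a e : Exp k) {σ ρ δ d s} → Ok a ρ → Ok e ρ → Below ρ δ →
                   Z ^ peak a δ < W → Z ^ peak e δ < W → Holds σ ρ d s →
                   Exec W (poke a e σ d) s ((cost a + (cost e + 1)) * X ^ (nesting a + nesting e))
                     (Poked d (eval m a ρ) (eval m e ρ) s)
    poke-correct a e {ρ = ρ} {d = d} {s} oka oke ρ≤ pka pke H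
      with t₁ , s₁ , p₁ , t₁≤ , R₁ ← compile-correct a oka ρ≤ pka H
      with t₂ , s₂ , p₂ , t₂≤ , R₂ ← compile-correct e oke ρ≤ pke (kept H R₁) =
      _ , _ , ⇓seq p₁ (⇓seq p₂ ⇓store) ,
      powers (cost a) (cost e + 1) (nesting a) (nesting e) t₁≤ (plus (cost e) 1 (nesting e) t₂≤ ≤-refl) ,
      record { kept-reg = λ x x<d → trans (R₂ .saved x (m<n⇒m<1+n x<d)) (R₁ .saved x x<d)
             ; poked    = λ x → trans
                 (cong₂ (λ a v → (mem s₂ [ a ↦ v ]) x) (trans (R₂ .saved d ≤-refl) (R₁ .result)) (R₂ .result))
                 (update-cong (eval m a ρ) (λ x → trans (R₂ .intact x) (R₁ .intact x)) x) }

    poked-holds : ∀ {k} {σ ρ : Vec ℕ k} {d a v s s′} → B ≤ a → Holds σ ρ d s → Poked d a v s s′ → Holds σ ρ d s′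
    poked-holds B≤a H K .fresh = H .fresh
    poked-holds B≤a H K .value x = trans (K .kept-reg _ (H .fresh x)) (H .value x)
    poked-holds {s = s} B≤a H K .input x x<B =
      trans (K .poked x) (trans (update-other (mem s) (>⇒≢ (<-≤-trans x<B B≤a))) (H .input x x<B))

-- Distances and diameters

least : ∀ {P : ℕ → Set} → (∀ n → Dec (P n)) → ∀ {n} → P n →
        ∃[ d ] P d × (∀ l → l < d → ¬ P l) × d ≤ n
least P? {zero} p = zero , p , (λ _ ()) , z≤n
least {P} P? {suc n} p with P? zero
... | yes p₀ = zero , p₀ , (λ _ ()) , z≤n
... | no ¬p₀ with d , pd , min , d≤n ← least (λ l → P? (suc l)) {n} p =
  suc d , pd , (λ { zero _ → ¬p₀ ; (suc l) (s≤s l<d) → min l l<d }) , s≤s d≤n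

greatest : ∀ {n} (f : Fin n → Fin n → ℕ) K → (∀ u v → f u v ≤ K) → Fin n →
           ∃[ D ] D ≤ K × (∀ u v → f u v ≤ D) × ∃[ u ] ∃[ v ] f u v ≡ D
greatest f zero f≤ u = 0 , z≤n , f≤ , u , u , n≤0⇒n≡0 (f≤ u u)
greatest f (suc K) f≤ w with Fin.any? (λ u → Fin.any? (λ v → f u v ≟ suc K))
... | yes (u , v , eq) = suc K , ≤-refl , f≤ , u , v , eq
... | no ¬∃ with D , D≤K , rest ← greatest f K (λ u v → s≤s⁻¹ (≤∧≢⇒< (f≤ u v) (λ eq → ¬∃ (u , v , eq)))) w =
  D , m≤n⇒m≤1+n D≤K , rest

module _ (G : Graph) where

  open Graph G

  adjacent? : ∀ u v → Dec (Adjacent u v)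
  adjacent? u v = _∈?_ (Product.≡-dec Fin._≟_ Fin._≟_) (u , v) edges
           ⊎-dec _∈?_ (Product.≡-dec Fin._≟_ Fin._≟_) (v , u) edges

  walk? : ∀ u v l → Dec (Walk u v l)
  walk? u v zero = map′ (λ { refl → nil }) (λ { nil → refl }) (u Fin.≟ v)
  walk? u v (suc l) = map′ (λ (w , a , p) → cons a p) (λ { (cons a p) → _ , a , p })
    (Fin.any? λ w → adjacent? u w ×-dec walk? w v l)

  Within : ℕ → Vertex → Vertex → Set
  Within K u v = ∃[ l ] l ≤ K × Walk u v l

  -- The given algorithm promises something only once a diameter is supplied, so one must be
  -- constructed. Adjacency is decidable and distances are bounded by `K`, hence distances and their
  -- maximum are found by finite search.
  diameter-exists : ∀ K → Vertex → (∀ u v → Within K u v) → ∃[ D ] IsDiameter D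
  diameter-exists K w within = D , (λ u v → dist u v , isDist u v , f≤ u v) ,
                        u , v , subst (IsDistance u v) eq (isDist u v)
    where
    shortest : ∀ u v → _
    shortest u v = least (walk? u v) (proj₂ (proj₂ (within u v)))
    dist : Vertex → Vertex → ℕ
    dist u v = proj₁ (shortest u v)
    isDist : ∀ u v → IsDistance u v (dist u v)
    isDist u v = let _ , p , min , _ = shortest u v in p , min
    dist≤ : ∀ u v → dist u v ≤ K
    dist≤ u v = let _ , _ , _ , d≤ = shortest u v in ≤-trans d≤ (proj₁ (proj₂ (within u v)))
    max : _
    max = greatest dist K dist≤ w
    D : ℕ
    D = proj₁ max
    f≤ : ∀ u v → dist u v ≤ D
    f≤ = proj₁ (proj₂ (proj₂ max))
    u v : Vertex
    u = proj₁ (proj₂ (proj₂ (proj₂ max)))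
    v = proj₁ (proj₂ (proj₂ (proj₂ (proj₂ max))))
    eq : dist u v ≡ D
    eq = proj₂ (proj₂ (proj₂ (proj₂ (proj₂ max))))

  far⇒diameter> : ∀ {K D u v} → ¬ Within K u v → IsDiameter D → K < D
  far⇒diameter> {u = u} {v} ¬within (dist , _) with d , (p , _) , d≤D ← dist u v =
    <-≤-trans (≰⇒> (λ d≤K → ¬within (d , d≤K , p))) d≤D

  Near : Vertex → Vertex → Set
  Near u v = u ≡ v ⊎ Adjacent u v

  near-sym : ∀ {u v} → Near u v → Near v u
  near-sym (inj₁ refl) = inj₁ refl
  near-sym (inj₂ a)    = inj₂ (swap a)

  near-step : ∀ {K u v w} → Near u v → Within K v w → Within (suc K) u w
  near-step (inj₁ refl) (l , l≤K , p) = l , m≤n⇒m≤1+n l≤K , p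
  near-step (inj₂ a)    (l , l≤K , p) = suc l , s≤s l≤K , cons a p

  near² : ∀ {u v w} → Near u v → Near v w → Within 2 u w
  near² a b = near-step a (near-step b (0 , z≤n , nil))

  near³ : ∀ {u v w x} → Near u v → Near v w → Near w x → Within 3 u x
  near³ a b c = near-step a (near² b c)

-- The graph of a covering problem

quotient : ∀ {r} q d .{{_ : NonZero d}} → r < d → (r + q * d) / d ≡ q
quotient {r} q d r<d = trans (+-distrib-/-∣ʳ r {d = d} (divides-refl q))
  (cong₂ _+_ (m<n⇒m/n≡0 r<d) (m*n/n≡m q d))

remainder : ∀ {r} q d .{{_ : NonZero d}} → r < d → (r + q * d) % d ≡ r
remainder {r} q d r<d = trans ([m+kn]%n≡m%n r q d) (m<n⇒m%n≡m r<d)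

if-< : ∀ {A : Set} {k n} {a b : A} → k < n → (if k <ᵇ n then a else b) ≡ a
if-< {k = k} {n} k<n rewrite dec-true (k <? n) k<n = refl

if-≥ : ∀ {A : Set} {k n} {a b : A} → n ≤ k → (if k <ᵇ n then a else b) ≡ b
if-≥ {k = k} {n} n≤k rewrite dec-false (k <? n) (≤⇒≯ n≤k) = refl

bit≤1 : ∀ b → bit b ≤ 1
bit≤1 true  = ≤-refl
bit≤1 false = z≤n

-- The clause vertices c = 0, …, M - 1 have number 3c.  So that the number of
-- edges does not depend on the formula, assignment i has an edge for every
-- clause: to 3c if it falsifies c, and to a dummy vertex 3c + 1 + i % 2 otherwise,
-- which it shares only with assignments of the same half.  Both hubs
-- are adjacent to the dummies as well.  The clause M, which counts as satisfied,
-- makes the hubs 3M + 1 and 3M + 2 the dummies of M.  Assignment i has number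
-- 3M + 3 + i, and the halves are told apart by the parity of i.
module Gadget (M N : ℕ) (sat : ℕ → ℕ → Bool) (sat-M : ∀ i → sat i M ≡ true) where

  -- `m₀` counts the edges among low vertices: two from each of the H + 1 vertices 0, ..., H to the
  -- hubs, and one between the hubs. The other summand of `m` has one edge per assignment and
  -- clause, the extra clause `M` included.
  H m₀ m V : ℕ
  H  = M * 3
  m₀ = 3 + H * 2
  m  = m₀ + N * suc M
  V  = 3 + H + N

  target : ℕ → ℕ → ℕ
  target i c = bit (sat i c) * suc (i % 2) + c * 3

  -- A row edge has number m₀ + c + i (M + 1). The hub edge 2t + r joins `t` to the hub 2 + H - r,
  -- so that the last one, with t = 1 + H and r = 0, joins the two hubs.
  lower upper : ℕ → ℕ
  lower k = if k <ᵇ m₀ then k / 2 else target ((k ∸ m₀) / suc M) ((k ∸ m₀) % suc M)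
  upper k = if k <ᵇ m₀ then 2 + H ∸ k % 2 else 3 + H + (k ∸ m₀) / suc M

  offset<3 : ∀ i c → bit (sat i c) * suc (i % 2) < 3
  offset<3 i c = s≤s (*-mono-≤ (bit≤1 (sat i c)) (m%n<n i 2))

  target-≤ : ∀ i {c} → c ≤ M → target i c ≤ 2 + H
  target-≤ i {c} c≤M = +-mono-≤ (s≤s⁻¹ (offset<3 i c)) (*-monoˡ-≤ 3 c≤M)

  target-M : ∀ i → target i M ≡ suc (i % 2) + H
  target-M i rewrite sat-M i = cong (_+ H) (+-identityʳ (suc (i % 2)))

  data View (k : ℕ) : Set where
    hub : ∀ r t → r < 2 → r + t * 2 < m₀ → k ≡ r + t * 2 →
          lower k ≡ t → upper k ≡ 2 + H ∸ r → View k
    row : ∀ i c → i < N → c ≤ M → k ≡ m₀ + (c + i * suc M) →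
          lower k ≡ target i c → upper k ≡ 3 + H + i → View k

  view : ∀ {k} → k < m → View k
  view {k} k<m with k <? m₀
  ... | yes k<m₀ = hub (k % 2) (k / 2) (m%n<n k 2) (subst (_< m₀) k≡ k<m₀) k≡ (if-< k<m₀) (if-< k<m₀)
    where k≡ = m≡m%n+[m/n]*n k 2
  ... | no k≮m₀ = row (q / suc M) (q % suc M) (m<n*o⇒m/o<n q<) (s≤s⁻¹ (m%n<n q (suc M)))
      (trans (sym (m+[n∸m]≡n m₀≤k)) (cong (m₀ +_) (m≡m%n+[m/n]*n q (suc M)))) (if-≥ m₀≤k) (if-≥ m₀≤k)
    where
    q = k ∸ m₀
    m₀≤k = ≮⇒≥ k≮m₀
    q< : q < N * suc M
    q< = +-cancelˡ-< m₀ q _ (subst (_< m) (sym (m+[n∸m]≡n m₀≤k)) k<m)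

  hub-half : ∀ {r} t → r + t * 2 < m₀ → t ≤ 1 + H
  hub-half t lt = *-cancelʳ-≤ t (1 + H) 2 (s≤s⁻¹ (≤-trans (s≤s (m≤n+m _ _)) lt))

  lower-≤ : ∀ {k} → k < m → lower k ≤ 2 + H
  lower-≤ k<m with view k<m
  ... | hub r t _ lt _ eq _ = ≤-trans (≤-reflexive eq) (≤-trans (hub-half t lt) (n≤1+n _))
  ... | row i c _ c≤M _ eq _ = ≤-trans (≤-reflexive eq) (target-≤ i c≤M)

  lower<upper : ∀ {k} → k < m → lower k < upper k
  lower<upper k<m with view k<m
  ... | hub zero t _ lt _ eq eq′ = subst₂ _<_ (sym eq) (sym eq′) (s≤s (hub-half t lt))
  ... | hub (suc zero) t _ lt _ eq eq′ = subst₂ _<_ (sym eq) (sym eq′)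
          (*-cancelʳ-< 2 t (1 + H) (s<s⁻¹ lt))
  ... | hub (suc (suc _)) t (s≤s (s≤s ())) _ _ _ _
  ... | row i c _ c≤M _ eq eq′ = subst₂ _<_ (sym eq) (sym eq′) (s≤s (≤-trans (target-≤ i c≤M) (m≤m+n _ i)))

  upper<V : ∀ {k} → k < m → upper k < V
  upper<V k<m with view k<m
  ... | hub r t _ _ _ _ eq′ = subst (_< V) (sym eq′) (s≤s (≤-trans (m∸n≤m _ r) (m≤m+n _ N)))
  ... | row i c i<N _ _ _ eq′ = subst (_< V) (sym eq′) (+-monoʳ-< (3 + H) i<N)

  -- Upper endpoints separate hub edges (at most 2 + H) from row edges. In a row edge the upper
  -- endpoint yields `i`, and the lower one divided by 3 yields `c`, as the offset within a block is
  -- below 3.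
  edge-injective : ∀ {k k′} → k < m → k′ < m → lower k ≡ lower k′ → upper k ≡ upper k′ → k ≡ k′
  edge-injective k<m k′<m l≡ u≡ with view k<m | view k′<m
  ... | hub r t r<2 _ k≡ l u | hub r′ t′ r′<2 _ k′≡ l′ u′ =
    trans k≡ (trans (cong₂ (λ r t → r + t * 2)
      (∸-cancelˡ-≡ (≤-trans (s≤s⁻¹ r<2) (s≤s z≤n)) (≤-trans (s≤s⁻¹ r′<2) (s≤s z≤n)) (trans (sym u) (trans u≡ u′)))
      (trans (sym l) (trans l≡ l′))) (sym k′≡))
  ... | hub r t _ _ _ _ u | row i c _ _ _ _ u′ =
    contradiction (trans (sym u) (trans u≡ u′)) (<⇒≢ (s≤s (≤-trans (m∸n≤m _ r) (m≤m+n _ i))))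
  ... | row i c _ _ _ _ u | hub r t _ _ _ _ u′ =
    contradiction (trans (sym u) (trans u≡ u′)) (>⇒≢ (s≤s (≤-trans (m∸n≤m _ r) (m≤m+n _ i))))
  ... | row i c _ _ k≡ l u | row i′ c′ _ _ k′≡ l′ u′ =
    trans k≡ (trans (cong₂ (λ c i → m₀ + (c + i * suc M))
      (trans (sym (quotient c 3 (offset<3 i c))) (trans
        (cong (_/ 3) (trans (sym l) (trans l≡ l′))) (quotient c′ 3 (offset<3 i′ c′))))
      (+-cancelˡ-≡ (3 + H) i i′ (trans (sym u) (trans u≡ u′)))) (sym k′≡))

  edge : Fin m → Fin V × Fin V
  edge k = fromℕ< (<-trans (lower<upper (Fin.toℕ<n k)) (upper<V (Fin.toℕ<n k))) , fromℕ< (upper<V (Fin.toℕ<n k))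

  edge-lower : ∀ k → toℕ (proj₁ (edge k)) ≡ lower (toℕ k)
  edge-lower k = Fin.toℕ-fromℕ< _

  edge-upper : ∀ k → toℕ (proj₂ (edge k)) ≡ upper (toℕ k)
  edge-upper k = Fin.toℕ-fromℕ< _

  graph : Graph
  graph = record
    { order  = V
    ; edges  = tabulate edge
    ; sorted = All.tabulate⁺ λ k → subst₂ _<_ (sym (edge-lower k)) (sym (edge-upper k)) (lower<upper (Fin.toℕ<n k))
    ; unique = Unique.tabulate⁺ λ {k} {k′} eq → Fin.toℕ-injective (edge-injective (Fin.toℕ<n k) (Fin.toℕ<n k′)
        (trans (sym (edge-lower k)) (trans (cong (λ e → toℕ (proj₁ e)) eq) (edge-lower k′)))
        (trans (sym (edge-upper k)) (trans (cong (λ e → toℕ (proj₂ e)) eq) (edge-upper k′))))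
    }

  open Graph graph using (size; Adjacent; Vertex; Walk; nil; cons; IsDiameter)

  size≡m : size ≡ m
  size≡m = length-tabulate edge

  Link : ℕ → ℕ → Set
  Link a b = ∃[ k ] k < m × lower k ≡ a × upper k ≡ b

  adjacent : ∀ {u v} → Link (toℕ u) (toℕ v) → Adjacent u v
  adjacent {u} {v} (k , k<m , l , r) = inj₁ (subst (_∈ tabulate edge) same (∈-tabulate⁺ {f = edge} (fromℕ< k<m)))
    where
    k≡ = Fin.toℕ-fromℕ< k<m
    same : edge (fromℕ< k<m) ≡ (u , v)
    same = cong₂ _,_ (Fin.toℕ-injective (trans (edge-lower (fromℕ< k<m)) (trans (cong lower k≡) l)))
                     (Fin.toℕ-injective (trans (edge-upper (fromℕ< k<m)) (trans (cong upper k≡) r)))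

  linked : ∀ {u v} → Adjacent u v → Link (toℕ u) (toℕ v) ⊎ Link (toℕ v) (toℕ u)
  linked (inj₁ e) with k , refl ← ∈-tabulate⁻ {f = edge} e = inj₁ (toℕ k , Fin.toℕ<n k , sym (edge-lower k) , sym (edge-upper k))
  linked (inj₂ e) with k , refl ← ∈-tabulate⁻ {f = edge} e = inj₂ (toℕ k , Fin.toℕ<n k , sym (edge-lower k) , sym (edge-upper k))

  link-hub : ∀ r t → r < 2 → r + t * 2 < m₀ → Link t (2 + H ∸ r)
  link-hub r t r<2 lt = r + t * 2 , ≤-trans lt (m≤m+n m₀ _) , trans (if-< lt) (quotient t 2 r<2) ,
    trans (if-< lt) (cong (2 + H ∸_) (remainder t 2 r<2))

  link-row : ∀ {i c} → i < N → c ≤ M → Link (target i c) (3 + H + i)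
  link-row {i} {c} i<N c≤M = k , +-monoʳ-< m₀ q< , trans (if-≥ (m≤m+n m₀ q)) (cong₂ target q/ q%) ,
      trans (if-≥ (m≤m+n m₀ q)) (cong (3 + H +_) q/)
    where
    q = c + i * suc M
    k = m₀ + q
    q/ : (k ∸ m₀) / suc M ≡ i
    q/ = trans (cong (_/ suc M) (m+n∸m≡n m₀ q)) (quotient i (suc M) (s≤s c≤M))
    q% : (k ∸ m₀) % suc M ≡ c
    q% = trans (cong (_% suc M) (m+n∸m≡n m₀ q)) (remainder i (suc M) (s≤s c≤M))
    q< : q < N * suc M
    q< = <-≤-trans (+-monoˡ-< (i * suc M) (s≤s c≤M)) (*-monoˡ-≤ (suc M) i<N)

  -- Distances in the gadget

  data Kind (u : Vertex) : Set where
    low        : toℕ u ≤ 2 + H → Kind u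
    assignment : ∀ i → i < N → toℕ u ≡ 3 + H + i → Kind u

  kind : ∀ u → Kind u
  kind u with toℕ u ≤? 2 + H
  ... | yes u≤ = low u≤
  ... | no  u≰ = assignment i (+-cancelˡ-< (3 + H) i N (subst (_< V) eq (Fin.toℕ<n u))) eq
    where
    i = toℕ u ∸ (3 + H)
    eq : toℕ u ≡ 3 + H + i
    eq = sym (m+[n∸m]≡n (≰⇒> u≰))

  vertex : ∀ {v} → v < V → Vertex
  vertex v<V = fromℕ< v<V

  hub<V : ∀ s → s < 2 → suc s + H < V
  hub<V s s<2 = s≤s (≤-trans (+-monoˡ-≤ H s<2) (m≤m+n _ N))

  hubOf : ∀ i → Vertex
  hubOf i = vertex (hub<V (i % 2) (m%n<n i 2))

  toℕ-hub : ∀ i → toℕ (hubOf i) ≡ suc (i % 2) + H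
  toℕ-hub i = Fin.toℕ-fromℕ< (hub<V (i % 2) (m%n<n i 2))

  near-hub-low : ∀ {u v s} → s < 2 → toℕ v ≡ suc s + H → toℕ u ≤ 2 + H → Near graph u v
  near-hub-low {u} {v} {s} s<2 v≡ u≤ with <-cmp (toℕ u) (toℕ v)
  ... | tri≈ _ eq _ = inj₁ (Fin.toℕ-injective eq)
  ... | tri< u<v _ _ = inj₂ (adjacent (subst (Link (toℕ u)) (trans ∸≡ (sym v≡))
          (link-hub (1 ∸ s) (toℕ u) (s≤s (m∸n≤m 1 s)) (bound s s<2 (subst (toℕ u <_) v≡ u<v)))))
    where
    ∸≡ : 2 + H ∸ (1 ∸ s) ≡ suc s + H
    ∸≡ = flip-side s s<2
      where
      flip-side : ∀ s → s < 2 → 2 + H ∸ (1 ∸ s) ≡ suc s + H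
      flip-side zero _ = refl
      flip-side (suc zero) _ = refl
      flip-side (suc (suc _)) (s≤s (s≤s ()))
    bound : ∀ s → s < 2 → toℕ u < suc s + H → (1 ∸ s) + toℕ u * 2 < m₀
    bound zero _ (s≤s u≤H) = s≤s (s≤s (m≤n⇒m≤1+n (*-monoˡ-≤ 2 u≤H)))
    bound (suc zero) _ (s≤s u≤) = s≤s (*-monoˡ-≤ 2 u≤)
    bound (suc (suc _)) (s≤s (s≤s ()))
  -- A low vertex above a hub can only be the larger hub above the smaller one; this is the last hub
  -- edge, number 2 (1 + H).
  ... | tri> _ _ v<u = inj₂ (swap (adjacent (subst₂ Link (sym v≡x) (sym u≡y) (link-hub 0 (1 + H) (s≤s z≤n) ≤-refl))))
    where
    v≡x : toℕ v ≡ 1 + H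
    v≡x = ≤-antisym (s≤s⁻¹ (≤-trans v<u u≤)) (≤-trans (s≤s (m≤n+m H s)) (≤-reflexive (sym v≡)))
    u≡y : toℕ u ≡ 2 + H
    u≡y = ≤-antisym u≤ (subst (_< toℕ u) v≡x v<u)

  low-hub : ∀ {u} j → toℕ u ≤ 2 + H → Near graph u (hubOf j)
  low-hub j = near-hub-low (m%n<n j 2) (toℕ-hub j)

  hub-low : ∀ j → toℕ (hubOf j) ≤ 2 + H
  hub-low j = subst (_≤ 2 + H) (sym (toℕ-hub j)) (+-monoˡ-≤ H (m%n<n j 2))

  -- The row edge for the extra clause `M` supplies the link: that clause is always satisfied, so
  -- the edge ends at the hub for the parity of `i`.
  assignment-hub : ∀ {u i} j → i < N → toℕ u ≡ 3 + H + i → i % 2 ≡ j % 2 → Near graph u (hubOf j)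
  assignment-hub {u} {i} j i<N u≡ eq = inj₂ (swap (adjacent (subst₂ Link
    (trans (target-M i) (trans (cong (λ s → suc s + H) eq) (sym (toℕ-hub j)))) (sym u≡) (link-row i<N ≤-refl))))

  some-hub : ∀ u → ∃[ j ] Near graph u (hubOf j)
  some-hub u with kind u
  ... | low u≤ = 0 , low-hub 0 u≤
  ... | assignment i i<N u≡ = i , assignment-hub i i<N u≡ refl

  within-3 : ∀ u v → Within graph 3 u v
  within-3 u v with i , a ← some-hub u | j , b ← some-hub v =
    near³ graph a (low-hub j (hub-low i)) (near-sym graph b)

  Covers : ℕ → ℕ → Set
  Covers i j = ∀ c → c < M → sat i c ∨ sat j c ≡ true

  record Cover : Set where
    constructor cover
    field
      {left right} : ℕ
      left<N  : left < N
      right<N : right < N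
      even    : left % 2 ≡ 0
      odd     : right % 2 ≡ 1
      covers  : Covers left right

  target-false : ∀ {i c} → sat i c ≡ false → target i c ≡ c * 3
  target-false eq rewrite eq = refl

  covers-or-close : ∀ {u v i j} → i < N → j < N → toℕ u ≡ 3 + H + i → toℕ v ≡ 3 + H + j →
                    Within graph 2 u v ⊎ Covers i j
  covers-or-close {u} {v} {i} {j} i<N j<N u≡ v≡
    with anyUpTo? (λ c → (sat i c Bool.≟ false) ×-dec (sat j c Bool.≟ false)) M
  ... | yes (c , c<M , fi , fj) = inj₁ (near² graph
          (inj₂ (swap (adjacent (subst₂ Link (trans (target-false fi) (sym w≡)) (sym u≡) (link-row i<N (<⇒≤ c<M))))))
          (inj₂ (adjacent (subst₂ Link (trans (target-false fj) (sym w≡)) (sym v≡) (link-row j<N (<⇒≤ c<M))))))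
    where
    w≡ : toℕ (vertex {c * 3} (s≤s (≤-trans (*-monoˡ-≤ 3 (<⇒≤ c<M)) (≤-trans (m≤n+m H 2) (m≤m+n _ N))))) ≡ c * 3
    w≡ = Fin.toℕ-fromℕ< _
  ... | no ¬∃ = inj₂ covered
    where
    covered : Covers i j
    covered c c<M with sat i c in ei | sat j c in ej
    ... | true  | _     = refl
    ... | false | true  = refl
    ... | false | false = contradiction (c , c<M , ei , ej) ¬∃

  even-or-odd : ∀ n → n % 2 ≡ 0 ⊎ n % 2 ≡ 1
  even-or-odd n with n % 2 | m%n<n n 2
  ... | zero        | _ = inj₁ refl
  ... | suc zero    | _ = inj₂ refl
  ... | suc (suc _) | s≤s (s≤s ())

  within-2 : ∀ u v → Within graph 2 u v ⊎ Cover
  within-2 u v with kind u | kind v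
  ... | low u≤ | low v≤ = inj₁ (near² graph (low-hub 0 u≤) (near-sym graph (low-hub 0 v≤)))
  ... | low u≤ | assignment j j<N v≡ = inj₁ (near² graph (low-hub j u≤) (near-sym graph (assignment-hub j j<N v≡ refl)))
  ... | assignment i i<N u≡ | low v≤ = inj₁ (near² graph (assignment-hub i i<N u≡ refl) (near-sym graph (low-hub i v≤)))
  ... | assignment i i<N u≡ | assignment j j<N v≡ with even-or-odd i | even-or-odd j
  ...   | inj₁ ei | inj₁ ej = inj₁ (near² graph (assignment-hub 0 i<N u≡ ei) (near-sym graph (assignment-hub 0 j<N v≡ ej)))
  ...   | inj₂ ei | inj₂ ej = inj₁ (near² graph (assignment-hub 1 i<N u≡ ei) (near-sym graph (assignment-hub 1 j<N v≡ ej)))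
  ...   | inj₁ ei | inj₂ ej with covers-or-close i<N j<N u≡ v≡
  ...     | inj₁ p = inj₁ p
  ...     | inj₂ c = inj₂ (cover i<N j<N ei ej c)
  within-2 u v | assignment i i<N u≡ | assignment j j<N v≡ | inj₂ ei | inj₁ ej with covers-or-close i<N j<N u≡ v≡
  ...     | inj₁ p = inj₁ p
  ...     | inj₂ c = inj₂ (cover j<N i<N ej ei λ k k<M → trans (Bool.∨-comm (sat j k) (sat i k)) (c k k<M))

  -- Assignment numbers exceed all lower endpoints and both hubs, so such a vertex occurs only as
  -- the upper endpoint of the edges in its own row.
  neighbour : ∀ {u w i} → toℕ u ≡ 3 + H + i → Adjacent u w → ∃[ c ] c ≤ M × toℕ w ≡ target i c
  neighbour {u} {w} {i} u≡ a with linked a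
  ... | inj₁ (k , k<m , l , _) = contradiction (trans l u≡) (<⇒≢ (s≤s (≤-trans (lower-≤ k<m) (m≤m+n _ i))))
  ... | inj₂ (k , k<m , l , r) with view k<m
  ...   | hub x t _ _ _ _ r′ = contradiction (trans (sym r′) (trans r u≡)) (<⇒≢ (s≤s (≤-trans (m∸n≤m _ x) (m≤m+n _ i))))
  ...   | row j c _ c≤M _ l′ r′ with refl ← +-cancelˡ-≡ (3 + H) i j (trans (sym u≡) (trans (sym r) r′)) =
    c , c≤M , trans (sym l) l′

  module _ (C : Cover) where

    open Cover C

    -- Division by 3 gives c = c′. Within the block the offset is 0 for a falsified clause, and
    -- otherwise 1 on the even side and 2 on the odd side, so the targets agree only if both sides
    -- falsify `c`; this excludes c = M.
    common : ∀ {c c′} → c ≤ M → target left c ≡ target right c′ → sat left c ∨ sat right c ≡ false × c < M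
    common {c} {c′} c≤M eq
      with refl ← trans (sym (quotient c 3 (offset<3 left c))) (trans (cong (_/ 3) eq) (quotient c′ 3 (offset<3 right c′)))
      with eq′ ← +-cancelʳ-≡ (c * 3) _ _ eq
      rewrite even | odd
      with sat left c in el | sat right c in er
    ... | false | false = refl , ≤∧≢⇒< c≤M λ { refl → contradiction (trans (sym (sat-M left)) el) λ () }
    ... | true | true = contradiction eq′ λ ()
    ... | true | false = contradiction eq′ λ ()
    ... | false | true = contradiction eq′ λ ()

    apart : ∀ {u v} → toℕ u ≡ 3 + H + left → toℕ v ≡ 3 + H + right → ¬ Within graph 2 u v
    apart u≡ v≡ (_ , _ , nil) = contradiction (trans (sym even) (trans (cong (_% 2) same) odd)) λ ()
      where same = +-cancelˡ-≡ (3 + H) left right (trans (sym u≡) v≡)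
    apart u≡ v≡ (_ , _ , cons a nil) with c , c≤M , eq ← neighbour u≡ a =
      contradiction (trans (sym eq) v≡) (<⇒≢ (s≤s (≤-trans (target-≤ left c≤M) (m≤m+n _ right))))
    apart u≡ v≡ (_ , _ , cons a (cons b nil))
      with c , c≤M , eq ← neighbour u≡ a | c′ , _ , eq′ ← neighbour v≡ (swap b)
      with no-cover , c<M ← common c≤M (trans (sym eq) eq′) =
      contradiction (trans (sym (covers c c<M)) no-cover) λ ()
    apart u≡ v≡ (_ , s≤s (s≤s ()) , cons _ (cons _ (cons _ _)))

    far : ∃[ u ] ∃[ v ] ¬ Within graph 2 u v
    far = vertex left<V , vertex right<V , apart (Fin.toℕ-fromℕ< left<V) (Fin.toℕ-fromℕ< right<V)
      where
      left<V  = +-monoʳ-< (3 + H) left<N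
      right<V = +-monoʳ-< (3 + H) right<N

  gadget-diameter : ∃[ D ] IsDiameter D
  gadget-diameter = diameter-exists graph 3 (hubOf 0) within-3

  cover⇒diameter≥3 : ∀ {D} → IsDiameter D → Cover → 3 ≤ D
  cover⇒diameter≥3 isD C = far⇒diameter> graph (proj₂ (proj₂ (far C))) isD

  diameter≥3⇒cover : ∀ {D} → IsDiameter D → 3 ≤ D → Cover
  diameter≥3⇒cover {D} (_ , u , v , _ , shortest) 3≤D with within-2 u v
  ... | inj₂ C = C
  ... | inj₁ (l , l≤2 , p) = contradiction p (shortest l (<-≤-trans (s≤s l≤2) 3≤D))

-- Satisfiability as a covering problem

≡ᵇ-true : ∀ {x y} → x ≡ y → (x ≡ᵇ y) ≡ true
≡ᵇ-true {x} {y} eq = Equivalence.to Bool.T-≡ (≡⇒≡ᵇ x y eq)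

true-≡ᵇ : ∀ x y → (x ≡ᵇ y) ≡ true → x ≡ y
true-≡ᵇ x y eq = ≡ᵇ⇒≡ x y (Equivalence.from Bool.T-≡ eq)

∧-true : ∀ {x y} → x ∧ y ≡ true → x ≡ true × y ≡ true
∧-true {true} eq = refl , eq

∨-true : ∀ x {y} → x ∨ y ≡ true → x ≡ true ⊎ y ≡ true
∨-true true  eq = inj₁ refl
∨-true false eq = inj₂ eq

bitAt : ℕ → ℕ → ℕ
bitAt j a = iterate (λ a _ → a / 2) j a % 2

pack : (ℕ → Bool) → ℕ → ℕ
pack f zero    = 0
pack f (suc h) = bit (f 0) + pack (f ∘ suc) h * 2

bit<2 : ∀ b → bit b < 2
bit<2 b = s≤s (bit≤1 b)

pack< : ∀ f h → pack f h < 2 ^ h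
pack< f zero    = s≤s z≤n
pack< f (suc h) = begin-strict
  bit (f 0) + pack (f ∘ suc) h * 2 <⟨ +-monoˡ-< _ (bit<2 (f 0)) ⟩
  suc (pack (f ∘ suc) h) * 2       ≤⟨ *-monoˡ-≤ 2 (pack< (f ∘ suc) h) ⟩
  2 ^ h * 2                        ≡⟨ *-comm (2 ^ h) 2 ⟩
  2 ^ suc h                        ∎
  where open ≤-Reasoning

bitAt-pack : ∀ f {h} j → j < h → bitAt j (pack f h) ≡ bit (f j)
bitAt-pack f {suc h} zero    _         = remainder (pack (f ∘ suc) h) 2 (bit<2 (f 0))
bitAt-pack f {suc h} (suc j) (s≤s j<h) = trans
  (cong (bitAt j) (quotient (pack (f ∘ suc) h) 2 (bit<2 (f 0)))) (bitAt-pack (f ∘ suc) j j<h)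

-- Vertex i stands for the assignment of the variables v ≡ i (mod 2) whose
-- value at v is bit v / 2 of i / 2; ℓ is the code of a literal.
literalTrue : ℕ → ℕ → Bool
literalTrue i ℓ = ((ℓ / 2) % 2 ≡ᵇ i % 2) ∧ (bitAt (ℓ / 2 / 2) (i / 2) ≡ᵇ ℓ % 2)

module _ {n} (x : Fin n) (b : Bool) where

  private
    code : encodeLiteral (x , b) ≡ bit b + toℕ x * 2
    code = trans (+-comm (2 * toℕ x) (bit b)) (cong (bit b +_) (*-comm 2 (toℕ x)))

  literal-variable : encodeLiteral (x , b) / 2 ≡ toℕ x
  literal-variable = trans (cong (_/ 2) code) (quotient (toℕ x) 2 (bit<2 b))

  literal-sign : encodeLiteral (x , b) % 2 ≡ bit b
  literal-sign = trans (cong (_% 2) code) (remainder (toℕ x) 2 (bit<2 b))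

  literalTrue⁺ : ∀ i → toℕ x % 2 ≡ i % 2 → bitAt (toℕ x / 2) (i / 2) ≡ bit b →
                 literalTrue i (encodeLiteral (x , b)) ≡ true
  literalTrue⁺ i eq eq′ rewrite literal-variable | literal-sign | ≡ᵇ-true eq = ≡ᵇ-true eq′

  literalTrue⁻ : ∀ i → literalTrue i (encodeLiteral (x , b)) ≡ true →
                 toℕ x % 2 ≡ i % 2 × bitAt (toℕ x / 2) (i / 2) ≡ bit b
  literalTrue⁻ i eq rewrite literal-variable | literal-sign with e , e′ ← ∧-true eq =
    true-≡ᵇ _ _ e , true-≡ᵇ _ _ e′

-- The disjunction runs from the highest index down because `loop` passes the number of remaining
-- rounds to its body; `iterate-any` then matches the two directly.
anyBelow : (ℕ → Bool) → ℕ → Bool → Bool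
anyBelow h zero    b = b
anyBelow h (suc j) b = anyBelow h j (b ∨ h j)

anyBelow-start : ∀ h n → anyBelow h n true ≡ true
anyBelow-start h zero    = refl
anyBelow-start h (suc n) = anyBelow-start h n

anyBelow⁺ : ∀ h n {b j} → j < n → h j ≡ true → anyBelow h n b ≡ true
anyBelow⁺ h (suc n) {b} {j} (s≤s j≤n) hj with j ≟ n
... | yes refl rewrite hj | Bool.∨-zeroʳ b = anyBelow-start h n
... | no  j≢n  = anyBelow⁺ h n (≤∧≢⇒< j≤n j≢n) hj

anyBelow⁻ : ∀ h n {b} → anyBelow h n b ≡ true → b ≡ true ⊎ ∃[ j ] j < n × h j ≡ true
anyBelow⁻ h zero    eq = inj₁ eq
anyBelow⁻ h (suc n) {b} eq with anyBelow⁻ h n eq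
... | inj₂ (j , j<n , hj) = inj₂ (j , m<n⇒m<1+n j<n , hj)
... | inj₁ eq′ with ∨-true b eq′
...   | inj₁ b≡ = inj₁ b≡
...   | inj₂ hn = inj₂ (n , ≤-refl , hn)

cell-++ˡ : ∀ xs ys {j} → j < length xs → cell (xs ++ ys) j ≡ cell xs j
cell-++ˡ (x ∷ xs) ys {zero}  _         = refl
cell-++ˡ (x ∷ xs) ys {suc j} (s≤s j<n) = cell-++ˡ xs ys j<n

cell-++ʳ : ∀ xs ys j → cell (xs ++ ys) (length xs + j) ≡ cell ys j
cell-++ʳ []       ys j = refl
cell-++ʳ (x ∷ xs) ys j = cell-++ʳ xs ys j

cell-any⁺ : ∀ {A : Set} (P : ℕ → Set) (f : A → ℕ) {xs} → Any (P ∘ f) xs →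
            ∃[ j ] j < length xs × P (cell (map f xs) j)
cell-any⁺ P f (here p)  = 0 , s≤s z≤n , p
cell-any⁺ P f (there a) with j , j<n , p ← cell-any⁺ P f a = suc j , s≤s j<n , p

cell-any⁻ : ∀ {A : Set} (P : ℕ → Set) (f : A → ℕ) {xs} j → j < length xs →
            P (cell (map f xs) j) → Any (P ∘ f) xs
cell-any⁻ P f {x ∷ xs} zero    _         p = here p
cell-any⁻ P f {x ∷ xs} (suc j) (s≤s j<n) p = there (cell-any⁻ P f j j<n p)

module Formula {n : ℕ} (φ : CNF n) where

  tape : ℕ → ℕ
  tape = cell (encodeCNF φ)

  M L : ℕ
  M = length φ
  L = length (encodeCNF φ)

  next : ℕ → ℕ → ℕ
  next p _ = p + (1 + tape p)

  -- Encoded clauses have different lengths, so clause `c` is reached by skipping its predecessors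
  -- from address 2, behind the numbers of variables and clauses. For c = M this is the end of the
  -- formula.
  position : ℕ → ℕ
  position c = iterate next c 2

  -- Starting the disjunction from `M ≤ᵇ c` declares the extra clause `M` satisfied without a branch
  -- in the compiled code.
  sat : ℕ → ℕ → Bool
  sat i c = anyBelow (λ j → literalTrue i (tape (position c + (1 + j)))) (tape (position c)) (M ≤ᵇ c)

  -- `content` also covers `j` past the end, so for empty `ψ` it says that the length cell at `p`
  -- reads 0.
  record Suffix (p : ℕ) (ψ : CNF n) : Set where
    field
      content : ∀ j → tape (p + j) ≡ cell (concatMap encodeClause ψ) j
      ending  : p + length (concatMap encodeClause ψ) ≡ L

  open Suffix public

  suffix-start : Suffix 2 φ
  suffix-start .content j = refl
  suffix-start .ending    = refl

  suffix-length : ∀ {p κ ψ} → Suffix p (κ ∷ ψ) → tape p ≡ length κ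
  suffix-length {p} S = trans (cong tape (sym (+-identityʳ p))) (S .content 0)

  suffix-literal : ∀ {p κ ψ} → Suffix p (κ ∷ ψ) → ∀ {j} → j < length κ →
                   tape (p + (1 + j)) ≡ cell (map encodeLiteral κ) j
  suffix-literal {p} {κ} S {j} j< = trans (S .content (1 + j))
    (cell-++ˡ (map encodeLiteral κ) _ (subst (j <_) (sym (length-map encodeLiteral κ)) j<))

  suffix-next : ∀ {p κ ψ j} → Suffix p (κ ∷ ψ) → Suffix (next p j) ψ
  suffix-next {p} {κ} {ψ} S .content j = begin
    tape (p + (1 + tape p) + j)                     ≡⟨ cong tape (+-assoc p (1 + tape p) j) ⟩
    tape (p + (1 + tape p + j))                     ≡⟨ S .content (1 + tape p + j) ⟩
    cell (map encodeLiteral κ ++ rest) (tape p + j) ≡⟨ cong (λ k → cell (map encodeLiteral κ ++ rest) (k + j))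
                                                  (trans (suffix-length S) (sym (length-map encodeLiteral κ))) ⟩
    cell (map encodeLiteral κ ++ rest) (length (map encodeLiteral κ) + j) ≡⟨ cell-++ʳ (map encodeLiteral κ) rest j ⟩
    cell rest j ∎
    where
    open ≡-Reasoning
    rest = concatMap encodeClause ψ
  suffix-next {p} {κ} {ψ} S .ending = begin
    p + (1 + tape p) + length rest        ≡⟨ +-assoc p (1 + tape p) _ ⟩
    p + (1 + (tape p + length rest))      ≡⟨ cong (λ k → p + (1 + (k + length rest)))
                                          (trans (suffix-length S) (sym (length-map encodeLiteral κ))) ⟩
    p + (1 + (length (map encodeLiteral κ) + length rest)) ≡⟨ cong (λ k → p + (1 + k)) (length-++ (map encodeLiteral κ)) ⟨
    p + length (concatMap encodeClause (κ ∷ ψ)) ≡⟨ S .ending ⟩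
    L ∎
    where
    open ≡-Reasoning
    rest = concatMap encodeClause ψ

  suffix-≤ : ∀ {p ψ} → Suffix p ψ → p ≤ L
  suffix-≤ {p} S = subst (p ≤_) (S .ending) (m≤m+n p _)

  suffix-end : ∀ {p κ ψ} → Suffix p (κ ∷ ψ) → p + (1 + tape p) ≤ L
  suffix-end S = suffix-≤ (suffix-next {j = 0} S)

  suffix-iterate : ∀ c {p} {ψ} → c ≤ length ψ → Suffix p ψ → Suffix (iterate next c p) (drop c ψ)
  suffix-iterate zero    c≤ S = S
  suffix-iterate (suc c) {ψ = κ ∷ ψ} (s≤s c≤) S = suffix-iterate c c≤ (suffix-next {j = c} S)

  suffix-position : ∀ {c} → c ≤ M → Suffix (position c) (drop c φ)
  suffix-position c≤ = suffix-iterate _ c≤ suffix-start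

  sat-M : ∀ i → sat i M ≡ true
  sat-M i rewrite Equivalence.to Bool.T-≡ (≤⇒≤ᵇ (≤-refl {M})) = anyBelow-start _ (tape (position M))

  ClauseTrue : ℕ → Clause n → Set
  ClauseTrue i = Any (λ l → literalTrue i (encodeLiteral l) ≡ true)

  sat⁺ : ∀ {c κ ψ} i → c ≤ M → drop c φ ≡ κ ∷ ψ → ClauseTrue i κ → sat i c ≡ true
  sat⁺ {c} {κ} {ψ} i c≤M eq a
    with S ← subst (Suffix (position c)) eq (suffix-position c≤M)
    with j , j< , p ← cell-any⁺ (λ ℓ → literalTrue i ℓ ≡ true) encodeLiteral a =
    anyBelow⁺ _ (tape (position c)) (subst (j <_) (sym (suffix-length S)) j<)
      (trans (cong (literalTrue i) (suffix-literal S j<)) p)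

  sat⁻ : ∀ {c κ ψ} i → c < M → drop c φ ≡ κ ∷ ψ → sat i c ≡ true → ClauseTrue i κ
  sat⁻ {c} {κ} {ψ} i c<M eq s
    with S ← subst (Suffix (position c)) eq (suffix-position (<⇒≤ c<M))
    with anyBelow⁻ (λ j → literalTrue i (tape (position c + (1 + j)))) (tape (position c)) s
  ... | inj₁ M≤c = contradiction (≤ᵇ⇒≤ M c (Equivalence.from Bool.T-≡ M≤c)) (<⇒≱ c<M)
  ... | inj₂ (j , j< , p) with j<′ ← subst (j <_) (suffix-length S) j< =
    cell-any⁻ (λ ℓ → literalTrue i ℓ ≡ true) encodeLiteral j j<′ (trans (cong (literalTrue i) (sym (suffix-literal S j<′))) p)

drop-∈ : ∀ {A : Set} {xs : List A} {x} → x ∈ xs → ∃[ c ] c < length xs × ∃[ ys ] drop c xs ≡ x ∷ ys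
drop-∈ (here refl) = 0 , s≤s z≤n , _ , refl
drop-∈ (there x∈) with c , c< , ys , eq ← drop-∈ x∈ = suc c , s≤s c< , ys , eq

drop-< : ∀ {A : Set} (xs : List A) {c} → c < length xs → ∃[ x ] ∃[ ys ] drop c xs ≡ x ∷ ys × x ∈ xs
drop-< (x ∷ xs) {zero}  _        = x , xs , refl , here refl
drop-< (x ∷ xs) {suc c} (s≤s c<) with y , ys , eq , y∈ ← drop-< xs c< = y , ys , eq , there y∈

module Split {n : ℕ} (φ : CNF n) where

  open Formula φ

  -- The machine has no exponentiation, so `N` is given as the doubling loop that `assignmentsᵉ`
  -- performs. It starts at 2 to count both halves.
  h N : ℕ
  h = (n + 1) / 2
  N = iterate (λ a _ → a + a) h 2

  double : ∀ h a → iterate (λ a _ → a + a) h a ≡ a * 2 ^ h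
  double zero    a = sym (*-identityʳ a)
  double (suc h) a = trans (double h (a + a)) (begin
    (a + a) * 2 ^ h ≡⟨ cong (λ x → (a + x) * 2 ^ h) (+-identityʳ a) ⟨
    2 * a * 2 ^ h   ≡⟨ cong (_* 2 ^ h) (*-comm 2 a) ⟩
    a * 2 * 2 ^ h   ≡⟨ *-assoc a 2 (2 ^ h) ⟩
    a * 2 ^ suc h   ∎)
    where open ≡-Reasoning

  N≡ : N ≡ 2 * 2 ^ h
  N≡ = double h 2

  open Gadget M N sat sat-M public

  half<h : ∀ (x : Fin n) → toℕ x / 2 < h
  half<h x = begin
    suc (toℕ x / 2)   ≡⟨ +-comm 1 (toℕ x / 2) ⟩
    toℕ x / 2 + 2 / 2 ≡⟨ +-distrib-/-∣ʳ (toℕ x) {2} {2} ∣-refl ⟨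
    (toℕ x + 2) / 2   ≤⟨ /-monoˡ-≤ 2 (≤-trans (≤-reflexive (+-suc (toℕ x) 1)) (+-monoˡ-≤ 1 (Fin.toℕ<n x))) ⟩
    (n + 1) / 2       ∎
    where open ≤-Reasoning

  cover⇒satisfiable : Cover → Satisfiable φ
  cover⇒satisfiable C = α , All.tabulate clause
    where
    open Cover C
    α : Fin n → Bool
    α x = if toℕ x % 2 ≡ᵇ 0 then bitAt (toℕ x / 2) (left / 2) ≡ᵇ 1 else bitAt (toℕ x / 2) (right / 2) ≡ᵇ 1
    bit-≡ᵇ : ∀ {v b} → v ≡ bit b → (v ≡ᵇ 1) ≡ b
    bit-≡ᵇ {b = true}  refl = refl
    bit-≡ᵇ {b = false} refl = refl
    literal-left : ∀ (l : Literal n) → literalTrue left (encodeLiteral l) ≡ true → α (proj₁ l) ≡ proj₂ l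
    literal-left (x , b) eq with e , e′ ← literalTrue⁻ x b left eq rewrite trans e even = bit-≡ᵇ e′
    literal-right : ∀ (l : Literal n) → literalTrue right (encodeLiteral l) ≡ true → α (proj₁ l) ≡ proj₂ l
    literal-right (x , b) eq with e , e′ ← literalTrue⁻ x b right eq rewrite trans e odd = bit-≡ᵇ e′
    clause : ∀ {κ} → κ ∈ φ → Any (λ l → α (proj₁ l) ≡ proj₂ l) κ
    clause κ∈ with c , c<M , ψ , eq ← drop-∈ κ∈ with ∨-true (sat left c) (covers c c<M)
    ... | inj₁ s = Any.map (λ {l} → literal-left l) (sat⁻ left c<M eq s)
    ... | inj₂ s = Any.map (λ {l} → literal-right l) (sat⁻ right c<M eq s)

  satisfiable⇒cover : Satisfiable φ → Cover
  satisfiable⇒cover (α , satisfies) = cover (index<N 0 (s≤s z≤n)) (index<N 1 ≤-refl)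
      (remainder (assigned 0) 2 (s≤s z≤n)) (remainder (assigned 1) 2 ≤-refl) covered
    where
    -- For odd `n` the odd half has one bit too many, which stands for a nonexistent variable `n`;
    -- it is set to `false`.
    value : ℕ → Bool
    value v with v <? n
    ... | yes v<n = α (fromℕ< v<n)
    ... | no  _   = false
    value-toℕ : ∀ x → value (toℕ x) ≡ α x
    value-toℕ x with toℕ x <? n
    ... | yes v<n = cong α (Fin.fromℕ<-toℕ x v<n)
    ... | no  v≮n = contradiction (Fin.toℕ<n x) v≮n
    assigned : ℕ → ℕ
    assigned s = pack (λ j → value (s + j * 2)) h
    index : ℕ → ℕ
    index s = s + assigned s * 2
    index<N : ∀ s → s < 2 → index s < N
    index<N s s<2 = begin-strict
      s + assigned s * 2   <⟨ +-monoˡ-< _ s<2 ⟩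
      suc (assigned s) * 2 ≤⟨ *-monoˡ-≤ 2 (pack< _ h) ⟩
      2 ^ h * 2            ≡⟨ *-comm (2 ^ h) 2 ⟩
      2 * 2 ^ h            ≡⟨ N≡ ⟨
      N                    ∎
      where open ≤-Reasoning
    literal-true : ∀ {x b} s → toℕ x % 2 ≡ s → α x ≡ b → literalTrue (index s) (encodeLiteral (x , b)) ≡ true
    literal-true {x} {b} s eq αx = literalTrue⁺ x b (index s) (trans eq (sym (remainder (assigned s) 2 s<2)))
      (begin
        bitAt (toℕ x / 2) (index s / 2)    ≡⟨ cong (bitAt (toℕ x / 2)) (quotient (assigned s) 2 s<2) ⟩
        bitAt (toℕ x / 2) (assigned s)     ≡⟨ bitAt-pack _ (toℕ x / 2) (half<h x) ⟩
        bit (value (s + toℕ x / 2 * 2))    ≡⟨ cong (λ r → bit (value (r + toℕ x / 2 * 2))) eq ⟨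
        bit (value (toℕ x % 2 + toℕ x / 2 * 2)) ≡⟨ cong (bit ∘ value) (m≡m%n+[m/n]*n (toℕ x) 2) ⟨
        bit (value (toℕ x))                ≡⟨ cong bit (trans (value-toℕ x) αx) ⟩
        bit b                              ∎)
      where
      open ≡-Reasoning
      s<2 : s < 2
      s<2 = subst (_< 2) eq (m%n<n (toℕ x) 2)
    choose : ∀ {κ} → Any (λ l → α (proj₁ l) ≡ proj₂ l) κ → ClauseTrue (index 0) κ ⊎ ClauseTrue (index 1) κ
    choose (here {x , b} αx) with even-or-odd (toℕ x)
    ... | inj₁ e = inj₁ (here (literal-true 0 e αx))
    ... | inj₂ e = inj₂ (here (literal-true 1 e αx))
    choose (there a) = [ (λ l → inj₁ (there l)) , (λ r → inj₂ (there r)) ]′ (choose a)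
    covered : Covers (index 0) (index 1)
    covered c c<M with κ , ψ , eq , κ∈ ← drop-< φ c<M with choose (All.lookup satisfies κ∈)
    ... | inj₁ t = cong (_∨ sat (index 1) c) (sat⁺ (index 0) (<⇒≤ c<M) eq t)
    ... | inj₂ t = trans (cong (sat (index 0) c ∨_) (sat⁺ (index 1) (<⇒≤ c<M) eq t)) (Bool.∨-zeroʳ (sat (index 0) c))

-- Expressions for the edges

infixl 6 _⊕_ _⊖_
infixl 7 _⊗_ _⊘_

_⊕_ _⊖_ _⊗_ _⊘_ : ∀ {k} → Exp k → Exp k → Exp k
_⊕_ = op add
_⊖_ = op sub
_⊗_ = op mul
_⊘_ = op div

-- Truth values are 0 and 1. Truncated subtraction from 1 negates, and (a - b) + (b - a) is the
-- absolute difference.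
equalᵉ orᵉ : ∀ {k} → Exp k → Exp k → Exp k
equalᵉ a b = lit 1 ⊖ ((a ⊖ b) ⊕ (b ⊖ a))
orᵉ a b    = lit 1 ⊖ ((lit 1 ⊖ a) ⊗ (lit 1 ⊖ b))

oddᵉ : ∀ {k} → Exp k → Exp k
oddᵉ a = a ⊖ a ⊘ lit 2 ⊗ lit 2

literalᵉ : ∀ {k} → Exp k → Exp k → Exp k
literalᵉ i ℓ =
  equalᵉ (oddᵉ (ℓ ⊘ lit 2)) (oddᵉ i) ⊗
  equalᵉ (oddᵉ (loop (ℓ ⊘ lit 2 ⊘ lit 2) (i ⊘ lit 2) (var 0F ⊘ lit 2))) (oddᵉ ℓ)

positionᵉ : ∀ {k} → Exp k → Exp k
positionᵉ c = loop c (lit 2) (var 0F ⊕ (lit 1 ⊕ read (var 0F)))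

satᵉ : ∀ {k} → Fin k → Fin k → Fin k → Exp k
satᵉ i c M = bind (positionᵉ (var c))
  (loop (read (var 0F)) (lit 1 ⊖ (var (suc M) ⊖ var (suc c)))
    (orᵉ (var 0F) (literalᵉ (var (suc (suc (suc i)))) (read (var 2F ⊕ (lit 1 ⊕ var 1F))))))

Hᵉ m₀ᵉ : ∀ {k} → Exp k → Exp k
Hᵉ M  = M ⊗ lit 3
m₀ᵉ M = lit 3 ⊕ Hᵉ M ⊗ lit 2

-- The value is that of b when k < m₀, and that of a otherwise.
selectᵉ : ∀ {k} → Exp k → Exp k → Exp k → Exp k → Exp k
selectᵉ k M a b = (lit 1 ⊖ (m₀ᵉ M ⊖ k)) ⊗ a ⊕ (lit 1 ⊖ (lit 1 ⊖ (m₀ᵉ M ⊖ k))) ⊗ b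

-- The variables are an edge number k, the number M of clauses, and the base
-- address of the graph.
lowerᵉ upperᵉ : Exp 3
lowerᵉ =
  bind ((var 0F ⊖ m₀ᵉ (var 1F)) ⊘ (lit 1 ⊕ var 1F))
  (bind ((var 1F ⊖ m₀ᵉ (var 2F)) ⊖ var 0F ⊗ (lit 1 ⊕ var 2F))
    (selectᵉ (var 2F) (var 3F)
      (satᵉ 1F 0F 3F ⊗ (lit 1 ⊕ oddᵉ (var 1F)) ⊕ var 0F ⊗ lit 3)
      (var 2F ⊘ lit 2)))
upperᵉ = selectᵉ (var 0F) (var 1F)
  (lit 3 ⊕ Hᵉ (var 1F) ⊕ (var 0F ⊖ m₀ᵉ (var 1F)) ⊘ (lit 1 ⊕ var 1F))
  (lit 2 ⊕ Hᵉ (var 1F) ⊖ oddᵉ (var 0F))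

-- The graph starts one cell behind the end of the formula: for the extra clause `M`, `satᵉ` reads a
-- length at address `position M`, and that cell must remain 0.
clausesᵉ baseᵉ assignmentsᵉ : Exp 0
clausesᵉ     = read (lit 1)
baseᵉ        = lit 1 ⊕ positionᵉ clausesᵉ
assignmentsᵉ = loop ((read (lit 0) ⊕ lit 1) ⊘ lit 2) (lit 2) (var 0F ⊕ var 0F)

-- The variables are the number N of assignment vertices, M, and the base
-- address.
orderᵉ sizeᵉ : Exp 3
orderᵉ = lit 3 ⊕ Hᵉ (var 1F) ⊕ var 0F
sizeᵉ  = m₀ᵉ (var 1F) ⊕ var 0F ⊗ (lit 1 ⊕ var 1F)

equal-bit : ∀ x y → 1 ∸ ((x ∸ y) + (y ∸ x)) ≡ bit (x ≡ᵇ y)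
equal-bit zero    zero    = refl
equal-bit zero    (suc y) = 0∸n≡0 y
equal-bit (suc x) zero    = 0∸n≡0 (x + 0)
equal-bit (suc x) (suc y) = equal-bit x y

or-bit : ∀ a b → 1 ∸ (1 ∸ bit a) * (1 ∸ bit b) ≡ bit (a ∨ b)
or-bit true  b     = refl
or-bit false true  = refl
or-bit false false = refl

and-bit : ∀ a b → bit a * bit b ≡ bit (a ∧ b)
and-bit true  true  = refl
and-bit true  false = refl
and-bit false b     = refl

≤-bit : ∀ a b → 1 ∸ (a ∸ b) ≡ bit (a ≤ᵇ b)
≤-bit a b with a ≤? b
... | yes a≤b rewrite dec-true (a ≤? b) a≤b | m≤n⇒m∸n≡0 a≤b = refl
... | no  a≰b rewrite dec-false (a ≤? b) a≰b = m≤n⇒m∸n≡0 (m<n⇒0<n∸m (≰⇒> a≰b))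

iterate-any : ∀ {f} h → (∀ a j → f (bit a) j ≡ bit (a ∨ h j)) →
              ∀ n b → iterate f n (bit b) ≡ bit (anyBelow h n b)
iterate-any h eq zero    b = refl
iterate-any {f} h eq (suc n) b = trans (cong (iterate f n) (eq b n)) (iterate-any h eq n (b ∨ h n))

select-if : ∀ k n {a b : ℕ} → (1 ∸ (n ∸ k)) * a + (1 ∸ (1 ∸ (n ∸ k))) * b ≡ (if k <ᵇ n then b else a)
select-if k n {a} {b} with k <? n
... | yes k<n rewrite dec-true (k <? n) k<n | m≤n⇒m∸n≡0 (m<n⇒0<n∸m k<n) = +-identityʳ b
... | no  k≮n rewrite dec-false (k <? n) k≮n | m≤n⇒m∸n≡0 (≮⇒≥ k≮n) = trans (+-identityʳ _) (+-identityʳ a)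

odd-eval : ∀ a → a ∸ a / 2 * 2 ≡ a % 2
odd-eval a = sym (m%n≡m∸m/n*n a 2)

literal-eval : ∀ {k} t (i ℓ : Exp k) ρ → eval t (literalᵉ i ℓ) ρ ≡ bit (literalTrue (eval t i ρ) (eval t ℓ ρ))
literal-eval t i ℓ ρ
  rewrite odd-eval (eval t ℓ ρ / 2) | odd-eval (eval t i ρ) | odd-eval (eval t ℓ ρ)
        | odd-eval (iterate (λ a _ → a / 2) (eval t ℓ ρ / 2 / 2) (eval t i ρ / 2))
        | equal-bit (eval t ℓ ρ / 2 % 2) (eval t i ρ % 2)
        | equal-bit (bitAt (eval t ℓ ρ / 2 / 2) (eval t i ρ / 2)) (eval t ℓ ρ % 2) =
  and-bit (eval t ℓ ρ / 2 % 2 ≡ᵇ eval t i ρ % 2) (bitAt (eval t ℓ ρ / 2 / 2) (eval t i ρ / 2) ≡ᵇ eval t ℓ ρ % 2)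

-- Values and safety of the expressions for the graph

module Evaluation {n : ℕ} (φ : CNF n) where

  open Formula φ
  open Split φ

  sat-eval : ∀ {k} (i c Mᵛ : Fin k) ρ → lookup ρ Mᵛ ≡ M →
             eval tape (satᵉ i c Mᵛ) ρ ≡ bit (sat (lookup ρ i) (lookup ρ c))
  sat-eval i c Mᵛ ρ M≡ = trans (cong (iterate body len) (trans (cong (λ x → 1 ∸ (x ∸ lookup ρ c)) M≡) (≤-bit M (lookup ρ c))))
      (iterate-any (λ j → literalTrue (lookup ρ i) (tape (p + (1 + j)))) step len (M ≤ᵇ lookup ρ c))
    where
    p   = position (lookup ρ c)
    len = tape p
    body : ℕ → ℕ → ℕ
    body a j = eval tape (orᵉ (var 0F) (literalᵉ (var (suc (suc (suc i)))) (read (var 2F ⊕ (lit 1 ⊕ var 1F)))))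
                 (a ∷ j ∷ p ∷ ρ)
    step : ∀ a j → body (bit a) j ≡ bit (a ∨ literalTrue (lookup ρ i) (tape (p + (1 + j))))
    step a j = trans (cong (λ x → 1 ∸ (1 ∸ bit a) * (1 ∸ x))
      (literal-eval tape (var (suc (suc (suc i)))) (read (var 2F ⊕ (lit 1 ⊕ var 1F))) (bit a ∷ j ∷ p ∷ ρ)))
      (or-bit a _)

  lower-eval : ∀ k B → eval tape lowerᵉ (k ∷ M ∷ B ∷ []) ≡ lower k
  lower-eval k B = begin
    eval tape lowerᵉ (k ∷ M ∷ B ∷ [])
      ≡⟨ select-if k m₀ ⟩
    (if k <ᵇ m₀ then k / 2
     else eval tape (satᵉ 1F 0F 3F) (q ∸ i * suc M ∷ i ∷ k ∷ M ∷ B ∷ []) * suc (i ∸ i / 2 * 2) + (q ∸ i * suc M) * 3)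
      ≡⟨ cong₃ (λ x y c → if k <ᵇ m₀ then k / 2 else x * suc y + c * 3)
           (trans (sat-eval 1F 0F 3F (q ∸ i * suc M ∷ i ∷ k ∷ M ∷ B ∷ []) refl) (cong (λ c → bit (sat i c)) c≡)) (odd-eval i) c≡ ⟩
    lower k ∎
    where
    open ≡-Reasoning
    q = k ∸ m₀
    i = q / suc M
    c≡ : q ∸ i * suc M ≡ q % suc M
    c≡ = sym (m%n≡m∸m/n*n q (suc M))
    cong₃ : ∀ (f : ℕ → ℕ → ℕ → ℕ) {x x′ y y′ z z′} → x ≡ x′ → y ≡ y′ → z ≡ z′ → f x y z ≡ f x′ y′ z′
    cong₃ f refl refl refl = refl

  upper-eval : ∀ k B → eval tape upperᵉ (k ∷ M ∷ B ∷ []) ≡ upper k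
  upper-eval k B = trans (select-if k m₀)
    (cong (λ r → if k <ᵇ m₀ then 2 + H ∸ r else 3 + H + (k ∸ m₀) / suc M) (odd-eval k))

  position-M : position M ≡ L
  position-M = trans (sym (+-identityʳ (position M))) (subst Suffix′ (drop-all M φ ≤-refl) (suffix-position ≤-refl) .ending)
    where
    Suffix′ : CNF n → Set
    Suffix′ = Suffix (position M)

  base-eval : eval tape baseᵉ [] ≡ suc L
  base-eval = cong suc position-M

  size# : ℕ
  size# = formulaSize φ

  tape-beyond : ∀ a → L ≤ a → tape a ≡ 0
  tape-beyond = cell-beyond (encodeCNF φ)
    where
    cell-beyond : ∀ xs a → length xs ≤ a → cell xs a ≡ 0
    cell-beyond []       a       _         = refl
    cell-beyond (x ∷ xs) (suc a) (s≤s len) = cell-beyond xs a len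

  cell-++-≤ : ∀ {X} xs ys → (∀ a → cell xs a ≤ X) → (∀ a → cell ys a ≤ X) → ∀ a → cell (xs ++ ys) a ≤ X
  cell-++-≤ []       ys x≤ y≤ a       = y≤ a
  cell-++-≤ (x ∷ xs) ys x≤ y≤ zero    = x≤ 0
  cell-++-≤ (x ∷ xs) ys x≤ y≤ (suc a) = cell-++-≤ xs ys (x≤ ∘ suc) y≤ a

  literals-≤ : ∀ (κ : Clause n) a → cell (map encodeLiteral κ) a ≤ 2 * n
  literals-≤ []            a       = z≤n
  literals-≤ ((x , b) ∷ κ) zero    = begin
    2 * toℕ x + bit b ≤⟨ +-monoʳ-≤ (2 * toℕ x) (≤-trans (bit≤1 b) (n≤1+n 1)) ⟩
    2 * toℕ x + 2     ≡⟨ trans (+-comm (2 * toℕ x) 2) (sym (*-suc 2 (toℕ x))) ⟩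
    2 * suc (toℕ x)   ≤⟨ *-monoʳ-≤ 2 (Fin.toℕ<n x) ⟩
    2 * n             ∎
    where open ≤-Reasoning
  literals-≤ (l ∷ κ)       (suc a) = literals-≤ κ a

  clauses-≤ : ∀ {X} (ψ : CNF n) → 2 * n ≤ X → length (concatMap encodeClause ψ) ≤ X →
              ∀ a → cell (concatMap encodeClause ψ) a ≤ X
  clauses-≤ [] n≤ len≤ a = z≤n
  clauses-≤ (κ ∷ ψ) n≤ len≤ zero = ≤-trans (m≤m+n (length κ) _) (≤-trans (n≤1+n _)
    (≤-trans (≤-reflexive (cong suc (sym (trans (length-++ (map encodeLiteral κ)) (cong (_+ _) (length-map encodeLiteral κ)))))) len≤))
  clauses-≤ (κ ∷ ψ) n≤ len≤ (suc a) = cell-++-≤ (map encodeLiteral κ) _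
    (λ a → ≤-trans (literals-≤ κ a) n≤)
    (clauses-≤ ψ n≤ (≤-trans (≤-trans (m≤n+m _ (length (map encodeLiteral κ)))
      (≤-trans (≤-reflexive (sym (length-++ (map encodeLiteral κ)))) (n≤1+n _))) len≤)) a

  M+2≤L : 2 + M ≤ L
  M+2≤L = s≤s (s≤s (count φ))
    where
    count : ∀ (ψ : CNF n) → length ψ ≤ length (concatMap encodeClause ψ)
    count []      = z≤n
    count (κ ∷ ψ) = s≤s (≤-trans (count ψ) (≤-trans (m≤n+m _ (length (map encodeLiteral κ)))
      (≤-reflexive (sym (length-++ (map encodeLiteral κ))))))

  M≤L : M ≤ L
  M≤L = ≤-trans (m≤n+m M 2) M+2≤L

  -- Literal codes are bounded only by 2n, whence the factor 2; all other entries are at most the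
  -- formula size. The same number serves as `rounds`.
  tape-≤ : ∀ a → tape a ≤ 2 * size#
  tape-≤ 0 = ≤-trans (m≤m+n n _) (m≤m+n size# _)
  tape-≤ 1 = ≤-trans M≤L (≤-trans (m≤n+m L n) (m≤m+n size# _))
  tape-≤ (suc (suc a)) = clauses-≤ φ (*-monoʳ-≤ 2 (m≤m+n n L))
    (≤-trans (m≤n+m _ 2) (≤-trans (m≤n+m L n) (m≤m+n size# _))) a

  limits : ℕ → Limits
  limits Z = record { contents = tape ; extent = suc L ; rounds = 2 * size# ; ceiling = Z }

  module Safe (Z : ℕ) (X≤Z : 2 * size# ≤ Z) (N≤Z : N ≤ Z) where

    open Compiled (limits Z) using (Ok; Iterates)

    L≤X : L ≤ 2 * size#
    L≤X = ≤-trans (m≤n+m L n) (m≤m+n size# _)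

    L≤Z : L ≤ Z
    L≤Z = ≤-trans L≤X X≤Z

    M≤X : M ≤ 2 * size#
    M≤X = ≤-trans M≤L L≤X

    2≤Z : 2 ≤ Z
    2≤Z = ≤-trans (s≤s (s≤s z≤n)) L≤Z

    equal-ok : ∀ {k} {a b : Exp k} {ρ} → Ok a ρ → Ok b ρ → Ok (equalᵉ a b) ρ
    equal-ok a b = _ , (a , b) , (b , a)

    odd-ok : ∀ {k} {a : Exp k} {ρ} → Ok a ρ → Ok (oddᵉ a) ρ
    odd-ok a = a , (a , _) , _

    halving : ∀ j {a} → a ≤ Z → Iterates (λ _ _ → ⊤ × ⊤) (λ a _ → a / 2) j a
    halving zero    a≤ = a≤
    halving (suc j) {a} a≤ = a≤ , _ , halving j (≤-trans (m/n≤m a 2) a≤)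

    literal-ok : ∀ {k} (i ℓ : Exp k) {ρ} → Ok i ρ → Ok ℓ ρ → eval tape i ρ ≤ Z →
                 eval tape ℓ ρ ≤ 2 * size# → Ok (literalᵉ i ℓ) ρ
    literal-ok i ℓ {ρ} oki okℓ i≤ ℓ≤ =
      equal-ok {a = oddᵉ (ℓ ⊘ lit 2)} {oddᵉ i} (odd-ok {a = ℓ ⊘ lit 2} (okℓ , _)) (odd-ok {a = i} oki) ,
      equal-ok {a = oddᵉ bits} {oddᵉ ℓ} (odd-ok {a = bits} (((okℓ , _) , _) , (oki , _) ,
        ≤-trans (m/n≤m (eval tape ℓ ρ / 2) 2) (≤-trans (m/n≤m (eval tape ℓ ρ) 2) ℓ≤) ,
        halving (eval tape ℓ ρ / 2 / 2) (≤-trans (m/n≤m (eval tape i ρ) 2) i≤)))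
        (odd-ok {a = ℓ} okℓ)
      where bits = loop (ℓ ⊘ lit 2 ⊘ lit 2) (i ⊘ lit 2) (var 0F ⊘ lit 2)

    walking : ∀ c {p ψ} → c ≤ length ψ → Suffix p ψ →
              Iterates (λ a _ → ⊤ × ⊤ × ⊤ × a < suc L) next c p
    walking zero    c≤ S = ≤-trans (suffix-≤ S) L≤Z
    walking (suc c) {ψ = κ ∷ ψ} (s≤s c≤) S =
      ≤-trans (suffix-≤ S) L≤Z , (_ , _ , _ , s≤s (suffix-≤ S)) , walking c c≤ (suffix-next {j = c} S)

    position-ok : ∀ {k} (c : Exp k) {ρ} → Ok c ρ → eval tape c ρ ≤ M → Ok (positionᵉ c) ρ
    position-ok c {ρ} okc c≤ = okc , _ , ≤-trans c≤ M≤X , walking (eval tape c ρ) c≤ suffix-start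

    clause-end : ∀ {p ψ} → Suffix p ψ → p + tape p ≤ L
    clause-end {p} {[]} S rewrite trans (cong tape (sym (+-identityʳ p))) (S .content 0) | +-identityʳ p = suffix-≤ S
    clause-end {p} {κ ∷ ψ} S = ≤-trans (+-monoʳ-≤ p (n≤1+n (tape p))) (suffix-end S)

    sat-ok : ∀ {k} (i c Mᵛ : Fin k) {ρ} → lookup ρ i ≤ Z → lookup ρ c ≤ M → Ok (satᵉ i c Mᵛ) ρ
    sat-ok i c Mᵛ {ρ} i≤ c≤ = position-ok (var c) {ρ} _ c≤ ,
        (_ , s≤s (suffix-≤ S)) , _ , tape-≤ p , scanning (tape p) (m∸n≤m 1 (lookup ρ Mᵛ ∸ lookup ρ c)) ≤-refl
      where
      p = position (lookup ρ c)
      S = suffix-position c≤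
      literal = literalᵉ (var (suc (suc (suc i)))) (read (var 2F ⊕ (lit 1 ⊕ var 1F)))
      scanning : ∀ j {a} → a ≤ 1 → j ≤ tape p →
        Iterates (λ a j → Ok (orᵉ (var 0F) literal) (a ∷ j ∷ p ∷ ρ))
                 (λ a j → eval tape (orᵉ (var 0F) literal) (a ∷ j ∷ p ∷ ρ)) j a
      scanning zero    a≤ j≤ = ≤-trans a≤ (≤-trans (n≤1+n 1) 2≤Z)
      scanning (suc j) {a} a≤ j≤ = ≤-trans a≤ (≤-trans (n≤1+n 1) 2≤Z) ,
        (_ , _ , _ , literal-ok (var (suc (suc (suc i)))) (read (var 2F ⊕ (lit 1 ⊕ var 1F))) {a ∷ j ∷ p ∷ ρ} _
           (_ , s≤s (≤-trans (+-monoʳ-≤ p j≤) (clause-end S))) i≤ (tape-≤ (p + (1 + j)))) ,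
        scanning j (m∸n≤m 1 ((1 ∸ a) * (1 ∸ eval tape literal (a ∷ j ∷ p ∷ ρ)))) (≤-trans (n≤1+n j) j≤)

    -- `selectᵉ` evaluates both alternatives, so the satisfaction test must be safe for hub edges
    -- too; there `k ∸ m₀` is 0 and it runs with i = c = 0.
    lower-ok : ∀ {k} B → k < m → Ok lowerᵉ (k ∷ M ∷ B ∷ [])
    lower-ok {k} B k<m = _ , _ , (_ , (sat-ok 1F 0F 3F {c ∷ i ∷ k ∷ M ∷ B ∷ []} (≤-trans i≤N N≤Z) c≤M , _) , _) , _
      where
      q = k ∸ m₀
      i = q / suc M
      c = q ∸ i * suc M
      i≤N : i ≤ N
      i≤N = ≤-trans (/-monoˡ-≤ (suc M) (≤-trans (∸-monoˡ-≤ m₀ (<⇒≤ k<m)) (≤-reflexive (m+n∸m≡n m₀ _))))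
        (≤-reflexive (m*n/n≡m N (suc M)))
      c≤M : c ≤ M
      c≤M = ≤-trans (≤-reflexive (sym (m%n≡m∸m/n*n q (suc M)))) (s≤s⁻¹ (m%n<n q (suc M)))

    upper-ok : ∀ {k} B → Ok upperᵉ (k ∷ M ∷ B ∷ [])
    upper-ok B = _

    clauses-ok : Ok clausesᵉ []
    clauses-ok = tt , s≤s (s≤s z≤n)

    base-ok : Ok baseᵉ []
    base-ok = _ , position-ok clausesᵉ {[]} clauses-ok ≤-refl

    -- Doubling never decreases the accumulator, so a bound on the final value covers all rounds.
    doubling : ∀ j {a} → iterate (λ a _ → a + a) j a ≤ Z → Iterates (λ _ _ → ⊤ × ⊤) (λ a _ → a + a) j a
    doubling zero    a≤ = a≤
    doubling (suc j) {a} it≤ = ≤-trans (grow (suc j) {a}) it≤ , _ , doubling j it≤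
      where
      grow : ∀ j {a} → a ≤ iterate (λ a _ → a + a) j a
      grow zero    = ≤-refl
      grow (suc j) {a} = ≤-trans (m≤m+n a a) (grow j)

    h≤X : h ≤ 2 * size#
    h≤X = ≤-trans (m/n≤m (n + 1) 2) (≤-trans (+-monoʳ-≤ n (s≤s z≤n)) (m≤m+n size# _))

    assignments-ok : Ok assignmentsᵉ []
    assignments-ok = (((_ , s≤s z≤n) , _) , _) , _ , h≤X , doubling h N≤Z

-- Writing the graph to memory

slot₀ slot₁ : Exp 3
slot₀ = var 2F ⊕ (lit 2 ⊕ var 0F ⊗ lit 2)
slot₁ = var 2F ⊕ (lit 3 ⊕ var 0F ⊗ lit 2)

params counters : Vec Reg 3
params   = 2 ∷ 1 ∷ 0 ∷ []
counters = 3 ∷ 1 ∷ 0 ∷ []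

-- The counter is lowered first, so the pass that leaves it at `j` writes edge `j`, and the edges
-- appear from last to first.
fill : Program
fill = while 3 (decrement 3 ⨾ poke slot₀ lowerᵉ counters 4 ⨾ poke slot₁ upperᵉ counters 4)

base₀ base₁ : Exp 3
base₀ = var 2F
base₁ = lit 1 ⊕ var 2F

-- Registers 0, 1, 2 and 3 receive the base, `M`, `N` and the number of edges. The base then stays
-- where `relocate` looks for it.
writeGraph : Program
writeGraph =
  (compile baseᵉ [] 0 ⨾ compile clausesᵉ [] 1 ⨾ compile assignmentsᵉ [] 2) ⨾
  (poke base₀ orderᵉ params 3 ⨾ poke base₁ sizeᵉ params 3 ⨾ compile sizeᵉ params 3) ⨾
  fill

writeGraph-registers : Writes< offset writeGraph
writeGraph-registers = _

-- Exponents for the counter, `M` and the base: the counter starts at the number of edges and so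
-- takes over the degree of `sizeᵉ`.
δ : Vec ℕ 3
δ = degree sizeᵉ (1 ∷ 1 ∷ 1 ∷ []) ∷ 1 ∷ 1 ∷ []

-- 6000 exceeds the peaks of all expressions compiled below.
record Machine {n} (φ : CNF n) (Z W : ℕ) : Set where
  open Formula φ using (L)
  open Split φ using (N)
  field
    X≤Z  : 2 * formulaSize φ ≤ Z
    N≤Z  : N ≤ Z
    L<Z  : suc L ≤ Z
    room : ∀ p → p ≤ 6000 → Z ^ p < W

-- The 3 is the loop test and the two steps of the decrement.
edgeTime setupTime : ℕ → ℕ
edgeTime X = 3 + ((cost slot₀ + (cost lowerᵉ + 1)) * X ^ (nesting slot₀ + nesting lowerᵉ) +
                  (cost slot₁ + (cost upperᵉ + 1)) * X ^ (nesting slot₁ + nesting upperᵉ))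
setupTime X =
  (cost baseᵉ * X ^ nesting baseᵉ +
    (cost clausesᵉ * X ^ nesting clausesᵉ + cost assignmentsᵉ * X ^ nesting assignmentsᵉ)) +
  ((cost base₀ + (cost orderᵉ + 1)) * X ^ (nesting base₀ + nesting orderᵉ) +
    ((cost base₁ + (cost sizeᵉ + 1)) * X ^ (nesting base₁ + nesting sizeᵉ) +
     cost sizeᵉ * X ^ nesting sizeᵉ))

module Writing {n} (φ : CNF n) {Z W : ℕ} (machine : Machine φ Z W) where

  open Machine machine
  open Formula φ using (tape; L; M)
  open Split φ using (N; m; V; lower; upper; graph)
  open Evaluation φ
  open Safe Z X≤Z N≤Z
  open Compiled (limits Z)

  X B : ℕ
  X = 2 * size#
  B = suc L

  bounds : Bounds W
  bounds = record
    { 1<W = room 0 z≤n ; 2≤Z = 2≤Z ; X≤Z = X≤Z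
    ; 1≤X = ≤-trans (s≤s z≤n) L≤X ; cells = λ a → ≤-trans (tape-≤ a) X≤Z }

  open Correct bounds

  roomy : ∀ {k} (e : Exp k) δ → T (peak e δ ≤ᵇ 6000) → Z ^ peak e δ < W
  roomy e δ ok = room (peak e δ) (≤ᵇ⇒≤ (peak e δ) 6000 ok)

  -- The effect of the remaining `j` rounds. They write only edges below `j`, and `after` is what
  -- preserves the edges written earlier.
  record Filled (j : ℕ) (s s′ : State) : Set where
    field
      registers : ∀ x → x < 3 → reg s′ x ≡ reg s x
      lowers    : ∀ k → k < j → mem s′ (B + (2 + k * 2)) ≡ lower k
      uppers    : ∀ k → k < j → mem s′ (B + (3 + k * 2)) ≡ upper k
      before    : ∀ a → a < B + 2 → mem s′ a ≡ mem s a
      after     : ∀ a → B + (2 + j * 2) ≤ a → mem s′ a ≡ mem s a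

  open Filled

  M≤Z^1 : M ≤ Z ^ 1
  M≤Z^1 = ≤-trans (≤-trans M≤X X≤Z) (≤-reflexive (sym Z^1))
  B≤Z^1 : B ≤ Z ^ 1
  B≤Z^1 = ≤-trans L<Z (≤-reflexive (sym Z^1))
  N≤Z^1 : N ≤ Z ^ 1
  N≤Z^1 = ≤-trans N≤Z (≤-reflexive (sym Z^1))

  below-params : Below (N ∷ M ∷ B ∷ []) (1 ∷ 1 ∷ 1 ∷ [])
  below-params 0F = N≤Z^1
  below-params 1F = M≤Z^1
  below-params 2F = B≤Z^1

  m≤Z^ : m ≤ Z ^ lookup δ 0F
  m≤Z^ = eval-≤ sizeᵉ {N ∷ M ∷ B ∷ []} {1 ∷ 1 ∷ 1 ∷ []} _ below-params

  below-counters : ∀ {k} → k ≤ m → Below (k ∷ M ∷ B ∷ []) δ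
  below-counters k≤m 0F = ≤-trans k≤m m≤Z^
  below-counters k≤m 1F = M≤Z^1
  below-counters k≤m 2F = B≤Z^1

  edge-correct : ∀ {j s} → j < m → Holds counters (j ∷ M ∷ B ∷ []) 4 s →
    Exec W (poke slot₀ lowerᵉ counters 4 ⨾ poke slot₁ upperᵉ counters 4) s
      ((cost slot₀ + (cost lowerᵉ + 1)) * X ^ (nesting slot₀ + nesting lowerᵉ) +
       (cost slot₁ + (cost upperᵉ + 1)) * X ^ (nesting slot₁ + nesting upperᵉ))
      (λ s′ → (∀ x → x < 4 → reg s′ x ≡ reg s x) ×
              (∀ a → mem s′ a ≡ ((mem s [ B + (2 + j * 2) ↦ lower j ]) [ B + (3 + j * 2) ↦ upper j ]) a))
  edge-correct {j} {s} j<m H =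
    exec-seq (poke-correct slot₀ lowerᵉ {δ = δ} _ (lower-ok B j<m) (below-counters (<⇒≤ j<m))
      (roomy slot₀ δ tt) (roomy lowerᵉ δ tt) H) λ {s₁} K₁ →
    exec-map (poke-correct slot₁ upperᵉ {δ = δ} _ (upper-ok {j} B) (below-counters (<⇒≤ j<m))
      (roomy slot₁ δ tt) (roomy upperᵉ δ tt) (poked-holds (m≤m+n B _) H K₁)) λ {s₂} K₂ →
    both {s₁} {s₂} (subst (λ v → Poked 4 (B + (2 + j * 2)) v s s₁) (lower-eval j B) K₁)
                   (subst (λ v → Poked 4 (B + (3 + j * 2)) v s₁ s₂) (upper-eval j B) K₂)
    where
    both : ∀ {s₁ s₂} → Poked 4 (B + (2 + j * 2)) (lower j) s s₁ → Poked 4 (B + (3 + j * 2)) (upper j) s₁ s₂ →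
           (∀ x → x < 4 → reg s₂ x ≡ reg s x) ×
           (∀ a → mem s₂ a ≡ ((mem s [ B + (2 + j * 2) ↦ lower j ]) [ B + (3 + j * 2) ↦ upper j ]) a)
    both K₁ K₂ = (λ x x<4 → trans (K₂ .kept-reg x x<4) (K₁ .kept-reg x x<4)) ,
                 λ a → trans (K₂ .poked a) (update-cong (B + (3 + j * 2)) (K₁ .poked) a)

  filled-step : ∀ {j s s₁ s₂} → (∀ x → x < 3 → reg s₁ x ≡ reg s x) →
    (∀ a → mem s₁ a ≡ ((mem s [ B + (2 + j * 2) ↦ lower j ]) [ B + (3 + j * 2) ↦ upper j ]) a) →
    Filled j s₁ s₂ → Filled (suc j) s s₂
  filled-step regs mems F .registers x x<3 = trans (F .registers x x<3) (regs x x<3)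
  filled-step {j} {s} regs mems F .lowers k k≤j with m≤n⇒m<n∨m≡n (s≤s⁻¹ k≤j)
  ... | inj₁ k<j  = F .lowers k k<j
  ... | inj₂ refl = trans (F .after _ ≤-refl) (trans (mems _) (trans
          (update-other (mem s [ B + (2 + j * 2) ↦ lower j ]) (>⇒≢ (+-monoʳ-< B (n<1+n (2 + j * 2)))))
          (update-same (mem s) (B + (2 + j * 2)))))
  filled-step {j} {s} regs mems F .uppers k k≤j with m≤n⇒m<n∨m≡n (s≤s⁻¹ k≤j)
  ... | inj₁ k<j  = F .uppers k k<j
  ... | inj₂ refl = trans (F .after _ (+-monoʳ-≤ B (n≤1+n (2 + j * 2)))) (trans (mems _)
          (update-same (mem s [ B + (2 + j * 2) ↦ lower j ]) (B + (3 + j * 2))))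
  filled-step {j} {s} regs mems F .before a a< = trans (F .before a a<) (trans (mems a) (trans
    (update-other (mem s [ B + (2 + j * 2) ↦ lower j ]) (>⇒≢ (<-≤-trans a< (+-monoʳ-≤ B (s≤s (s≤s z≤n))))))
    (update-other (mem s) (>⇒≢ (<-≤-trans a< (+-monoʳ-≤ B (s≤s (s≤s z≤n))))))))
  filled-step {j} {s} regs mems F .after a ≤a = trans (F .after a (≤-trans (+-monoʳ-≤ B (m≤n+m (2 + j * 2) 2)) ≤a))
    (trans (mems a) (trans
      (update-other (mem s [ B + (2 + j * 2) ↦ lower j ]) (<⇒≢ (<-≤-trans (+-monoʳ-< B (n<1+n (3 + j * 2))) ≤a)))
      (update-other (mem s) (<⇒≢ (<-≤-trans (+-monoʳ-< B (m<n⇒m<1+n (n<1+n (2 + j * 2)))) ≤a)))))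

  fill-correct : ∀ j {s} → j ≤ m → Holds counters (j ∷ M ∷ B ∷ []) 4 s →
                 Exec W fill s (j * edgeTime X + 1) (Filled j s)
  fill-correct zero j≤m H = _ , _ , ⇓exit (H .value 0F) , ≤-refl , record
    { registers = λ _ _ → refl ; lowers = λ _ () ; uppers = λ _ ()
    ; before = λ _ _ → refl ; after = λ _ _ → refl }
  fill-correct (suc j) {s} j<m H =
    exec-weaken (≤-reflexive (sym (+-assoc (edgeTime X) (j * edgeTime X) 1)))
      (exec-loop (λ e → 1+n≢0 (trans (sym (H .value 0F)) e))
        (exec-seq (decremented (H .value 0F) (≤-<-trans (≤-trans (<⇒≤ j<m) m≤Z^) (room (lookup δ 0F) (≤ᵇ⇒≤ _ _ tt)))) λ R →
         exec-map (edge-correct j<m (decremented-holds R)) (step R))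
        λ (regs , mems , H′) → exec-map (fill-correct j (<⇒≤ j<m) H′) (filled-step regs mems))
    where
    decremented-holds : ∀ {s₁} → Returns 3 j s s₁ → Holds counters (j ∷ M ∷ B ∷ []) 4 s₁
    decremented-holds R .fresh = H .fresh
    decremented-holds R .value 0F = R .result
    decremented-holds R .value 1F = trans (R .saved 1 (≤ᵇ⇒≤ 2 3 tt)) (H .value 1F)
    decremented-holds R .value 2F = trans (R .saved 0 (≤ᵇ⇒≤ 1 3 tt)) (H .value 2F)
    decremented-holds R .input a a<B = trans (R .intact a) (H .input a a<B)

    Step : State → State → Set
    Step s s₂ = ∀ a → mem s₂ a ≡ ((mem s [ B + (2 + j * 2) ↦ lower j ]) [ B + (3 + j * 2) ↦ upper j ]) a

    step : ∀ {s₁ s₂} → Returns 3 j s s₁ → (∀ x → x < 4 → reg s₂ x ≡ reg s₁ x) × Step s₁ s₂ →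
           (∀ x → x < 3 → reg s₂ x ≡ reg s x) × Step s s₂ × Holds counters (j ∷ M ∷ B ∷ []) 4 s₂
    step {s₁} R (regs , mems) =
      (λ x x<3 → trans (regs x (m<n⇒m<1+n x<3)) (R .saved x x<3)) ,
      (λ a → trans (mems a) (update-cong (B + (3 + j * 2)) (update-cong (B + (2 + j * 2)) (R .intact)) a)) ,
      record { fresh = H .fresh
             ; value = λ x → trans (regs _ (H .fresh x)) (decremented-holds R .value x)
             ; input = λ a a<B → trans (mems a) (trans
                 (update-other (mem s₁ [ B + (2 + j * 2) ↦ lower j ]) (>⇒≢ (<-≤-trans a<B (m≤m+n B _))))
                 (trans (update-other (mem s₁) (>⇒≢ (<-≤-trans a<B (m≤m+n B _)))) (decremented-holds R .input a a<B))) }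

  record Written (s : State) : Set where
    field
      base   : reg s 0 ≡ B
      order  : mem s (B + 0) ≡ V
      size   : mem s (B + 1) ≡ m
      lowers : ∀ k → k < m → mem s (B + (2 + k * 2)) ≡ lower k
      uppers : ∀ k → k < m → mem s (B + (3 + k * 2)) ≡ upper k
      blank  : ∀ a → B + (2 + m * 2) ≤ a → mem s a ≡ 0

  record Prepared (s : State) : Set where
    field
      holds  : Holds params (N ∷ M ∷ B ∷ []) 3 s
      unused : ∀ a → B ≤ a → mem s a ≡ 0

  open Prepared

  prepare-correct : Exec W (compile baseᵉ [] 0 ⨾ compile clausesᵉ [] 1 ⨾ compile assignmentsᵉ [] 2)
    (initial (encodeCNF φ))
    (cost baseᵉ * X ^ nesting baseᵉ + (cost clausesᵉ * X ^ nesting clausesᵉ + cost assignmentsᵉ * X ^ nesting assignmentsᵉ))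
    Prepared
  prepare-correct =
    exec-seq (compile-correct baseᵉ {[]} {[]} {[]} base-ok (λ ()) (roomy baseᵉ [] tt) H₀) λ R₁ →
    exec-seq (compile-correct clausesᵉ {[]} {[]} {[]} clauses-ok (λ ()) (roomy clausesᵉ [] tt) (kept H₀ R₁)) λ R₂ →
    exec-map (compile-correct assignmentsᵉ {[]} {[]} {[]} assignments-ok (λ ()) (roomy assignmentsᵉ [] tt) (kept (kept H₀ R₁) R₂)) λ R₃ →
    record
      { holds = record
        { fresh = λ { 0F → ≤ᵇ⇒≤ 3 3 tt ; 1F → ≤ᵇ⇒≤ 2 3 tt ; 2F → ≤ᵇ⇒≤ 1 3 tt }
        ; value = λ { 0F → R₃ .result ; 1F → trans (R₃ .saved 1 (≤ᵇ⇒≤ 2 2 tt)) (R₂ .result)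
                    ; 2F → trans (R₃ .saved 0 (≤ᵇ⇒≤ 1 2 tt)) (trans (R₂ .saved 0 (≤ᵇ⇒≤ 1 1 tt)) (trans (R₁ .result) base-eval)) }
        ; input = kept (kept (kept H₀ R₁) R₂) R₃ .input }
      ; unused = λ a B≤a → trans (R₃ .intact a) (trans (R₂ .intact a) (trans (R₁ .intact a) (tape-beyond a (<⇒≤ B≤a)))) }
    where
    H₀ : Holds [] [] 0 (initial (encodeCNF φ))
    H₀ = record { fresh = λ () ; value = λ () ; input = λ _ _ → refl }

  record Sized (s : State) : Set where
    field
      counter : Holds counters (m ∷ M ∷ B ∷ []) 4 s
      order   : mem s (B + 0) ≡ V
      size    : mem s (B + 1) ≡ m
      blank   : ∀ a → B + 2 ≤ a → mem s a ≡ 0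

  open Sized

  size-correct : ∀ {s} → Prepared s →
    Exec W (poke base₀ orderᵉ params 3 ⨾ poke base₁ sizeᵉ params 3 ⨾ compile sizeᵉ params 3) s
      ((cost base₀ + (cost orderᵉ + 1)) * X ^ (nesting base₀ + nesting orderᵉ) +
       ((cost base₁ + (cost sizeᵉ + 1)) * X ^ (nesting base₁ + nesting sizeᵉ) +
        cost sizeᵉ * X ^ nesting sizeᵉ)) Sized
  size-correct {s} P =
    exec-seq (poke-correct base₀ orderᵉ {params} {ρ} {δ₁} _ _ below-params
      (roomy base₀ δ₁ tt) (roomy orderᵉ δ₁ tt) (P .holds)) λ K₁ →
    exec-seq (poke-correct base₁ sizeᵉ {params} {ρ} {δ₁} _ _ below-params
      (roomy base₁ δ₁ tt) (roomy sizeᵉ δ₁ tt) (poked-holds ≤-refl (P .holds) K₁)) λ {s₂} K₂ →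
    exec-map (compile-correct sizeᵉ {params} {ρ} {δ₁} _ below-params (roomy sizeᵉ δ₁ tt)
      (poked-holds (n≤1+n B) (poked-holds ≤-refl (P .holds) K₁) K₂)) λ R → sized K₁ K₂ R
    where
    ρ δ₁ : Vec ℕ 3
    ρ  = N ∷ M ∷ B ∷ []
    δ₁ = 1 ∷ 1 ∷ 1 ∷ []
    sized : ∀ {s₁ s₂ s₃} → Poked 3 B V s s₁ → Poked 3 (1 + B) m s₁ s₂ → Returns 3 m s₂ s₃ → Sized s₃
    sized {s₁} K₁ K₂ R = record
      { counter = record
        { fresh = λ { 0F → ≤ᵇ⇒≤ 4 4 tt ; 1F → ≤ᵇ⇒≤ 2 4 tt ; 2F → ≤ᵇ⇒≤ 1 4 tt }
        ; value = λ { 0F → R .result ; 1F → H .value 1F ; 2F → H .value 2F }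
        ; input = H .input }
      ; order = trans (R .intact _) (trans (K₂ .poked _) (trans
          (update-other (mem s₁) (>⇒≢ (≤-<-trans (≤-reflexive (+-identityʳ B)) (n<1+n B))))
          (trans (K₁ .poked _) (trans (cong (mem s [ B ↦ V ]) (+-identityʳ B)) (update-same (mem s) B)))))
      ; size  = trans (R .intact _) (trans (K₂ .poked _) (trans
          (cong (mem s₁ [ 1 + B ↦ m ]) (+-comm B 1)) (update-same (mem s₁) (1 + B))))
      ; blank = λ a B+2≤a → trans (R .intact a) (trans (K₂ .poked a) (trans
          (update-other (mem s₁) (<⇒≢ (≤-trans (≤-reflexive (+-comm 2 B)) B+2≤a)))
          (trans (K₁ .poked a) (trans
            (update-other (mem s) (<⇒≢ (≤-trans (s≤s (n≤1+n B)) (≤-trans (≤-reflexive (+-comm 2 B)) B+2≤a))))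
            (P .unused a (≤-trans (m≤m+n B 2) B+2≤a)))))) }
      where
      H : Holds params ρ 4 _
      H = kept (poked-holds (n≤1+n B) (poked-holds ≤-refl (P .holds) K₁) K₂) R

  writeGraph-correct : Exec W writeGraph (initial (encodeCNF φ)) (setupTime X + (m * edgeTime X + 1)) Written
  writeGraph-correct = exec-weaken time≤ (exec-seq prepare-correct λ P → exec-seq (size-correct P) λ S →
    exec-map (fill-correct m ≤-refl (S .counter)) λ F → record
      { base   = trans (F .registers 0 (≤ᵇ⇒≤ 1 3 tt)) (S .counter .value 2F)
      ; order  = trans (F .before _ (+-monoʳ-< B (≤ᵇ⇒≤ 1 2 tt))) (S .order)
      ; size   = trans (F .before _ (+-monoʳ-< B (≤ᵇ⇒≤ 2 2 tt))) (S .size)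
      ; lowers = F .lowers
      ; uppers = F .uppers
      ; blank  = λ a ≤a → trans (F .after a ≤a) (S .blank a (≤-trans (+-monoʳ-≤ B (s≤s (s≤s z≤n))) ≤a)) })
    where
    time≤ = ≤-reflexive (sym (+-assoc
      (cost baseᵉ * X ^ nesting baseᵉ +
        (cost clausesᵉ * X ^ nesting clausesᵉ + cost assignmentsᵉ * X ^ nesting assignmentsᵉ)) _ _))

-- Deciding satisfiability

-- Register `offset` is the output register of the relocated program. Truncated subtraction of 2
-- leaves a nonzero difference exactly for estimates of at least 3.
answer : Program
answer = const 1 2 ⨾ arith sub 1 offset 1 ⨾ ifnz 1 (const 0 1) (const 0 0)

answer-correct : ∀ {W s} → 2 < W → reg s offset < W →
                 Exec W answer s 4 (λ s′ → reg s′ 0 ≡ bit (3 ≤ᵇ reg s offset))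
answer-correct {W} {s} 2<W v<W with reg s offset ≤? 2
... | yes v≤2 = _ , _ , ⇓seq (⇓const 2<W) (⇓seq (⇓arith (≤-<-trans (m∸n≤m (reg s offset) 2) v<W))
        (⇓else (m≤n⇒m∸n≡0 v≤2) (⇓const (≤-trans (s≤s z≤n) 2<W)))) , ≤-refl , sym (small v≤2)
  where
  small : ∀ {v} → v ≤ 2 → bit (3 ≤ᵇ v) ≡ 0
  small z≤n             = refl
  small (s≤s z≤n)       = refl
  small (s≤s (s≤s z≤n)) = refl
... | no v≰2 = _ , _ , ⇓seq (⇓const 2<W) (⇓seq (⇓arith (≤-<-trans (m∸n≤m (reg s offset) 2) v<W))
        (⇓then (m>n⇒m∸n≢0 (≰⇒> v≰2)) (⇓const (≤-trans (s≤s (s≤s z≤n)) 2<W)))) , ≤-refl , sym (large (≰⇒> v≰2))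
  where
  large : ∀ {v} → 3 ≤ v → bit (3 ≤ᵇ v) ≡ 1
  large (s≤s (s≤s (s≤s z≤n))) = refl

solve : Program → Program
solve P = writeGraph ⨾ relocate P ⨾ answer

pairs : ∀ {n} → List (Fin n × Fin n) → List ℕ
pairs = concatMap (λ e → toℕ (proj₁ e) ∷ toℕ (proj₂ e) ∷ [])

pairs-cell : ∀ {V} k (f : Fin k → Fin V × Fin V) (g : ℕ → ℕ) →
  (∀ i → g (toℕ i * 2) ≡ toℕ (proj₁ (f i))) → (∀ i → g (1 + toℕ i * 2) ≡ toℕ (proj₂ (f i))) →
  (∀ a → k * 2 ≤ a → g a ≡ 0) → ∀ a → g a ≡ cell (pairs (tabulate f)) a
pairs-cell zero    f g lo hi out a = out a z≤n
pairs-cell (suc k) f g lo hi out zero          = lo zero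
pairs-cell (suc k) f g lo hi out (suc zero)    = hi zero
pairs-cell (suc k) f g lo hi out (suc (suc a)) =
  pairs-cell k (λ i → f (suc i)) (λ a → g (2 + a)) (λ i → lo (suc i)) (λ i → hi (suc i))
    (λ a k≤a → out (2 + a) (s≤s (s≤s k≤a))) a

module Solving {n} (φ : CNF n) {Z W : ℕ} (machine : Machine φ Z W) where

  open Machine machine
  open Split φ
  open Writing φ machine

  written-cell : ∀ {s} → Written s → ∀ a → mem s (B + a) ≡ cell (encodeGraph graph) a
  written-cell w zero          = Written.order w
  written-cell w (suc zero)    = trans (Written.size w) (sym size≡m)
  written-cell {s} w (suc (suc a)) = pairs-cell m edge (λ a → mem s (B + (2 + a)))
    (λ i → trans (Written.lowers w (toℕ i) (Fin.toℕ<n i)) (sym (edge-lower i)))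
    (λ i → trans (Written.uppers w (toℕ i) (Fin.toℕ<n i)) (sym (edge-upper i)))
    (λ a m≤a → Written.blank w _ (+-monoʳ-≤ B (s≤s (s≤s m≤a)))) a

  written-relocated : ∀ {b} → Exec W writeGraph (initial (encodeCNF φ)) b Written →
                      Exec W writeGraph (initial (encodeCNF φ)) b (Relocated B (initial (encodeGraph graph)))
  written-relocated (t , s , p , t≤ , w) = t , s , p , t≤ , record
    { base      = Written.base w
    ; registers = λ r → frame {R = offset} p writeGraph-registers (offset + r) (m≤m+n offset r)
    ; memory    = written-cell w }

  solve-correct : ∀ P {W₀ D̂ t} → 2 < W → B + W₀ ≤ W → 0 < W₀ → Run W₀ P (encodeGraph graph) D̂ t →
    ∃[ t′ ] Run W (solve P) (encodeCNF φ) (bit (3 ≤ᵇ D̂)) t′ × t′ ≤ setupTime X + (m * edgeTime X + 1) + (2 * t + 4)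
  solve-correct P {W₀} {t = t} 2<W fits 0<W₀ (s₀ , p , refl) = run
      (exec-seq (written-relocated writeGraph-correct) λ R →
       exec-seq (simulate fits p (λ _ → 0<W₀) R) λ R′ →
       exec-map (answer-correct 2<W (subst (_< W) (sym (Relocated.registers R′ 0)) output<W))
         λ out → trans out (cong (λ v → bit (3 ≤ᵇ v)) (Relocated.registers R′ 0)))
    where
    output<W : reg s₀ 0 < W
    output<W = <-≤-trans (exec-small p (λ _ → 0<W₀) 0) (m+n≤o⇒n≤o B fits)
    run : ∀ {b v} → Exec W (solve P) (initial (encodeCNF φ)) b (λ s → reg s 0 ≡ v) →
          ∃[ t′ ] Run W (solve P) (encodeCNF φ) v t′ × t′ ≤ b
    run (t′ , s′ , p′ , t′≤ , out) = t′ , (s′ , p′ , out) , t′≤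

-- Growth rates

^-cancelˡ-≤ : ∀ r .{{_ : NonZero r}} {x y} → x ^ r ≤ y ^ r → x ≤ y
^-cancelˡ-≤ r {x} {y} le = ≮⇒≥ λ y<x → <⇒≱ (^-monoˡ-< r y<x) le

^-distrib : ∀ x y r → (x * y) ^ r ≡ x ^ r * y ^ r
^-distrib x y zero    = refl
^-distrib x y (suc r) = trans (cong (x * y *_) (^-distrib x y r)) (interchange x y (x ^ r) (y ^ r))
  where
  interchange : ∀ a b c d → a * b * (c * d) ≡ a * c * (b * d)
  interchange = solve-∀

-- Bernoulli's inequality (1 - 1/(b+1))^r ≥ 1 - r/(b+1), multiplied out.
bernoulli : ∀ b r → suc b ^ suc r ≤ suc b * b ^ r + r * suc b ^ r
bernoulli b zero    = ≤-reflexive (sym (+-identityʳ _))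
bernoulli b (suc r) = begin
  suc b ^ suc r + b * suc b ^ suc r                       ≤⟨ +-monoʳ-≤ (suc b ^ suc r) (*-monoʳ-≤ b (bernoulli b r)) ⟩
  suc b ^ suc r + b * (suc b * b ^ r + r * suc b ^ r)     ≡⟨ rearrange (suc b ^ suc r) b (suc b) (b ^ r) r (suc b ^ r) ⟩
  suc b * (b * b ^ r) + (suc b ^ suc r + r * (b * suc b ^ r)) ≤⟨ +-monoʳ-≤ (suc b * (b * b ^ r))
      (+-monoʳ-≤ (suc b ^ suc r) (*-monoʳ-≤ r (*-monoˡ-≤ (suc b ^ r) (n≤1+n b)))) ⟩
  suc b * b ^ suc r + suc r * suc b ^ suc r               ∎
  where
  open ≤-Reasoning
  rearrange : ∀ s b c x r y → s + b * (c * x + r * y) ≡ c * (b * x) + (s + r * (b * y))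
  rearrange = solve-∀

-- Here b + 1 = 2r, so that the right-hand side of Bernoulli's inequality is 1/2.
half-bernoulli : ∀ b r → suc b ≡ 2 * r → suc b ^ r ≤ 2 * b ^ r
half-bernoulli b r eq = *-cancelˡ-≤ r {{r≢0}} (+-cancelʳ-≤ (r * suc b ^ r) _ _ (begin
  r * suc b ^ r + r * suc b ^ r       ≡⟨ double r (suc b ^ r) ⟩
  2 * r * suc b ^ r                   ≡⟨ cong (_* suc b ^ r) eq ⟨
  suc b ^ suc r                       ≤⟨ bernoulli b r ⟩
  suc b * b ^ r + r * suc b ^ r       ≡⟨ cong (λ x → x * b ^ r + r * suc b ^ r) eq ⟩
  2 * r * b ^ r + r * suc b ^ r       ≡⟨ cong (_+ r * suc b ^ r) (commute r (b ^ r)) ⟩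
  r * (2 * b ^ r) + r * suc b ^ r     ∎))
  where
  open ≤-Reasoning
  r≢0 : NonZero r
  r≢0 = ≢-nonZero λ { refl → contradiction eq λ () }
  double : ∀ r x → r * x + r * x ≡ 2 * r * x
  double = solve-∀
  commute : ∀ r x → 2 * r * x ≡ r * (2 * x)
  commute = solve-∀

-- numer q′ / denom q′ = 2 - 1/(2q) where q = suc q′.
denom numer : ℕ → ℕ
denom q′ = 2 * suc q′
numer q′ = 3 + 4 * q′

-- This is 2^(1 - 1/(2q)) ≤ 2 - 1/(2q) without roots. Doubled, the left-hand side becomes (2d)^(2q)
-- with d = `denom q′`; since 2d = 4q exceeds `numer q′` by 1, `half-bernoulli` applies with r = 2q.
root-bound : ∀ q′ → let q = suc q′ in 2 ^ (1 + 2 * q′) * denom q′ ^ (2 * q) ≤ numer q′ ^ (2 * q)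
root-bound q′ = *-cancelˡ-≤ 2 (begin
  2 * (2 ^ (1 + 2 * q′) * d ^ (2 * q))  ≡⟨ *-assoc 2 (2 ^ (1 + 2 * q′)) (d ^ (2 * q)) ⟨
  2 ^ (2 + 2 * q′) * d ^ (2 * q)        ≡⟨ cong (λ e → 2 ^ e * d ^ (2 * q)) (*-suc 2 q′) ⟨
  2 ^ (2 * q) * d ^ (2 * q)             ≡⟨ ^-distrib 2 d (2 * q) ⟨
  (2 * d) ^ (2 * q)                     ≡⟨ cong (_^ (2 * q)) (four q′) ⟨
  suc (numer q′) ^ (2 * q)              ≤⟨ half-bernoulli (numer q′) (2 * q) (four q′) ⟩
  2 * numer q′ ^ (2 * q)                ∎)
  where
  open ≤-Reasoning
  q = suc q′
  d = denom q′
  four : ∀ q′ → 4 + 4 * q′ ≡ 2 * (2 * suc q′)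
  four = solve-∀

denom≤numer : ∀ q′ → denom q′ ≤ numer q′
denom≤numer q′ = ≤-trans (≤-reflexive (*-suc 2 q′)) (+-mono-≤ {2} {3} (n≤1+n 2) (*-monoˡ-≤ q′ (s≤s (s≤s (z≤n {2})))))

module Growth (q′ n g : ℕ) (g²≤ : g * g ≤ 2 * 2 ^ n) where

  private
    q = suc q′
    d = denom q′
    a = numer q′
    e = 1 + 2 * q′

  open ≤-Reasoning

  -- The cost of writing the graph, about 2^(n/2), must also stay below the rate. This amounts to 2
  -- d² ≤ a²; squaring the claim brings in the bound on g².
  half-growth : g * d ^ n ≤ 2 * a ^ n
  half-growth = ^-cancelˡ-≤ 2 (begin
    (g * d ^ n) ^ 2                    ≡⟨ square g (d ^ n) ⟩
    g * g * (d ^ n * d ^ n)            ≤⟨ *-monoˡ-≤ _ g²≤ ⟩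
    2 * 2 ^ n * (d ^ n * d ^ n)        ≡⟨ *-assoc 2 (2 ^ n) _ ⟩
    2 * (2 ^ n * (d ^ n * d ^ n))      ≡⟨ cong (λ x → 2 * (2 ^ n * x)) (^-distrib d d n) ⟨
    2 * (2 ^ n * (d * d) ^ n)          ≡⟨ cong (2 *_) (^-distrib 2 (d * d) n) ⟨
    2 * (2 * (d * d)) ^ n              ≤⟨ *-monoʳ-≤ 2 (^-monoˡ-≤ n
        (≤-trans (m≤m+n _ (8 * q′ * q′ + 8 * q′ + 1)) (≤-reflexive (difference q′)))) ⟩
    2 * (a * a) ^ n                    ≡⟨ cong (2 *_) (^-distrib a a n) ⟩
    2 * (a ^ n * a ^ n)                ≤⟨ m≤m+n _ _ ⟩
    2 * (a ^ n * a ^ n) + 2 * (a ^ n * a ^ n) ≡⟨ four (a ^ n) ⟩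
    (2 * a ^ n) ^ 2                    ∎)
    where
    square : ∀ x y → (x * y) * ((x * y) * 1) ≡ x * x * (y * y)
    square = solve-∀
    four : ∀ x → 2 * (x * x) + 2 * (x * x) ≡ (2 * x) * ((2 * x) * 1)
    four = solve-∀
    difference : ∀ q′ → 2 * (2 * suc q′ * (2 * suc q′)) + (8 * q′ * q′ + 8 * q′ + 1) ≡ (3 + 4 * q′) * (3 + 4 * q′)
    difference = solve-∀

  -- With m ≤ s g this is the bound C m^(2 - 1/q) = O(s² (2 - 1/(2q))^n).
  time-growth : ∀ {t C m s p} → 1 ≤ p → 1 ≤ m → m ≤ s * g → t ^ q * m ^ p ≤ C ^ q * m ^ (2 * q) →
                t * d ^ n ≤ 2 * C * (s * s) * a ^ n
  time-growth {t} {C} {m} {s} {p} 1≤p 1≤m m≤ time = ^-cancelˡ-≤ (2 * q) (begin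
    (t * d ^ n) ^ (2 * q)                          ≡⟨ ^-distrib t (d ^ n) (2 * q) ⟩
    t ^ (2 * q) * (d ^ n) ^ (2 * q)                ≤⟨ *-monoˡ-≤ _ t²≤ ⟩
    (C * (s * s)) ^ (2 * q) * (2 * 2 ^ n) ^ e * (d ^ n) ^ (2 * q) ≡⟨ *-assoc ((C * (s * s)) ^ (2 * q)) _ _ ⟩
    (C * (s * s)) ^ (2 * q) * ((2 * 2 ^ n) ^ e * (d ^ n) ^ (2 * q)) ≤⟨ *-monoʳ-≤ ((C * (s * s)) ^ (2 * q)) powers≤ ⟩
    (C * (s * s)) ^ (2 * q) * (2 ^ (2 * q) * (a ^ n) ^ (2 * q)) ≡⟨ *-assoc ((C * (s * s)) ^ (2 * q)) _ _ ⟨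
    (C * (s * s)) ^ (2 * q) * 2 ^ (2 * q) * (a ^ n) ^ (2 * q) ≡⟨ cong (_* (a ^ n) ^ (2 * q)) (^-distrib (C * (s * s)) 2 (2 * q)) ⟨
    (C * (s * s) * 2) ^ (2 * q) * (a ^ n) ^ (2 * q) ≡⟨ ^-distrib (C * (s * s) * 2) (a ^ n) (2 * q) ⟨
    (C * (s * s) * 2 * a ^ n) ^ (2 * q)            ≡⟨ cong (λ x → (x * a ^ n) ^ (2 * q)) (shuffle C (s * s)) ⟩
    (2 * C * (s * s) * a ^ n) ^ (2 * q)            ∎)
    where
    shuffle : ∀ x y → x * y * 2 ≡ 2 * x * y
    shuffle = solve-∀
    swap-powers : ∀ x u v → (x ^ u) ^ v ≡ (x ^ v) ^ u
    swap-powers x u v = trans (^-*-assoc x u v) (trans (cong (x ^_) (*-comm u v)) (sym (^-*-assoc x v u)))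
    instance
      m≢0 : NonZero m
      m≢0 = >-nonZero 1≤m
      s≢0 : NonZero s
      s≢0 = ≢-nonZero λ s≡0 → 1+n≰n (subst (λ x → 1 ≤ x * g) s≡0 (≤-trans 1≤m m≤))
    2q≡ : 2 * q ≡ suc e
    2q≡ = *-suc 2 q′
    s^e≤ : s ^ e ≤ s ^ (2 * q)
    s^e≤ = ^-monoʳ-≤ s (≤-trans (n≤1+n e) (≤-reflexive (sym 2q≡)))
    -- Since p ≥ 1, one factor `m` can be cancelled, which leaves m^(2q - 1), where 2q - 1 = e.
    t≤ : t ^ q ≤ C ^ q * (s ^ (2 * q) * g ^ e)
    t≤ = *-cancelʳ-≤ (t ^ q) _ m (begin
      t ^ q * m                       ≡⟨ cong (t ^ q *_) (*-identityʳ m) ⟨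
      t ^ q * m ^ 1                   ≤⟨ *-monoʳ-≤ (t ^ q) (^-monoʳ-≤ m 1≤p) ⟩
      t ^ q * m ^ p                   ≤⟨ time ⟩
      C ^ q * m ^ (2 * q)             ≡⟨ cong (λ x → C ^ q * m ^ x) 2q≡ ⟩
      C ^ q * (m * m ^ e)             ≡⟨ last (C ^ q) m (m ^ e) ⟩
      C ^ q * m ^ e * m               ≤⟨ *-monoˡ-≤ m (*-monoʳ-≤ (C ^ q) (begin
        m ^ e                 ≤⟨ ^-monoˡ-≤ e m≤ ⟩
        (s * g) ^ e           ≡⟨ ^-distrib s g e ⟩
        s ^ e * g ^ e         ≤⟨ *-monoˡ-≤ (g ^ e) s^e≤ ⟩
        s ^ (2 * q) * g ^ e   ∎)) ⟩
      C ^ q * (s ^ (2 * q) * g ^ e) * m ∎)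
      where
      last : ∀ x y z → x * (y * z) ≡ x * z * y
      last = solve-∀
    -- Squared, so that the bound on g² applies.
    t²≤ : t ^ (2 * q) ≤ (C * (s * s)) ^ (2 * q) * (2 * 2 ^ n) ^ e
    t²≤ = begin
      t ^ (2 * q)                       ≡⟨ double t ⟩
      t ^ q * t ^ q                     ≤⟨ *-mono-≤ t≤ t≤ ⟩
      C ^ q * (s ^ (2 * q) * g ^ e) * (C ^ q * (s ^ (2 * q) * g ^ e)) ≡⟨ group (C ^ q) (s ^ (2 * q)) (g ^ e) ⟩
      C ^ q * C ^ q * (s ^ (2 * q) * s ^ (2 * q)) * (g ^ e * g ^ e) ≡⟨ cong₂ _*_
        (cong₂ _*_ (sym (double C)) (sym (^-distrib s s (2 * q)))) (sym (^-distrib g g e)) ⟩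
      C ^ (2 * q) * (s * s) ^ (2 * q) * (g * g) ^ e ≤⟨ *-mono-≤ (≤-reflexive (sym (^-distrib C (s * s) (2 * q)))) (^-monoˡ-≤ e g²≤) ⟩
      (C * (s * s)) ^ (2 * q) * (2 * 2 ^ n) ^ e ∎
      where
      double : ∀ x → x ^ (2 * q) ≡ x ^ q * x ^ q
      double x = trans (cong (λ y → x ^ (q + y)) (+-identityʳ q)) (^-distribˡ-+-* x q q)
      group : ∀ x y z → x * (y * z) * (x * (y * z)) ≡ x * x * (y * y) * (z * z)
      group = solve-∀
    powers≤ : (2 * 2 ^ n) ^ e * (d ^ n) ^ (2 * q) ≤ 2 ^ (2 * q) * (a ^ n) ^ (2 * q)
    powers≤ = begin
      (2 * 2 ^ n) ^ e * (d ^ n) ^ (2 * q)           ≡⟨ cong₂ _*_ (^-distrib 2 (2 ^ n) e) (swap-powers d n (2 * q)) ⟩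
      2 ^ e * (2 ^ n) ^ e * (d ^ (2 * q)) ^ n       ≡⟨ *-assoc (2 ^ e) _ _ ⟩
      2 ^ e * ((2 ^ n) ^ e * (d ^ (2 * q)) ^ n)     ≡⟨ cong (λ x → 2 ^ e * (x * (d ^ (2 * q)) ^ n)) (swap-powers 2 n e) ⟩
      2 ^ e * ((2 ^ e) ^ n * (d ^ (2 * q)) ^ n)     ≡⟨ cong (2 ^ e *_) (^-distrib (2 ^ e) (d ^ (2 * q)) n) ⟨
      2 ^ e * (2 ^ e * d ^ (2 * q)) ^ n             ≤⟨ *-mono-≤
        (^-monoʳ-≤ 2 (≤-trans (n≤1+n e) (≤-reflexive (sym 2q≡)))) (^-monoˡ-≤ n (root-bound q′)) ⟩
      2 ^ (2 * q) * (a ^ (2 * q)) ^ n               ≡⟨ cong (2 ^ (2 * q) *_) (swap-powers a (2 * q) n) ⟩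
      2 ^ (2 * q) * (a ^ n) ^ (2 * q)               ∎

half-square : ∀ n → 2 ^ ((n + 1) / 2) * 2 ^ ((n + 1) / 2) ≤ 2 * 2 ^ n
half-square n = begin
  2 ^ h * 2 ^ h   ≡⟨ ^-distribˡ-+-* 2 h h ⟨
  2 ^ (h + h)     ≤⟨ ^-monoʳ-≤ 2 (begin
    h + h           ≡⟨ cong (h +_) (+-identityʳ h) ⟨
    2 * h           ≡⟨ *-comm 2 h ⟩
    h * 2           ≤⟨ m/n*n≤m (n + 1) 2 ⟩
    n + 1           ≡⟨ +-comm n 1 ⟩
    1 + n           ∎) ⟩
  2 ^ (1 + n)     ∎
  where
  open ≤-Reasoning
  h = (n + 1) / 2

-- Rational bounds

fromℕ-* : ∀ x y → fromℕ (x * y) ≡ fromℕ x ℚ.* fromℕ y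
fromℕ-* x y = ℚ.toℚᵘ-injective (begin-equality
  ℚ.toℚᵘ (fromℕ (x * y))                ≃⟨ ℚ.toℚᵘ-fromℚᵘ (mkℚᵘ (ℤ.+ (x * y)) 0) ⟩
  mkℚᵘ (ℤ.+ (x * y)) 0                  ≃⟨ ℚᵘ.*≡* (cong (ℤ._* ℤ.+ 1) (ℤ.pos-* x y)) ⟩
  mkℚᵘ (ℤ.+ x) 0 ℚᵘ.* mkℚᵘ (ℤ.+ y) 0        ≃⟨ ℚᵘ.*-cong (ℚ.toℚᵘ-fromℚᵘ (mkℚᵘ (ℤ.+ x) 0)) (ℚ.toℚᵘ-fromℚᵘ (mkℚᵘ (ℤ.+ y) 0)) ⟨
  ℚ.toℚᵘ (fromℕ x) ℚᵘ.* ℚ.toℚᵘ (fromℕ y)    ≃⟨ ℚ.toℚᵘ-homo-* (fromℕ x) (fromℕ y) ⟨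
  ℚ.toℚᵘ (fromℕ x ℚ.* fromℕ y)              ∎)
  where open ℚᵘ.≤-Reasoning

fromℕ-suc : ∀ x → fromℕ (suc x) ≡ fromℕ x ℚ.+ ℚ.1ℚ
fromℕ-suc x = ℚ.toℚᵘ-injective (begin-equality
  ℚ.toℚᵘ (fromℕ (suc x))                  ≃⟨ ℚ.toℚᵘ-fromℚᵘ (mkℚᵘ (ℤ.+ suc x) 0) ⟩
  mkℚᵘ (ℤ.+ suc x) 0                      ≃⟨ ℚᵘ.*≡* (cong (ℤ._* ℤ.+ 1)
    (trans (cong ℤ.+_ (+-comm 1 x)) (cong (ℤ._+ ℤ.+ 1) (sym (ℤ.*-identityʳ (ℤ.+ x)))))) ⟩
  mkℚᵘ (ℤ.+ x) 0 ℚᵘ.+ mkℚᵘ (ℤ.+ 1) 0        ≃⟨ ℚᵘ.+-congˡ (ℚ.toℚᵘ ℚ.1ℚ) (ℚ.toℚᵘ-fromℚᵘ (mkℚᵘ (ℤ.+ x) 0)) ⟨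
  ℚ.toℚᵘ (fromℕ x) ℚᵘ.+ ℚ.toℚᵘ ℚ.1ℚ           ≃⟨ ℚ.toℚᵘ-homo-+ (fromℕ x) ℚ.1ℚ ⟨
  ℚ.toℚᵘ (fromℕ x ℚ.+ ℚ.1ℚ)                   ∎)
  where open ℚᵘ.≤-Reasoning

fromℕ-mono-≤ : ∀ {x y} → x ≤ y → fromℕ x ℚ.≤ fromℕ y
fromℕ-mono-≤ {x} {y} x≤y = ℚ.toℚᵘ-cancel-≤ (begin
  ℚ.toℚᵘ (fromℕ x) ≃⟨ ℚ.toℚᵘ-fromℚᵘ (mkℚᵘ (ℤ.+ x) 0) ⟩
  mkℚᵘ (ℤ.+ x) 0   ≤⟨ ℚᵘ.*≤* (ℤ.*-monoʳ-≤-nonNeg (ℤ.+ 1) (ℤ.+≤+ x≤y)) ⟩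
  mkℚᵘ (ℤ.+ y) 0   ≃⟨ ℚ.toℚᵘ-fromℚᵘ (mkℚᵘ (ℤ.+ y) 0) ⟨
  ℚ.toℚᵘ (fromℕ y) ∎)
  where open ℚᵘ.≤-Reasoning

fromℕ-positive : ∀ x .{{_ : NonZero x}} → ℚ.Positive (fromℕ x)
fromℕ-positive x = ℚ.normalize-pos x 1

module _ (q′ : ℕ) where

  -- The δ of the conclusion: 1/(2q) for an ε with denominator q.
  saving : ℚ.ℚ
  saving = ℤ.+ 1 ℚ./ denom q′

  saving>0 : ℚ.0ℚ ℚ.< saving
  saving>0 = ℚ.positive⁻¹ saving {{ℚ.normalize-pos 1 (denom q′)}}

  saving-denom : saving ℚ.* fromℕ (denom q′) ≡ ℚ.1ℚ
  saving-denom = ℚ.toℚᵘ-injective (begin-equality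
    ℚ.toℚᵘ (saving ℚ.* fromℕ (denom q′))              ≃⟨ ℚ.toℚᵘ-homo-* saving (fromℕ (denom q′)) ⟩
    ℚ.toℚᵘ saving ℚᵘ.* ℚ.toℚᵘ (fromℕ (denom q′))      ≃⟨ ℚᵘ.*-cong
      (ℚ.toℚᵘ-fromℚᵘ (mkℚᵘ (ℤ.+ 1) (pred (denom q′)))) (ℚ.toℚᵘ-fromℚᵘ (mkℚᵘ (ℤ.+ denom q′) 0)) ⟩
    mkℚᵘ (ℤ.+ 1) (pred (denom q′)) ℚᵘ.* mkℚᵘ (ℤ.+ denom q′) 0 ≃⟨ ℚᵘ.*≡* (trans (ℤ.*-identityʳ _)
      (trans (ℤ.*-comm (ℤ.+ 1) (ℤ.+ denom q′)) (sym (ℤ.*-identityˡ _)))) ⟩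
    ℚ.toℚᵘ ℚ.1ℚ ∎)
    where open ℚᵘ.≤-Reasoning

  saving<2 : saving ℚ.< fromℕ 2
  saving<2 = ℚ.≤-<-trans saving≤1 (toWitness {a? = ℚ.1ℚ ℚ.<? fromℕ 2} tt)
    where
    saving≤1 : saving ℚ.≤ ℚ.1ℚ
    saving≤1 = ℚ.*-cancelʳ-≤-pos (fromℕ (denom q′)) {{fromℕ-positive (denom q′)}}
      (subst₂ ℚ._≤_ (sym saving-denom) (sym (ℚ.*-identityˡ _)) (fromℕ-mono-≤ {1} {denom q′} (s≤s z≤n)))

  rate : ℚ.ℚ
  rate = fromℕ 2 ℚ.- saving

  rate-denom : rate ℚ.* fromℕ (denom q′) ≡ fromℕ (numer q′)
  rate-denom = begin
    (fromℕ 2 ℚ.- saving) ℚ.* d              ≡⟨ ℚ.*-distribʳ-+ d (fromℕ 2) (ℚ.- saving) ⟩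
    fromℕ 2 ℚ.* d ℚ.+ ℚ.- saving ℚ.* d          ≡⟨ cong₂ ℚ._+_ (sym (fromℕ-* 2 (denom q′))) (sym (ℚ.neg-distribˡ-* saving d)) ⟩
    fromℕ (2 * denom q′) ℚ.- saving ℚ.* d ≡⟨ cong₂ (λ x y → fromℕ x ℚ.- y) (sym (four q′)) saving-denom ⟩
    fromℕ (suc (numer q′)) ℚ.- ℚ.1ℚ         ≡⟨ cong (ℚ._- ℚ.1ℚ) (fromℕ-suc (numer q′)) ⟩
    fromℕ (numer q′) ℚ.+ ℚ.1ℚ ℚ.- ℚ.1ℚ          ≡⟨ ℚ.+-assoc (fromℕ (numer q′)) ℚ.1ℚ (ℚ.- ℚ.1ℚ) ⟩
    fromℕ (numer q′) ℚ.+ (ℚ.1ℚ ℚ.- ℚ.1ℚ)        ≡⟨ ℚ.+-identityʳ _ ⟩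
    fromℕ (numer q′)                    ∎
    where
    open ≡-Reasoning
    d = fromℕ (denom q′)
    four : ∀ q′ → 4 + 4 * q′ ≡ 2 * (2 * suc q′)
    four q′ = trans (sym (*-suc 4 q′)) (*-assoc 2 2 (suc q′))

  rate-power : ∀ n → rate ^ℚ n ℚ.* fromℕ (denom q′ ^ n) ≡ fromℕ (numer q′ ^ n)
  rate-power zero    = refl
  rate-power (suc n) = begin
    rate ℚ.* rate ^ℚ n ℚ.* fromℕ (d * d ^ n)            ≡⟨ cong (rate ℚ.* rate ^ℚ n ℚ.*_) (fromℕ-* d (d ^ n)) ⟩
    rate ℚ.* rate ^ℚ n ℚ.* (fromℕ d ℚ.* fromℕ (d ^ n))      ≡⟨ ℚ.*-assoc rate (rate ^ℚ n) _ ⟩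
    rate ℚ.* (rate ^ℚ n ℚ.* (fromℕ d ℚ.* fromℕ (d ^ n)))    ≡⟨ cong (rate ℚ.*_) (ℚ.*-assoc (rate ^ℚ n) (fromℕ d) _) ⟨
    rate ℚ.* (rate ^ℚ n ℚ.* fromℕ d ℚ.* fromℕ (d ^ n))      ≡⟨ cong (λ x → rate ℚ.* (x ℚ.* fromℕ (d ^ n))) (ℚ.*-comm (rate ^ℚ n) (fromℕ d)) ⟩
    rate ℚ.* (fromℕ d ℚ.* rate ^ℚ n ℚ.* fromℕ (d ^ n))      ≡⟨ cong (rate ℚ.*_) (ℚ.*-assoc (fromℕ d) (rate ^ℚ n) _) ⟩
    rate ℚ.* (fromℕ d ℚ.* (rate ^ℚ n ℚ.* fromℕ (d ^ n)))    ≡⟨ ℚ.*-assoc rate (fromℕ d) _ ⟨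
    rate ℚ.* fromℕ d ℚ.* (rate ^ℚ n ℚ.* fromℕ (d ^ n))      ≡⟨ cong₂ ℚ._*_ rate-denom (rate-power n) ⟩
    fromℕ (numer q′) ℚ.* fromℕ (numer q′ ^ n)           ≡⟨ fromℕ-* (numer q′) (numer q′ ^ n) ⟨
    fromℕ (numer q′ ^ suc n)                          ∎
    where
    open ≡-Reasoning
    d = denom q′

  power-bound : ∀ {t F} n → t * denom q′ ^ n ≤ F * numer q′ ^ n → fromℕ t ℚ.≤ fromℕ F ℚ.* rate ^ℚ n
  power-bound {t} {F} n le = ℚ.*-cancelʳ-≤-pos (fromℕ (d ^ n)) {{fromℕ-positive (d ^ n) {{m^n≢0 d n}}}} (begin
    fromℕ t ℚ.* fromℕ (d ^ n)              ≡⟨ fromℕ-* t (d ^ n) ⟨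
    fromℕ (t * d ^ n)                  ≤⟨ fromℕ-mono-≤ le ⟩
    fromℕ (F * numer q′ ^ n)           ≡⟨ fromℕ-* F (numer q′ ^ n) ⟩
    fromℕ F ℚ.* fromℕ (numer q′ ^ n)       ≡⟨ cong (fromℕ F ℚ.*_) (rate-power n) ⟨
    fromℕ F ℚ.* (rate ^ℚ n ℚ.* fromℕ (d ^ n)) ≡⟨ ℚ.*-assoc (fromℕ F) (rate ^ℚ n) _ ⟨
    fromℕ F ℚ.* rate ^ℚ n ℚ.* fromℕ (d ^ n)  ∎)
    where
    open ℚ.≤-Reasoning
    d = denom q′

numerator≥1 : ∀ {ε} → ℚ.0ℚ ℚ.< ε → 1 ≤ ℤ.∣ ℚ.↥ ε ∣
numerator≥1 {ℚ.mkℚ (ℤ.+ zero) _ _}    (ℚ.*<* (ℤ.+<+ ()))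
numerator≥1 {ℚ.mkℚ ℤ.+[1+ _ ] _ _}    _ = s≤s z≤n
numerator≥1 {ℚ.mkℚ ℤ.-[1+ _ ] _ _}  (ℚ.*<* ())

-- If D̂ ≤ 2, then (3/2 - ε) D̂ < 3 ≤ D, against the lower bound on the estimate. The case D̂ = 0 is
-- separate because multiplying 3/2 - ε < 3/2 by 0 is not strict.
estimate-gap : ∀ {ε D D̂} → ℚ.0ℚ ℚ.< ε → IsEstimate ε D D̂ → 3 ≤ D → 3 ≤ D̂
estimate-gap {ε} {D} {D̂} ε>0 (D≤ , _) 3≤D = ≮⇒≥ (λ D̂<3 → ℚ.<-irrefl refl (ℚ.≤-<-trans
  (ℚ.≤-trans (fromℕ-mono-≤ 3≤D) D≤) (small D̂ (s≤s⁻¹ D̂<3))))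
  where
  ratio< : (ℤ.+ 3 ℚ./ 2) ℚ.- ε ℚ.< ℤ.+ 3 ℚ./ 2
  ratio< = subst ((ℤ.+ 3 ℚ./ 2) ℚ.- ε ℚ.<_) (ℚ.+-identityʳ (ℤ.+ 3 ℚ./ 2)) (ℚ.+-monoʳ-< (ℤ.+ 3 ℚ./ 2) (ℚ.neg-antimono-< ε>0))
  small : ∀ D̂ → D̂ ≤ 2 → ((ℤ.+ 3 ℚ./ 2) ℚ.- ε) ℚ.* fromℕ D̂ ℚ.< fromℕ 3
  small 0 _ = subst (ℚ._< fromℕ 3) (sym (ℚ.*-zeroʳ ((ℤ.+ 3 ℚ./ 2) ℚ.- ε))) (toWitness {a? = ℚ.0ℚ ℚ.<? fromℕ 3} tt)
  small 1 _ = ℚ.<-≤-trans (ℚ.*-monoˡ-<-pos (fromℕ 1) ratio<) (toWitness {a? = (ℤ.+ 3 ℚ./ 2) ℚ.* fromℕ 1 ℚ.≤? fromℕ 3} tt)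
  small 2 _ = ℚ.<-≤-trans (ℚ.*-monoˡ-<-pos (fromℕ 2) ratio<) (toWitness {a? = (ℤ.+ 3 ℚ./ 2) ℚ.* fromℕ 2 ℚ.≤? fromℕ 3} tt)
  small (suc (suc (suc _))) (s≤s (s≤s ()))

-- The reduction

-- A single monomial, as `DecidesSAT` asks for. Monomials are combined by adding exponents, and
-- powers of `S` grow with the exponent only for S ≥ 1.
Polynomial : (ℕ → ℕ) → Set
Polynomial f = ∃[ A ] ∃[ e ] ∀ S → 1 ≤ S → f S ≤ A * S ^ e

poly-const : ∀ k → Polynomial (λ _ → k)
poly-const k = k , 0 , λ _ _ → ≤-reflexive (sym (*-identityʳ k))

poly-id : Polynomial (λ S → S)
poly-id = 1 , 1 , λ S _ → ≤-reflexive (sym (trans (*-identityˡ (S * 1)) (*-identityʳ S)))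

poly-+ : ∀ {f g} → Polynomial f → Polynomial g → Polynomial (λ S → f S + g S)
poly-+ {f} {g} (A , e , f≤) (A′ , e′ , g≤) = A + A′ , e + e′ , λ S 1≤S → begin
  f S + g S                                  ≤⟨ +-mono-≤ (f≤ S 1≤S) (g≤ S 1≤S) ⟩
  A * S ^ e + A′ * S ^ e′                    ≤⟨ +-mono-≤
      (*-monoʳ-≤ A (^-monoʳ-≤ S {{>-nonZero 1≤S}} (m≤m+n e e′)))
      (*-monoʳ-≤ A′ (^-monoʳ-≤ S {{>-nonZero 1≤S}} (m≤n+m e′ e))) ⟩
  A * S ^ (e + e′) + A′ * S ^ (e + e′)       ≡⟨ *-distribʳ-+ (S ^ (e + e′)) A A′ ⟨
  (A + A′) * S ^ (e + e′)                    ∎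
  where open ≤-Reasoning

poly-* : ∀ {f g} → Polynomial f → Polynomial g → Polynomial (λ S → f S * g S)
poly-* {f} {g} (A , e , f≤) (A′ , e′ , g≤) = A * A′ , e + e′ , λ S 1≤S → begin
  f S * g S                          ≤⟨ *-mono-≤ (f≤ S 1≤S) (g≤ S 1≤S) ⟩
  A * S ^ e * (A′ * S ^ e′)          ≡⟨ interchange A (S ^ e) A′ (S ^ e′) ⟩
  A * A′ * (S ^ e * S ^ e′)          ≡⟨ cong (A * A′ *_) (^-distribˡ-+-* S e e′) ⟨
  A * A′ * S ^ (e + e′)              ∎
  where
  open ≤-Reasoning
  interchange : ∀ a b c d → a * b * (c * d) ≡ a * c * (b * d)
  interchange = solve-∀

poly-^ : ∀ {f} → Polynomial f → ∀ k → Polynomial (λ S → f S ^ k)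
poly-^ pf zero    = poly-const 1
poly-^ pf (suc k) = poly-* pf (poly-^ pf k)

poly-term : ∀ c k → Polynomial (λ S → c * (2 * S) ^ k)
poly-term c k = poly-* (poly-const c) (poly-^ (poly-* (poly-const 2) poly-id) k)

exp-poly : ∀ {k} (e : Exp k) → Polynomial (λ S → cost e * (2 * S) ^ nesting e)
exp-poly e = poly-term (cost e) (nesting e)

poke-poly : ∀ {k} (a e : Exp k) → Polynomial (λ S → (cost a + (cost e + 1)) * (2 * S) ^ (nesting a + nesting e))
poke-poly a e = poly-term (cost a + (cost e + 1)) (nesting a + nesting e)

setup-poly : Polynomial (λ S → setupTime (2 * S))
setup-poly = poly-+ (poly-+ (exp-poly baseᵉ) (poly-+ (exp-poly clausesᵉ) (exp-poly assignmentsᵉ)))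
                    (poly-+ (poke-poly base₀ orderᵉ) (poly-+ (poke-poly base₁ sizeᵉ) (exp-poly sizeᵉ)))

edge-poly : Polynomial (λ S → edgeTime (2 * S))
edge-poly = poly-+ (poly-const 3) (poly-+ (poke-poly slot₀ lowerᵉ) (poke-poly slot₁ upperᵉ))

-- The coefficient that `combine-times` yields for s = 11 S, where 11 S 2^h bounds the number of
-- edges, and R = 2 C s², the bound of `time-growth` on the simulated run.
overhead : ℕ → ℕ → ℕ
overhead C S = setupTime (2 * S) + 5 + 2 * (11 * S * edgeTime (2 * S)) + 2 * (2 * C * (11 * S * (11 * S)))

abstract
  overhead-poly : ∀ C → Polynomial (overhead C)
  overhead-poly C = poly-+ (poly-+ (poly-+ setup-poly (poly-const 5)) (poly-* (poly-const 2) (poly-* s edge-poly)))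
                           (poly-* (poly-const 2) (poly-* (poly-const (2 * C)) (poly-* s s)))
    where
    s : Polynomial (λ S → 11 * S)
    s = poly-* (poly-const 11) poly-id

combine-times : ∀ {T σ m e t d a g s R} → T ≤ σ + (m * e + 1) + (2 * t + 4) → m ≤ s * g →
  g * d ≤ 2 * a → t * d ≤ R * a → d ≤ a → T * d ≤ (σ + 5 + 2 * (s * e) + 2 * R) * a
combine-times {T} {σ} {m} {e} {t} {d} {a} {g} {s} {R} T≤ m≤ gd≤ td≤ d≤ = begin
  T * d                                              ≤⟨ *-monoˡ-≤ d T≤ ⟩
  (σ + (m * e + 1) + (2 * t + 4)) * d                ≤⟨ *-monoˡ-≤ d
    (+-monoˡ-≤ (2 * t + 4) (+-monoʳ-≤ σ (+-monoˡ-≤ 1 (*-monoˡ-≤ e m≤)))) ⟩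
  (σ + (s * g * e + 1) + (2 * t + 4)) * d            ≡⟨ expand σ s g e t d ⟩
  (σ + 5) * d + s * e * (g * d) + 2 * (t * d)        ≤⟨ +-mono-≤
    (+-mono-≤ (*-monoʳ-≤ (σ + 5) d≤) (*-monoʳ-≤ (s * e) gd≤)) (*-monoʳ-≤ 2 td≤) ⟩
  (σ + 5) * a + s * e * (2 * a) + 2 * (R * a)        ≡⟨ collect σ s e R a ⟩
  (σ + 5 + 2 * (s * e) + 2 * R) * a                  ∎
  where
  open ≤-Reasoning
  expand : ∀ σ s g e t d → (σ + (s * g * e + 1) + (2 * t + 4)) * d ≡ (σ + 5) * d + s * e * (g * d) + 2 * (t * d)
  expand = solve-∀
  collect : ∀ σ s e R a → (σ + 5) * a + s * e * (2 * a) + 2 * (R * a) ≡ (σ + 5 + 2 * (s * e) + 2 * R) * a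
  collect = solve-∀

-- Sizes and word ranges

module Sizes {n} (φ : CNF n) where

  open Formula φ using (L; M)
  open Split φ
  open Evaluation φ using (size#; M+2≤L)

  g U : ℕ
  g = 2 ^ h
  U = 2 + 2 ^ n * size#

  L≤S : L ≤ size#
  L≤S = m≤n+m L n

  M<S : suc M ≤ size#
  M<S = ≤-trans (n≤1+n (suc M)) (≤-trans M+2≤L L≤S)

  S≥1 : 1 ≤ size#
  S≥1 = ≤-trans (s≤s z≤n) L≤S

  g≥1 : 1 ≤ g
  g≥1 = m^n>0 2 h

  -- Hub edges contribute at most 9 (M + 1) and rows 2 g (M + 1), whence the constant 11.
  m-≤ : m ≤ 11 * size# * g
  m-≤ = begin
    3 + M * 3 * 2 + N * suc M                     ≡⟨ cong (λ N → 3 + M * 3 * 2 + N * suc M) N≡ ⟩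
    3 + M * 3 * 2 + 2 * g * suc M                 ≤⟨ +-monoˡ-≤ (2 * g * suc M) (≤-trans (m≤m+n _ (6 + 3 * M)) (≤-reflexive (nine M))) ⟩
    9 * suc M * 1 + 2 * g * suc M                 ≤⟨ +-mono-≤ (*-mono-≤ (*-monoʳ-≤ 9 M<S) g≥1) (*-monoʳ-≤ (2 * g) M<S) ⟩
    9 * size# * g + 2 * g * size#                 ≡⟨ eleven size# g ⟩
    11 * size# * g                                ∎
    where
    open ≤-Reasoning
    nine : ∀ M → 3 + M * 3 * 2 + (6 + 3 * M) ≡ 9 * suc M * 1
    nine = solve-∀
    eleven : ∀ S g → 9 * S * g + 2 * g * S ≡ 11 * S * g
    eleven = solve-∀

  2^n≥1 : 1 ≤ 2 ^ n
  2^n≥1 = m^n>0 2 n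

  S≤ : size# ≤ 2 ^ n * size#
  S≤ = m≤n*m size# (2 ^ n) {{>-nonZero 2^n≥1}}

  S≤U : size# ≤ U
  S≤U = ≤-trans S≤ (m≤n+m _ 2)

  4≤U : 4 ≤ U
  4≤U = s≤s (s≤s (≤-trans (≤-trans (s≤s (s≤s z≤n)) L≤S) S≤))

  h≤n : h ≤ n
  h≤n = half n
    where
    half : ∀ n → (n + 1) / 2 ≤ n
    half zero    = z≤n
    half (suc n) = ≤-trans (/-monoˡ-≤ 2 (≤-trans (m≤m+n (suc n + 1) n) (≤-reflexive (two n)))) (≤-reflexive (m*n/n≡m (suc n) 2))
      where
      two : ∀ n → suc n + 1 + n ≡ suc n * 2
      two = solve-∀

  g≤U : g ≤ U
  g≤U = ≤-trans (^-monoʳ-≤ 2 h≤n) (≤-trans (m≤m*n (2 ^ n) size# {{>-nonZero S≥1}}) (m≤n+m _ 2))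

  N≤2U : N ≤ 2 * U
  N≤2U = ≤-trans (≤-reflexive N≡) (*-monoʳ-≤ 2 g≤U)

  -- Bounds the word range (2 + V + m)^c of the given program on this graph by U^(4c), where `U` is
  -- the base of the word range for the formula.
  graph-≤ : 2 + (V + m) ≤ U ^ 4
  graph-≤ = begin
    2 + (3 + M * 3 + N + (3 + M * 3 * 2 + N * suc M)) ≤⟨ m≤m+n _ (M + 1) ⟩
    2 + (3 + M * 3 + N + (3 + M * 3 * 2 + N * suc M)) + (M + 1) ≡⟨ collect M N ⟩
    suc M * 9 + M + N + N * suc M                     ≤⟨ +-mono-≤
      (+-mono-≤ (+-mono-≤ (*-monoˡ-≤ 9 M<U) (≤-trans (n≤1+n M) M<U)) N≤2U) (*-mono-≤ N≤2U M<U) ⟩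
    U * 9 + U + 2 * U + 2 * U * U                     ≤⟨ +-monoˡ-≤ (2 * U * U) (≤-reflexive (twelve U)) ⟩
    12 * U * 1 + 2 * U * U                            ≤⟨ +-monoˡ-≤ (2 * U * U) (*-monoʳ-≤ (12 * U) (≤-trans (s≤s z≤n) 4≤U)) ⟩
    12 * U * U + 2 * U * U                            ≤⟨ m≤m+n _ (2 * U * U) ⟩
    12 * U * U + 2 * U * U + 2 * U * U                ≡⟨ sixteen U ⟩
    4 * 4 * (U * U)                                   ≤⟨ *-monoˡ-≤ (U * U) (*-mono-≤ 4≤U 4≤U) ⟩
    U * U * (U * U)                                   ≡⟨ fourth U ⟩
    U ^ 4                                             ∎
    where
    open ≤-Reasoning
    M<U : suc M ≤ U
    M<U = ≤-trans M<S S≤U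
    collect : ∀ M N → 2 + (3 + M * 3 + N + (3 + M * 3 * 2 + N * suc M)) + (M + 1) ≡ suc M * 9 + M + N + N * suc M
    collect = solve-∀
    twelve : ∀ U → U * 9 + U + 2 * U ≡ 12 * U * 1
    twelve = solve-∀
    sixteen : ∀ U → 12 * U * U + 2 * U * U + 2 * U * U ≡ 4 * 4 * (U * U)
    sixteen = solve-∀
    fourth : ∀ U → U * U * (U * U) ≡ U * (U * (U * (U * 1)))
    fourth = solve-∀

  instance
    U≢0 : NonZero U
    U≢0 = _

  machine : ∀ {c′} → 12001 ≤ c′ → Machine φ (2 * U) (U ^ c′)
  machine {c′} c′≥ = record
    { X≤Z  = *-monoʳ-≤ 2 S≤U
    ; N≤Z  = N≤2U
    ; L<Z  = ≤-trans (s≤s (≤-trans L≤S S≤)) (≤-trans (n≤1+n _) (m≤m+n U _))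
    ; room = λ p p≤ → begin-strict
        (2 * U) ^ p   ≤⟨ ^-monoˡ-≤ p (*-monoˡ-≤ U (≤-trans (s≤s (s≤s z≤n)) 4≤U)) ⟩
        (U * U) ^ p   ≡⟨ ^-distrib U U p ⟩
        U ^ p * U ^ p ≡⟨ ^-distribˡ-+-* U p p ⟨
        U ^ (p + p)   <⟨ ^-monoʳ-< U (≤-trans (s≤s (s≤s z≤n)) 4≤U) (<-≤-trans (s≤s (+-mono-≤ p≤ p≤)) c′≥) ⟩
        U ^ c′        ∎ }
    where open ≤-Reasoning

  2<U^ : ∀ {c′} → 1 ≤ c′ → 2 < U ^ c′
  2<U^ c′≥ = ≤-trans (≤-trans (s≤s (s≤s (s≤s z≤n))) 4≤U) (≤-trans (≤-reflexive (sym (*-identityʳ U))) (^-monoʳ-≤ U c′≥))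

  -- The formula and the simulated memory must be addressable together. Two spare powers of `U`
  -- absorb the base address and the factor 2 from adding two terms.
  fits : ∀ c {c′} → 2 + 4 * c ≤ c′ → suc L + (2 + (V + m)) ^ c ≤ U ^ c′
  fits c {c′} c′≥ = begin
    suc L + (2 + (V + m)) ^ c         ≤⟨ +-mono-≤ (≤-trans (s≤s (≤-trans L≤S S≤)) (n≤1+n _)) (^-monoˡ-≤ c graph-≤) ⟩
    U + (U ^ 4) ^ c                   ≡⟨ cong (U +_) (^-*-assoc U 4 c) ⟩
    U + U ^ (4 * c)                   ≤⟨ +-mono-≤ (m≤m*n U (U ^ (4 * c)) {{m^n≢0 U (4 * c)}}) (m≤n*m (U ^ (4 * c)) U) ⟩
    U ^ (1 + 4 * c) + U ^ (1 + 4 * c) ≡⟨ cong (U ^ (1 + 4 * c) +_) (+-identityʳ _) ⟨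
    2 * U ^ (1 + 4 * c)               ≤⟨ *-monoˡ-≤ (U ^ (1 + 4 * c)) (≤-trans (s≤s (s≤s z≤n)) 4≤U) ⟩
    U ^ (2 + 4 * c)                   ≤⟨ ^-monoʳ-≤ U c′≥ ⟩
    U ^ c′                            ∎
    where open ≤-Reasoning

  running-time : ∀ q′ {p C t T} → 1 ≤ p → t ^ suc q′ * m ^ p ≤ C ^ suc q′ * m ^ (2 * suc q′) →
    T ≤ setupTime (2 * size#) + (m * edgeTime (2 * size#) + 1) + (2 * t + 4) →
    T * denom q′ ^ n ≤ overhead C size# * numer q′ ^ n
  running-time q′ {C = C} {t} 1≤p time T≤ =
    combine-times {σ = setupTime (2 * size#)} {m} {edgeTime (2 * size#)} {t} {denom q′ ^ n} {numer q′ ^ n} {g}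
      {11 * size#} {2 * C * (11 * size# * (11 * size#))}
      T≤ m-≤ half-growth (time-growth {t} {C} {m} {11 * size#} 1≤p (s≤s z≤n) m-≤ time) (^-monoˡ-≤ n (denom≤numer q′))
    where open Growth q′ n g (half-square n)

Approximates : ℚ.ℚ → Program → ℕ → ℕ → Set
Approximates ε P c C = (G : Graph) → let open Graph G in ∀ D → IsDiameter D → ∃[ D̂ ] ∃[ t ]
  Run (wordRange c (order + size)) P (encodeGraph G) D̂ t × IsEstimate ε D D̂ × TimeBound ε C size t

module Reduction {ε : ℚ.ℚ} (ε>0 : ℚ.0ℚ ℚ.< ε) {P : Program} {c C : ℕ} (approximates : Approximates ε P c C) where

  -- 12001 covers the words needed for writing the graph (Z = 2U ≤ U² and
  -- exponents up to 6000), 2 + 4c those of the relocated program.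
  q′ c′ : ℕ
  q′ = ℚ.ℚ.denominator-1 ε
  c′ = 12001 ⊔ (2 + 4 * c)

  c′≥ : 12001 ≤ c′
  c′≥ = m≤m⊔n 12001 (2 + 4 * c)

  record Outcome {n} (φ : CNF n) : Set where
    field
      {D D̂ t}  : ℕ
      isDiam   : Graph.IsDiameter (Split.graph φ) D
      estimate : IsEstimate ε D D̂
      time     : TimeBound ε C (Split.m φ) t
      {τ}      : ℕ
      run      : Run (Sizes.U φ ^ c′) (solve P) (encodeCNF φ) (bit (3 ≤ᵇ D̂)) τ
      total    : τ ≤ setupTime (2 * formulaSize φ) + (Split.m φ * edgeTime (2 * formulaSize φ) + 1) + (2 * t + 4)

  outcome : ∀ {n} (φ : CNF n) → Outcome φ
  outcome φ =
    let D , isD = gadget-diameter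
        D̂ , t , run , estimate , time = approximates graph D isD
        τ , run′ , total = solve-correct P (2<U^ (≤-trans (s≤s z≤n) c′≥))
          (subst (λ k → suc (Formula.L φ) + (2 + (V + k)) ^ c ≤ U ^ c′) (sym size≡m) (fits c (m≤n⊔m 12001 (2 + 4 * c))))
          (m^n>0 (2 + (V + Graph.size graph)) c) run
    in record { t = t ; isDiam = isD ; estimate = estimate ; time = subst (λ k → TimeBound ε C k t) size≡m time
              ; run = run′ ; total = total }
    where
    open Split φ
    open Sizes φ
    open Solving φ (machine c′≥)

  answer⇔satisfiable : ∀ {n} (φ : CNF n) (o : Outcome φ) → let open Outcome o in (3 ≤ᵇ D̂) ≡ true ⇔ Satisfiable φ
  answer⇔satisfiable φ o = mk⇔
    (λ large → Split.cover⇒satisfiable φ (Split.diameter≥3⇒cover φ isDiam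
       (≤-trans (≤ᵇ⇒≤ 3 D̂ (Equivalence.from Bool.T-≡ large)) (proj₂ estimate))))
    (λ sat → Equivalence.to Bool.T-≡ (≤⇒≤ᵇ (estimate-gap ε>0 estimate
       (Split.cover⇒diameter≥3 φ isDiam (Split.satisfiable⇒cover φ sat)))))
    where open Outcome o

  time-bound : ∀ {n} (φ : CNF n) (o : Outcome φ) → let open Outcome o in
               τ * denom q′ ^ n ≤ overhead C (formulaSize φ) * numer q′ ^ n
  time-bound φ o = Sizes.running-time φ q′ {C = C} {t} (numerator≥1 ε>0) time total
    where open Outcome o

  decides : DecidesSAT (saving q′) (solve P)
  decides = c′ , A , e , λ n φ → decide n φ (outcome φ)
    where
    A e : ℕ
    A = proj₁ (overhead-poly C)
    e = proj₁ (proj₂ (overhead-poly C))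
    overhead≤ : ∀ S → 1 ≤ S → overhead C S ≤ A * S ^ e
    overhead≤ = proj₂ (proj₂ (overhead-poly C))
    decide : ∀ n (φ : CNF n) → Outcome φ → ∃[ b ] ∃[ t ]
      Run (wordRange c′ (2 ^ n * formulaSize φ)) (solve P) (encodeCNF φ) (bit b) t ×
      (b ≡ true ⇔ Satisfiable φ) × fromℕ t ℚ.≤ fromℕ (A * formulaSize φ ^ e) ℚ.* rate q′ ^ℚ n
    decide n φ o = (3 ≤ᵇ D̂) , τ , run , answer⇔satisfiable φ o ,
      power-bound q′ {τ} {A * formulaSize φ ^ e} n (≤-trans (time-bound φ o)
        (*-monoˡ-≤ (numer q′ ^ n) (overhead≤ (formulaSize φ) (Sizes.S≥1 φ))))
      where open Outcome o

theorem1 : ∃[ ε ] (ℚ.0ℚ ℚ.< ε × ∃[ P ] ApproximatesDiameter ε P) →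
    ∃[ δ ] (ℚ.0ℚ ℚ.< δ × δ ℚ.< fromℕ 2 × ∃[ P ] DecidesSAT δ P)
theorem1 (ε , ε>0 , P , c , C , approximates) =
  saving q′ , saving>0 q′ , saving<2 q′ , solve P , decides
  where open Reduction ε>0 {P} {c} {C} approximates
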